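{- For all integers $r\ge 2$ and every real $\beta > 0$, there exist an integer $D_{\beta}$ and a real $\alpha > 0$ such that the following holds for all $D\ge D_{\beta}$. Let $G$ be an $r$-uniform multi-hypergraph in which every pair of distinct vertices has codegree at most $D^{1-\beta}$, whose edges are (not necessarily properly) colored so that each color class is a disjoint union of non-trivial cliques and spans at least $rD(1+D^{ -\alpha})$ vertices, and such that each vertex is incident with edges of at most $D$ distinct colors. Then $G$ has a full rainbow matching, and indeed even a set of $D$ pairwise edge-disjoint full rainbow matchings.
   Context: A multi-hypergraph has a vertex set and a multiset of subsets (edges); $r$-uniform means all edges have size exactly $r$; codegrees count multiplicity. A (non-trivial) clique in an $r$-uniform hypergraph is the set of all $r$-element subsets of a vertex set $K$ with $|K|\ge r$; a color class (the set of edges of a given color) is a disjoint union of non-trivial cliques if it is the union of such cliques on pairwise disjoint vertex sets. The number of vertices spanned by a color class is the number of vertices lying in at least one of its edges. A matching is rainbow if its edges have distinct colors, and full if every color used by the coloring appears on one of its edges. -}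

module Defs where

open import Data.Nat using (ℕ; zero; suc; _+_; _*_; _∸_; _^_; _≤_)
open import Data.Bool using (Bool; true; false; _∧_; _∨_; if_then_else_)
open import Data.Fin using (Fin; zero; suc)
open import Data.Fin.Properties using (_≟_)
open import Data.Fin.Subset using (Subset; _∈_; _⊆_; ∣_∣)
open import Data.Vec using (tabulate; lookup)
open import Data.Vec.Properties using (≡-dec)
import Data.Bool.Properties as B
open import Data.Product using (Σ; ∃; _×_; _,_)
open import Data.Empty using (⊥)
open import Relation.Nullary using (¬_; does)
open import Relation.Binary.PropositionalEquality using (_≡_; _≢_)

anyF : ∀ {m} → (Fin m → Bool) → Bool
anyF {zero} f = false
anyF {suc m} f = f zero ∨ anyF (λ i → f (suc i))

countF : ∀ {m} → (Fin m → Bool) → ℕ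
countF f = ∣ tabulate f ∣

Disjoint : ∀ {n} → Subset n → Subset n → Set
Disjoint A B = ∀ v → v ∈ A → v ∈ B → ⊥

-- An edge-coloured r-uniform multi-hypergraph on vertex set Fin n with
-- m edges (indexed by Fin m, so repetitions give multiplicity) and
-- colours drawn from a palette Fin k.
record ColHyp (n m k : ℕ) : Set where
  field
    edge  : Fin m → Subset n
    color : Fin m → Fin k

module _ {n m k : ℕ} (G : ColHyp n m k) where
  open ColHyp G

  Uniform : ℕ → Set
  Uniform r = ∀ e → ∣ edge e ∣ ≡ r

  codeg : Fin n → Fin n → ℕ
  codeg u v = countF (λ e → lookup (edge e) u ∧ lookup (edge e) v)

  Used : Fin k → Set
  Used c = ∃ λ e → color e ≡ c

  multC : Fin k → Subset n → ℕ
  multC c S = countF (λ e → does (color e ≟ c) ∧ does (≡-dec B._≟_ (edge e) S))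

  DisjointUnionOfCliques : ℕ → Fin k → Set
  DisjointUnionOfCliques r c =
    Σ ℕ λ t → Σ (Fin t → Subset n) λ K →
      (∀ i → r ≤ ∣ K i ∣) ×
      (∀ i j → i ≢ j → Disjoint (K i) (K j)) ×
      (∀ (S : Subset n) → ∣ S ∣ ≡ r →
         ((∃ λ i → S ⊆ K i) → multC c S ≡ 1) ×
         (¬ (∃ λ i → S ⊆ K i) → multC c S ≡ 0))

  spanC : Fin k → ℕ
  spanC c = countF (λ v → anyF (λ e → does (color e ≟ c) ∧ lookup (edge e) v))

  colDeg : Fin n → ℕ
  colDeg v = countF (λ c → anyF (λ e → does (color e ≟ c) ∧ lookup (edge e) v))

  FullRainbowMatching : Subset m → Set
  FullRainbowMatching M =
    (∀ e f → e ∈ M → f ∈ M → e ≢ f → Disjoint (edge e) (edge f)) ×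
    (∀ e f → e ∈ M → f ∈ M → e ≢ f → color e ≢ color f) ×
    (∀ c → Used c → ∃ λ e → e ∈ M × color e ≡ c)

-- x ≤ D^(1-p/q)   encoded (for q ≥ 1, D ≥ 1) as  x^q * D^p ≤ D^q
LeqPow1minus : ℕ → ℕ → ℕ → ℕ → Set
LeqPow1minus x D p q = x ^ q * D ^ p ≤ D ^ q

-- N ≥ r*D*(1 + D^(-a/b))  encoded (for b ≥ 1, D ≥ 1) as
-- r*D ≤ N  and  r^b * D^b ≤ (N ∸ r*D)^b * D^a
GeqSpanBound : ℕ → ℕ → ℕ → ℕ → ℕ → Set
GeqSpanBound N r D a b = (r * D ≤ N) × (r ^ b * D ^ b ≤ (N ∸ r * D) ^ b * D ^ a)

{-# OPTIONS --safe #-}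
module Submission where

-- Replace every clique by its cyclic intervals and take D copies of everything, the edges of G being extra vertices:
-- a matching saturating the A-side (colour, copy) of the resulting bipartite hypergraph is what is wanted. There every
-- A-vertex has x ≥ (1 + 1/g) y edges, every B-vertex degree at most y, and codegrees are at most κ, where g is a small
-- power of D and κ is at most x divided by a large power of g.
-- In one nibble each A-vertex picks one of its edges with probability 1/g³; picks that meet no other pick are kept,
-- and all covered B-vertices are deleted. Degrees are concentrated by the moment method, and the local lemma makes
-- them good everywhere at once. The relative gap x/y - 1 grows by a factor of about 1 + 1/g³ per nibble, so it becomes
-- constant after O(g³ log g) of them, while x only loses a factor g^O(r); once x ≥ 16 (r + 1) y, one more use of
-- the local lemma finishes. Probabilities are counts of assignments throughout.

open import Defs
open import Data.Nat
open import Data.Nat.Properties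
open import Data.Nat.DivMod using (m≡m%n+[m/n]*n; m%n<n; m/n*n≤m; m*n/n≡m; /-monoˡ-≤)
open import Data.Nat.Tactic.RingSolver using (solve-∀)
open import Data.Bool using (Bool; true; false; _∧_; _∨_; not) renaming (T to IsTrue)
import Data.Bool.Properties as 𝔹
open import Data.Fin using (Fin; zero; suc; toℕ; fromℕ<; _↑ˡ_; _↑ʳ_; splitAt; combine; remQuot)
import Data.Fin.Properties as F
open import Data.List using (List; []; _∷_; _++_; map; concatMap; length; filterᵇ)
open import Data.Bool.ListAction using (all; any)
import Data.List.Properties as L
open import Data.List.Membership.Propositional using () renaming (_∈_ to _∈ˡ_)
open import Data.Fin.Subset using (Subset; _∈_; _⊆_; ∣_∣)
import Data.Fin.Subset.Properties as S
open import Data.Maybe using (Maybe; just; nothing)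
open import Data.List.Membership.Propositional.Properties using (∈-map⁺; ∈-map⁻; ∈-++⁺ˡ; ∈-++⁺ʳ; ∈-++⁻)
open import Data.List.Relation.Unary.Any using (here; there)
open import Data.List.Relation.Unary.All using (All; []; _∷_)
import Data.List.Relation.Unary.All as All
open import Data.List.Relation.Unary.AllPairs using (AllPairs; []; _∷_)
import Data.List.Relation.Unary.All.Properties as AllP
import Data.List.Relation.Unary.AllPairs.Properties as AP
open import Data.Vec using (Vec; []; _∷_; lookup; tabulate)
import Data.Vec.Properties as V
open import Data.Product using (Σ; ∃; _×_; _,_; proj₁; proj₂; uncurry)
open import Data.Sum using (_⊎_; inj₁; inj₂; [_,_]′)
open import Data.Empty using (⊥; ⊥-elim)
open import Function using (_∘_; case_of_)
open import Relation.Nullary using (¬_; Dec; yes; no; does)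
open import Relation.Nullary.Decidable using (dec-true; dec-false)
open import Relation.Binary.PropositionalEquality hiding ([_])

-- Finite sums

-- The small gap 1/g dictates the parameters. With activation probability 1/T an A-vertex loses
-- about the fraction R y / (x T) of its edges, a B-vertex about (x + (R - 1) y) / (x T), because
-- its edges also disappear with their A-ends. The difference (x - y) / (x T), about 1 / (g T) at
-- the start, is the gain. Errors must stay below it: 1/F with F = g^2 T is smaller by a factor g,
-- and T = g^3 puts second-order effects, of relative size about 1/T^2, another factor g below 1/F.
-- The number of vertices is not bounded in terms of D, so no union bound over them is possible; the
-- local lemma applies because failure probabilities 2^(-g) beat the dependencies, polynomial in g.
-- Estimates are one-sided: few losses at A, few survivors at B. The latter need lower bounds for
-- deletion, hence exact degrees, which dummy picks supply. Intervals replace cliques because s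
-- vertices give s intervals with at most r through each vertex: a colour spanning more than rD
-- vertices gets more than rD edges while degrees stay at most rD.

𝟙 : Bool → ℕ
𝟙 true  = 1
𝟙 false = 0

𝟙≤1 : ∀ b → 𝟙 b ≤ 1
𝟙≤1 true  = ≤-refl
𝟙≤1 false = z≤n

𝟙-∧ : ∀ a b → 𝟙 (a ∧ b) ≡ 𝟙 a * 𝟙 b
𝟙-∧ true  b = sym (*-identityˡ _)
𝟙-∧ false b = refl

𝟙-not : ∀ b → 𝟙 b + 𝟙 (not b) ≡ 1
𝟙-not true  = refl
𝟙-not false = refl

𝟙-pos : ∀ b → 0 < 𝟙 b → b ≡ true
𝟙-pos true  _ = refl

𝟙-mono : ∀ a b → (a ≡ true → b ≡ true) → 𝟙 a ≤ 𝟙 b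
𝟙-mono true  b h rewrite h refl = ≤-refl
𝟙-mono false b h = z≤n

∧-true : ∀ {a b} → a ∧ b ≡ true → a ≡ true × b ≡ true
∧-true {true} {true} _ = refl , refl

*-pos : ∀ m n → 0 < m * n → 0 < m × 0 < n
*-pos (suc m) (suc n) _ = z<s , z<s
*-pos (suc m) zero h = ⊥-elim (n≮0 (subst (0 <_) (*-zeroʳ (suc m)) h))

≤ᵇ-true : ∀ {m n} → (m ≤ᵇ n) ≡ true → m ≤ n
≤ᵇ-true {m} {n} e = ≤ᵇ⇒≤ m n (subst IsTrue (sym e) _)

true-≤ᵇ : ∀ {m n} → m ≤ n → (m ≤ᵇ n) ≡ true
true-≤ᵇ {m} {n} h with m ≤ᵇ n in e
... | true  = refl
... | false = ⊥-elim (subst IsTrue e (≤⇒≤ᵇ h))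

≤ᵇ-false : ∀ {m n} → (m ≤ᵇ n) ≡ false → n < m
≤ᵇ-false e = ≰⇒> λ h → case trans (sym e) (true-≤ᵇ h) of λ ()

_==_ : ∀ {n} → Fin n → Fin n → Bool
i == j = does (i F.≟ j)

==-refl : ∀ {n} (i : Fin n) → (i == i) ≡ true
==-refl i = dec-true (i F.≟ i) refl

==-true : ∀ {n} {i j : Fin n} → (i == j) ≡ true → i ≡ j
==-true {i = i} {j} e with i F.≟ j
... | yes p = p

==-≢ : ∀ {n} {i j : Fin n} → i ≢ j → (i == j) ≡ false
==-≢ {i = i} {j} h = dec-false (i F.≟ j) h

==-suc : ∀ {n} (i j : Fin n) → (Fin.suc i == suc j) ≡ (i == j)
==-suc i j with i F.≟ j
... | yes _ = refl
... | no  _ = refl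

==-sym : ∀ {n} (i j : Fin n) → (i == j) ≡ (j == i)
==-sym i j with i F.≟ j
... | yes refl = sym (==-refl i)
... | no h     = sym (==-≢ (h ∘ sym))

∑ : {A : Set} → List A → (A → ℕ) → ℕ
∑ []       f = 0
∑ (x ∷ xs) f = f x + ∑ xs f

module _ {A : Set} where

  ∑-mono∈ : (xs : List A) {f g : A → ℕ} → (∀ {x} → x ∈ˡ xs → f x ≤ g x) → ∑ xs f ≤ ∑ xs g
  ∑-mono∈ []       h = z≤n
  ∑-mono∈ (x ∷ xs) h = +-mono-≤ (h (here refl)) (∑-mono∈ xs (h ∘ there))

  ∑-mono : (xs : List A) {f g : A → ℕ} → (∀ x → f x ≤ g x) → ∑ xs f ≤ ∑ xs g
  ∑-mono xs h = ∑-mono∈ xs (λ {x} _ → h x)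

  ∑-cong∈ : (xs : List A) {f g : A → ℕ} → (∀ {x} → x ∈ˡ xs → f x ≡ g x) → ∑ xs f ≡ ∑ xs g
  ∑-cong∈ []       h = refl
  ∑-cong∈ (x ∷ xs) h = cong₂ _+_ (h (here refl)) (∑-cong∈ xs (h ∘ there))

  ∑-cong : (xs : List A) {f g : A → ℕ} → (∀ x → f x ≡ g x) → ∑ xs f ≡ ∑ xs g
  ∑-cong xs h = ∑-cong∈ xs (λ {x} _ → h x)

  ∑-zero : (xs : List A) → ∑ xs (λ _ → 0) ≡ 0
  ∑-zero []       = refl
  ∑-zero (x ∷ xs) = ∑-zero xs

  ∑-zero∀ : (xs : List A) {f : A → ℕ} → (∀ x → f x ≡ 0) → ∑ xs f ≡ 0
  ∑-zero∀ xs h = trans (∑-cong xs h) (∑-zero xs)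

  ∑-+ : (xs : List A) (f g : A → ℕ) → ∑ xs (λ x → f x + g x) ≡ ∑ xs f + ∑ xs g
  ∑-+ []       f g = refl
  ∑-+ (x ∷ xs) f g rewrite ∑-+ xs f g = lem (f x) (g x) (∑ xs f) (∑ xs g)
    where
    lem : ∀ a b c d → a + b + (c + d) ≡ a + c + (b + d)
    lem = solve-∀

  ∑-*ˡ : (xs : List A) (c : ℕ) (f : A → ℕ) → ∑ xs (λ x → c * f x) ≡ c * ∑ xs f
  ∑-*ˡ []       c f = sym (*-zeroʳ c)
  ∑-*ˡ (x ∷ xs) c f rewrite ∑-*ˡ xs c f = sym (*-distribˡ-+ c (f x) (∑ xs f))

  ∑-*ʳ : (xs : List A) (c : ℕ) (f : A → ℕ) → ∑ xs (λ x → f x * c) ≡ ∑ xs f * c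
  ∑-*ʳ []       c f = refl
  ∑-*ʳ (x ∷ xs) c f rewrite ∑-*ʳ xs c f = sym (*-distribʳ-+ c (f x) (∑ xs f))

  ∑-const : (xs : List A) (c : ℕ) → ∑ xs (λ _ → c) ≡ length xs * c
  ∑-const []       c = refl
  ∑-const (x ∷ xs) c = cong (c +_) (∑-const xs c)

  ∑-++ : (xs ys : List A) (f : A → ℕ) → ∑ (xs ++ ys) f ≡ ∑ xs f + ∑ ys f
  ∑-++ []       ys f = refl
  ∑-++ (x ∷ xs) ys f rewrite ∑-++ xs ys f = sym (+-assoc (f x) _ _)

  ∑-∈ : {xs : List A} {x : A} (f : A → ℕ) → x ∈ˡ xs → f x ≤ ∑ xs f
  ∑-∈ f (here refl) = m≤m+n _ _
  ∑-∈ f (there i)   = ≤-trans (∑-∈ f i) (m≤n+m _ _)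

  ∑-pos : (xs : List A) (f : A → ℕ) → 0 < ∑ xs f → ∃ λ x → x ∈ˡ xs × 0 < f x
  ∑-pos (x ∷ xs) f h with f x in e
  ... | suc k = x , here refl , subst (0 <_) (sym e) z<s
  ... | zero  with ∑-pos xs f h
  ...   | y , i , p = y , there i , p

  ∑-swap : {B : Set} (xs : List A) (ys : List B) (f : A → B → ℕ) →
           ∑ xs (λ x → ∑ ys (f x)) ≡ ∑ ys (λ y → ∑ xs (λ x → f x y))
  ∑-swap []       ys f = sym (lem ys)
    where
    lem : {B : Set} (ys : List B) → ∑ ys (λ _ → 0) ≡ 0
    lem []       = refl
    lem (_ ∷ ys) = lem ys
  ∑-swap (x ∷ xs) ys f rewrite ∑-swap xs ys f = lem ys
    where
    lem : ∀ ys → ∑ ys (f x) + ∑ ys (λ y → ∑ xs (λ x → f x y)) ≡ ∑ ys (λ y → f x y + ∑ xs (λ x → f x y))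
    lem []       = refl
    lem (y ∷ ys) rewrite sym (lem ys) = lem₂ (f x y) _ _ _
      where
      lem₂ : ∀ a b c d → a + b + (c + d) ≡ a + c + (b + d)
      lem₂ = solve-∀

  ∑-map : {B : Set} (h : B → A) (xs : List B) (f : A → ℕ) → ∑ (map h xs) f ≡ ∑ xs (f ∘ h)
  ∑-map h []       f = refl
  ∑-map h (x ∷ xs) f = cong (f (h x) +_) (∑-map h xs f)

  ∑-concatMap : {B : Set} (h : B → List A) (xs : List B) (f : A → ℕ) →
                ∑ (concatMap h xs) f ≡ ∑ xs (λ x → ∑ (h x) f)
  ∑-concatMap h []       f = refl
  ∑-concatMap h (x ∷ xs) f = trans (∑-++ (h x) _ f) (cong (∑ (h x) f +_) (∑-concatMap h xs f))

  ∑-filter : (p : A → Bool) (xs : List A) (f : A → ℕ) →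
             ∑ (filterᵇ p xs) f ≡ ∑ xs (λ x → 𝟙 (p x) * f x)
  ∑-filter p []       f = refl
  ∑-filter p (x ∷ xs) f with p x
  ... | true  = cong₂ _+_ (sym (*-identityˡ _)) (∑-filter p xs f)
  ... | false = ∑-filter p xs f

fins : ∀ n → List (Fin n)
fins zero    = []
fins (suc n) = zero ∷ map suc (fins n)

length-fins : ∀ n → length (fins n) ≡ n
length-fins zero    = refl
length-fins (suc n) = cong suc (trans (L.length-map suc (fins n)) (length-fins n))

∈-fins : ∀ {n} (i : Fin n) → i ∈ˡ fins n
∈-fins zero    = here refl
∈-fins (suc i) = there (∈-map⁺ suc (∈-fins i))

∑-suc : ∀ n (f : Fin (suc n) → ℕ) → ∑ (fins (suc n)) f ≡ f zero + ∑ (fins n) (f ∘ suc)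
∑-suc n f = cong (f zero +_) (∑-map suc (fins n) f)

∑-≤ : ∀ n {f : Fin n → ℕ} {c} → (∀ i → f i ≤ c) → ∑ (fins n) f ≤ n * c
∑-≤ n {f} {c} h = ≤-trans (∑-mono (fins n) h)
  (≤-reflexive (trans (∑-const (fins n) c) (cong (_* c) (length-fins n))))

∑-const-fins : ∀ n c → ∑ (fins n) (λ _ → c) ≡ n * c
∑-const-fins n c = trans (∑-const (fins n) c) (cong (_* c) (length-fins n))

∑-fin : ∀ {n} (f : Fin n → ℕ) i → f i ≤ ∑ (fins n) f
∑-fin f i = ∑-∈ f (∈-fins i)

∑-δ : ∀ {n} (j : Fin n) (f : Fin n → ℕ) → ∑ (fins n) (λ i → 𝟙 (i == j) * f i) ≡ f j
∑-δ {suc n} zero f = begin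
  ∑ (fins (suc n)) (λ i → 𝟙 (i == zero) * f i)             ≡⟨ ∑-suc n (λ i → 𝟙 (i == zero) * f i) ⟩
  1 * f zero + ∑ (fins n) (λ i → 0)                        ≡⟨ cong (1 * f zero +_) (∑-zero (fins n)) ⟩
  1 * f zero + 0                                           ≡⟨ trans (+-identityʳ _) (*-identityˡ _) ⟩
  f zero                                                   ∎ where open ≡-Reasoning
∑-δ {suc n} (suc j) f = begin
  ∑ (fins (suc n)) (λ i → 𝟙 (i == suc j) * f i)            ≡⟨ ∑-suc n (λ i → 𝟙 (i == suc j) * f i) ⟩
  ∑ (fins n) (λ i → 𝟙 (suc i == suc j) * f (suc i))        ≡⟨ ∑-cong (fins n) (λ i → cong (λ b → 𝟙 b * f (suc i)) (==-suc i j)) ⟩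
  ∑ (fins n) (λ i → 𝟙 (i == j) * f (suc i))                ≡⟨ ∑-δ j (f ∘ suc) ⟩
  f (suc j)                                                ∎ where open ≡-Reasoning

∑-δ1 : ∀ {n} (j : Fin n) → ∑ (fins n) (λ i → 𝟙 (i == j)) ≡ 1
∑-δ1 {n} j = trans (∑-cong (fins n) (λ i → sym (*-identityʳ (𝟙 (i == j))))) (∑-δ j (λ _ → 1))

∑-split+ : ∀ m n (f : Fin (m + n) → ℕ) →
           ∑ (fins (m + n)) f ≡ ∑ (fins m) (λ i → f (i ↑ˡ n)) + ∑ (fins n) (λ j → f (m ↑ʳ j))
∑-split+ zero    n f = refl
∑-split+ (suc m) n f = begin
  ∑ (fins (suc m + n)) f                                                   ≡⟨ ∑-suc (m + n) f ⟩
  f zero + ∑ (fins (m + n)) (f ∘ suc)                                      ≡⟨ cong (f zero +_) (∑-split+ m n (f ∘ suc)) ⟩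
  f zero + (∑ (fins m) (λ i → f (suc i ↑ˡ n)) + ∑ (fins n) (λ j → f (suc m ↑ʳ j))) ≡⟨ sym (+-assoc (f zero) _ _) ⟩
  f zero + ∑ (fins m) (λ i → f (suc i ↑ˡ n)) + ∑ (fins n) (λ j → f (suc m ↑ʳ j))   ≡⟨ cong (_+ ∑ (fins n) (λ j → f (suc m ↑ʳ j))) (sym (∑-suc m (λ i → f (i ↑ˡ n)))) ⟩
  ∑ (fins (suc m)) (λ i → f (i ↑ˡ n)) + ∑ (fins n) (λ j → f (suc m ↑ʳ j))          ∎
  where open ≡-Reasoning

∑-split* : ∀ m n (f : Fin (m * n) → ℕ) →
           ∑ (fins (m * n)) f ≡ ∑ (fins m) (λ i → ∑ (fins n) (λ j → f (combine i j)))
∑-split* zero    n f = refl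
∑-split* (suc m) n f = begin
  ∑ (fins (n + m * n)) f                                                                ≡⟨ ∑-split+ n (m * n) f ⟩
  ∑ (fins n) (λ j → f (j ↑ˡ m * n)) + ∑ (fins (m * n)) (λ k → f (n ↑ʳ k))                ≡⟨ cong (∑ (fins n) (λ j → f (j ↑ˡ m * n)) +_) (∑-split* m n (λ k → f (n ↑ʳ k))) ⟩
  ∑ (fins n) (λ j → f (j ↑ˡ m * n)) + ∑ (fins m) (λ i → ∑ (fins n) (λ j → f (combine (suc i) j))) ≡⟨ sym (∑-suc m (λ i → ∑ (fins n) (λ j → f (combine i j)))) ⟩
  ∑ (fins (suc m)) (λ i → ∑ (fins n) (λ j → f (combine i j)))                            ∎
  where open ≡-Reasoning

∏ : ∀ m → (Fin m → ℕ) → ℕ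
∏ zero    f = 1
∏ (suc m) f = f zero * ∏ m (f ∘ suc)

-- The local lemma

Asg : ℕ → ℕ → Set
Asg Q N = Vec (Fin Q) N

asgs : ∀ Q N → List (Asg Q N)
asgs Q zero    = [] ∷ []
asgs Q (suc N) = concatMap (λ v → map (v ∷_) (asgs Q N)) (fins Q)

∑-asgs : ∀ Q N (f : Asg Q (suc N) → ℕ) →
         ∑ (asgs Q (suc N)) f ≡ ∑ (fins Q) (λ v → ∑ (asgs Q N) (λ x → f (v ∷ x)))
∑-asgs Q N f = trans (∑-concatMap (λ v → map (v ∷_) (asgs Q N)) (fins Q) f)
  (∑-cong (fins Q) (λ v → ∑-map (v ∷_) (asgs Q N) f))

∑-asgs-1 : ∀ Q N → ∑ (asgs Q N) (λ _ → 1) ≡ Q ^ N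
∑-asgs-1 Q zero    = refl
∑-asgs-1 Q (suc N) = begin
  ∑ (asgs Q (suc N)) (λ _ → 1)                 ≡⟨ ∑-asgs Q N (λ _ → 1) ⟩
  ∑ (fins Q) (λ v → ∑ (asgs Q N) (λ _ → 1))    ≡⟨ ∑-const-fins Q _ ⟩
  Q * ∑ (asgs Q N) (λ _ → 1)                   ≡⟨ cong (Q *_) (∑-asgs-1 Q N) ⟩
  Q * Q ^ N                                    ∎ where open ≡-Reasoning

Local : ∀ {Q N} {A : Set} → (Fin N → Set) → (Asg Q N → A) → Set
Local S f = ∀ x x' → (∀ c → S c → lookup x c ≡ lookup x' c) → f x ≡ f x'

cnt : ∀ {Q N} → (Asg Q N → Bool) → ℕ
cnt {Q} {N} p = ∑ (asgs Q N) (λ x → 𝟙 (p x))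

module _ {Q : ℕ} where

  private
    indep-head : ∀ N (f g : Asg Q (suc N) → ℕ) →
      (∀ v v' x → g (v ∷ x) ≡ g (v' ∷ x)) →
      (∀ v → ∑ (asgs Q N) (λ x → f (v ∷ x) * g (v ∷ x)) * Q ^ N
             ≡ ∑ (asgs Q N) (λ x → f (v ∷ x)) * ∑ (asgs Q N) (λ x → g (v ∷ x))) →
      ∑ (asgs Q (suc N)) (λ x → f x * g x) * Q ^ suc N ≡ ∑ (asgs Q (suc N)) f * ∑ (asgs Q (suc N)) g
    indep-head N f g const ih = begin
      ∑ (asgs Q (suc N)) (λ x → f x * g x) * Q ^ suc N   ≡⟨ cong (_* Q ^ suc N) (∑-asgs Q N _) ⟩
      ∑ (fins Q) fg * Q ^ suc N                          ≡⟨ sym (∑-*ʳ (fins Q) (Q ^ suc N) fg) ⟩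
      ∑ (fins Q) (λ v → fg v * Q ^ suc N)                ≡⟨ ∑-cong (fins Q) step ⟩
      ∑ (fins Q) (λ v → f̂ v * ∑ (fins Q) ĝ)              ≡⟨ ∑-*ʳ (fins Q) (∑ (fins Q) ĝ) f̂ ⟩
      ∑ (fins Q) f̂ * ∑ (fins Q) ĝ                        ≡⟨ sym (cong₂ _*_ (∑-asgs Q N f) (∑-asgs Q N g)) ⟩
      ∑ (asgs Q (suc N)) f * ∑ (asgs Q (suc N)) g        ∎
      where
      open ≡-Reasoning
      fg f̂ ĝ : Fin Q → ℕ
      fg v = ∑ (asgs Q N) (λ x → f (v ∷ x) * g (v ∷ x))
      f̂ v = ∑ (asgs Q N) (λ x → f (v ∷ x))
      ĝ v = ∑ (asgs Q N) (λ x → g (v ∷ x))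
      rearrange : ∀ a b c → a * (b * c) ≡ b * (a * c)
      rearrange = solve-∀
      step : ∀ v → fg v * Q ^ suc N ≡ f̂ v * ∑ (fins Q) ĝ
      step v = begin
        fg v * (Q * Q ^ N)     ≡⟨ rearrange (fg v) Q (Q ^ N) ⟩
        Q * (fg v * Q ^ N)     ≡⟨ cong (Q *_) (ih v) ⟩
        Q * (f̂ v * ĝ v)        ≡⟨ rearrange Q (f̂ v) (ĝ v) ⟩
        f̂ v * (Q * ĝ v)        ≡⟨ cong (f̂ v *_) (sym (∑-const-fins Q (ĝ v))) ⟩
        f̂ v * ∑ (fins Q) (λ _ → ĝ v) ≡⟨ cong (f̂ v *_) (∑-cong (fins Q) (λ v' → ∑-cong (asgs Q N) (const v v'))) ⟩
        f̂ v * ∑ (fins Q) ĝ     ∎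

    tail-local : ∀ {N} {A : Set} {S : Fin (suc N) → Set} {f : Asg Q (suc N) → A} → Local S f →
                 ∀ v → Local (S ∘ suc) (λ x → f (v ∷ x))
    tail-local h v x x' e = h (v ∷ x) (v ∷ x') λ { zero _ → refl ; (suc c) s → e c s }

    head-const : ∀ {N} {A : Set} {S : Fin (suc N) → Set} {f : Asg Q (suc N) → A} → Local S f →
                 ¬ S zero → ∀ v v' x → f (v ∷ x) ≡ f (v' ∷ x)
    head-const h ¬s v v' x = h (v ∷ x) (v' ∷ x) λ { zero s → ⊥-elim (¬s s) ; (suc c) _ → refl }

  -- Induction on the coordinates: the head is invisible to one of the two functions. `indep-head`
  -- treats the case in which it is the second, commutativity the other. The factor `Q ^ N` clears
  -- the denominators of the product rule for expectations.
  indep : ∀ N (w : Fin N → Bool) (f g : Asg Q N → ℕ) →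
          Local (λ c → w c ≡ true) f → Local (λ c → w c ≡ false) g →
          ∑ (asgs Q N) (λ x → f x * g x) * Q ^ N ≡ ∑ (asgs Q N) f * ∑ (asgs Q N) g
  indep zero    w f g hf hg = lem (f []) (g [])
    where
    lem : ∀ a b → (a * b + 0) * 1 ≡ (a + 0) * (b + 0)
    lem = solve-∀
  indep (suc N) w f g hf hg with w zero in e
  ... | true  = indep-head N f g (head-const hg λ h → case trans (sym e) h of λ ())
                  (λ v → indep N (w ∘ suc) _ _ (tail-local hf v) (tail-local hg v))
  ... | false = begin
      ∑ (asgs Q (suc N)) (λ x → f x * g x) * Q ^ suc N ≡⟨ cong (_* Q ^ suc N) (∑-cong (asgs Q (suc N)) (λ x → *-comm (f x) (g x))) ⟩
      ∑ (asgs Q (suc N)) (λ x → g x * f x) * Q ^ suc N ≡⟨ indep-head N g f (head-const hf λ h → case trans (sym e) h of λ ())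
                  (λ v → trans (cong (_* Q ^ N) (∑-cong (asgs Q N) (λ x → *-comm (g (v ∷ x)) (f (v ∷ x)))))
                    (trans (indep N (w ∘ suc) _ _ (tail-local hf v) (tail-local hg v)) (*-comm (∑ (asgs Q N) (λ x → f (v ∷ x))) _))) ⟩
      ∑ (asgs Q (suc N)) g * ∑ (asgs Q (suc N)) f      ≡⟨ *-comm (∑ (asgs Q (suc N)) g) _ ⟩
      ∑ (asgs Q (suc N)) f * ∑ (asgs Q (suc N)) g      ∎
      where open ≡-Reasoning

-- The symmetric local lemma in the form 4 d P ≤ 1 with d = `s * t`. The weight `W e c` is positive
-- where `bad e` reads the coordinate `c`. Being a number and not a relation, it allows the
-- neighbours of an event to be counted by a double sum over coordinates, and walk counts to serve
-- as weights.
module LocalLemma {Q N : ℕ} .{{_ : NonZero Q}} {E : Set}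
  (bad : E → Asg Q N → Bool) (W : E → Fin N → ℕ)
  (loc : ∀ e → Local (λ c → 0 < W e c) (bad e))
  (s t : ℕ) (1≤st : 1 ≤ s * t)
  (row : ∀ e → ∑ (fins N) (W e) ≤ s)
  (rare : ∀ e → cnt (bad e) * (4 * (s * t)) ≤ Q ^ N)
  where

  avoid : List E → Asg Q N → Bool
  avoid S x = all (λ e → not (bad e x)) S

  private
    share : E → E → Bool
    share e e' = 1 ≤ᵇ ∑ (fins N) (λ c → W e c * W e' c)

    near far : E → List E → List E
    near e S = filterᵇ (share e) S
    far e S = filterᵇ (λ e' → not (share e e')) S

    avoid-far : ∀ e S x → 𝟙 (avoid S x) ≤ 𝟙 (avoid (far e S) x)
    avoid-far e []       x = ≤-refl
    avoid-far e (e' ∷ S) x with share e e' | bad e' x in b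
    ... | true  | true  = z≤n
    ... | true  | false = avoid-far e S x
    ... | false | true  = z≤n
    ... | false | false rewrite b = avoid-far e S x

    split : ∀ e S x → 𝟙 (avoid (far e S) x) ≤ 𝟙 (avoid S x) + ∑ (near e S) (λ j → 𝟙 (bad j x))
    split e []       x = ≤-refl
    split e (e' ∷ S) x with share e e' | bad e' x in b
    ... | true  | true  rewrite b = ≤-trans (𝟙≤1 _) (s≤s z≤n)
    ... | true  | false rewrite b = split e S x
    ... | false | true  rewrite b = z≤n
    ... | false | false rewrite b = split e S x

    far-local : ∀ e S → Local (λ c → (1 ≤ᵇ W e c) ≡ false) (avoid (far e S))
    far-local e []       x x' h = refl
    far-local e (e' ∷ S) x x' h with share e e' in sh
    ... | true  = far-local e S x x' h
    ... | false = cong₂ (λ a b → not a ∧ b)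
          (loc e' x x' (λ c p → h c (lem c p))) (far-local e S x x' h)
      where
      lem : ∀ c → 0 < W e' c → (1 ≤ᵇ W e c) ≡ false
      lem c p with 1 ≤ᵇ W e c in q
      ... | false = refl
      ... | true  = ⊥-elim (<-irrefl refl (<-≤-trans (≤ᵇ-false sh)
              (≤-trans (*-mono-≤ (≤ᵇ-true {1} {W e c} q) p) (∑-fin (λ c → W e c * W e' c) c))))

    near-few : ∀ e S → (∀ c → ∑ S (λ e → W e c) ≤ t) → ∑ (near e S) (λ _ → 1) ≤ s * t
    near-few e S h = begin
      ∑ (near e S) (λ _ → 1)                                      ≡⟨ ∑-filter (share e) S (λ _ → 1) ⟩
      ∑ S (λ e' → 𝟙 (share e e') * 1)                             ≤⟨ ∑-mono S lem ⟩
      ∑ S (λ e' → ∑ (fins N) (λ c → W e c * W e' c))              ≡⟨ ∑-swap S (fins N) (λ e' c → W e c * W e' c) ⟩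
      ∑ (fins N) (λ c → ∑ S (λ e' → W e c * W e' c))              ≡⟨ ∑-cong (fins N) (λ c → ∑-*ˡ S (W e c) (λ e' → W e' c)) ⟩
      ∑ (fins N) (λ c → W e c * ∑ S (λ e' → W e' c))              ≤⟨ ∑-mono (fins N) (λ c → *-monoʳ-≤ (W e c) (h c)) ⟩
      ∑ (fins N) (λ c → W e c * t)                                ≡⟨ ∑-*ʳ (fins N) t (W e) ⟩
      ∑ (fins N) (W e) * t                                        ≤⟨ *-monoˡ-≤ t (row e) ⟩
      s * t                                                       ∎
      where
      open ≤-Reasoning
      lem : ∀ e' → 𝟙 (share e e') * 1 ≤ ∑ (fins N) (λ c → W e c * W e' c)
      lem e' with share e e' in sh
      ... | true  = ≤ᵇ-true sh
      ... | false = z≤n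

    far-load : ∀ e S → (∀ c → ∑ S (λ e → W e c) ≤ t) → ∀ c → ∑ (far e S) (λ e → W e c) ≤ t
    far-load e S h c = ≤-trans (≤-reflexive (∑-filter _ S _))
      (≤-trans (∑-mono S (λ e' → ≤-trans (*-monoˡ-≤ (W e' c) (𝟙≤1 (not (share e e')))) (≤-reflexive (*-identityˡ _)))) (h c))

    far-short : ∀ e S {j} → j ∈ˡ near e S → length (far e S) < length S
    far-short e (e' ∷ S) i with share e e'
    ... | true  = s≤s (L.length-filter _ S)
    far-short e (e' ∷ S) i | false = s≤s (far-short e S i)

    d : ℕ
    d = s * t

    bad∧ : E → List E → ℕ
    bad∧ e S = ∑ (asgs Q N) (λ x → 𝟙 (bad e x) * 𝟙 (avoid S x))

    -- P(e | no event of S) ≤ 1/(2d): e is independent of the events far from it, and avoiding the at most d near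
    -- ones costs, by induction and the union bound, at most half of the assignments.
    conditional : ∀ n S → length S ≤ n → (∀ c → ∑ S (λ e → W e c) ≤ t) →
                  ∀ e → bad∧ e S * (2 * d) ≤ cnt (avoid S)
    conditional n S len load e =
      *-cancelʳ-≤ _ _ (2 * d) {{m*n≢0 2 d {{_}} {{>-nonZero 1≤st}}}} (begin
        bad∧ e S * (2 * d) * (2 * d)   ≤⟨ *-monoˡ-≤ (2 * d) (*-monoˡ-≤ (2 * d) h₁) ⟩
        X * (2 * d) * (2 * d)          ≡⟨ lem₁ X d ⟩
        X * (4 * d) * d                ≤⟨ *-monoˡ-≤ d h₃ ⟩
        A₂ * d                         ≤⟨ h₄ ⟩
        A * (2 * d)                    ∎)
      where
      open ≤-Reasoning
      X A A₂ : ℕ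
      X = bad∧ e (far e S)
      A = cnt (avoid S)
      A₂ = cnt (avoid (far e S))
      lem₁ : ∀ X d → X * (2 * d) * (2 * d) ≡ X * (4 * d) * d
      lem₁ = solve-∀
      h₁ : bad∧ e S ≤ X
      h₁ = ∑-mono (asgs Q N) (λ x → *-monoʳ-≤ (𝟙 (bad e x)) (avoid-far e S x))
      h₂ : X * Q ^ N ≡ cnt (bad e) * A₂
      h₂ = indep N (λ c → 1 ≤ᵇ W e c) _ _
        (λ x x' h → cong 𝟙 (loc e x x' (λ c p → h c (true-≤ᵇ p))))
        (λ x x' h → cong 𝟙 (far-local e S x x' h))
      h₃ : X * (4 * d) ≤ A₂
      h₃ = *-cancelʳ-≤ _ _ (Q ^ N) {{m^n≢0 Q N}} (begin
        X * (4 * d) * Q ^ N            ≡⟨ lem₂ X (4 * d) (Q ^ N) ⟩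
        X * Q ^ N * (4 * d)            ≡⟨ cong (_* (4 * d)) h₂ ⟩
        cnt (bad e) * A₂ * (4 * d)     ≡⟨ lem₃ (cnt (bad e)) A₂ (4 * d) ⟩
        A₂ * (cnt (bad e) * (4 * d))   ≤⟨ *-monoʳ-≤ A₂ (rare e) ⟩
        A₂ * Q ^ N                     ∎)
        where
        lem₂ : ∀ a b c → a * b * c ≡ a * c * b
        lem₂ = solve-∀
        lem₃ : ∀ a b c → a * b * c ≡ b * (a * c)
        lem₃ = solve-∀
      h₅ : A₂ ≤ A + ∑ (near e S) (λ j → bad∧ j (far e S))
      h₅ = begin
        A₂
          ≤⟨ ∑-mono (asgs Q N) (λ x → pointwise x) ⟩
        ∑ (asgs Q N) (λ x → 𝟙 (avoid S x) + ∑ (near e S) (λ j → 𝟙 (bad j x) * 𝟙 (avoid (far e S) x)))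
          ≡⟨ ∑-+ (asgs Q N) _ _ ⟩
        A + ∑ (asgs Q N) (λ x → ∑ (near e S) (λ j → 𝟙 (bad j x) * 𝟙 (avoid (far e S) x)))
          ≡⟨ cong (A +_) (∑-swap (asgs Q N) (near e S) _) ⟩
        A + ∑ (near e S) (λ j → bad∧ j (far e S)) ∎
        where
        pointwise : ∀ x → 𝟙 (avoid (far e S) x) ≤
          𝟙 (avoid S x) + ∑ (near e S) (λ j → 𝟙 (bad j x) * 𝟙 (avoid (far e S) x))
        pointwise x with avoid (far e S) x | split e S x
        ... | true  | h = ≤-trans h (≤-reflexive (cong (𝟙 (avoid S x) +_)
                            (∑-cong (near e S) (λ j → sym (*-identityʳ _)))))
        ... | false | h = z≤n
      h₄ : A₂ * d ≤ A * (2 * d)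
      h₄ = +-cancelʳ-≤ (A₂ * d) _ _ (begin
        A₂ * d + A₂ * d                   ≡⟨ lem₄ A₂ d ⟩
        A₂ * (2 * d)                      ≤⟨ *-monoˡ-≤ (2 * d) h₅ ⟩
        (A + ∑ (near e S) (λ j → bad∧ j (far e S))) * (2 * d)
          ≡⟨ *-distribʳ-+ (2 * d) A _ ⟩
        A * (2 * d) + ∑ (near e S) (λ j → bad∧ j (far e S)) * (2 * d)
          ≡⟨ cong (A * (2 * d) +_) (sym (∑-*ʳ (near e S) (2 * d) _)) ⟩
        A * (2 * d) + ∑ (near e S) (λ j → bad∧ j (far e S) * (2 * d))
          ≤⟨ +-monoʳ-≤ (A * (2 * d)) (∑-mono∈ (near e S) (ih n len)) ⟩
        A * (2 * d) + ∑ (near e S) (λ _ → A₂)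
          ≡⟨ cong (A * (2 * d) +_) (trans (∑-cong (near e S) (λ _ → sym (*-identityʳ A₂))) (∑-*ˡ (near e S) A₂ (λ _ → 1))) ⟩
        A * (2 * d) + A₂ * ∑ (near e S) (λ _ → 1)
          ≤⟨ +-monoʳ-≤ (A * (2 * d)) (*-monoʳ-≤ A₂ (near-few e S load)) ⟩
        A * (2 * d) + A₂ * d              ∎)
        where
        lem₄ : ∀ a d → a * d + a * d ≡ a * (2 * d)
        lem₄ = solve-∀
        -- A near event is dropped from `far e S`, which is therefore shorter than `S`; the bound
        -- `n` on the length makes the recursion structural.
        ih : ∀ n → length S ≤ n → ∀ {j} → j ∈ˡ near e S → bad∧ j (far e S) * (2 * d) ≤ A₂
        ih n len {j} i with n | ≤-trans (far-short e S i) len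
        ... | suc n' | s≤s len' = conditional n' (far e S) len' (far-load e S load) j

    -- By `conditional` and 2 d ≥ 2, each further event costs at most half of the assignments that
    -- avoid the earlier ones, so some assignment is always left.
    positive : ∀ S → (∀ c → ∑ S (λ e → W e c) ≤ t) → 0 < cnt (avoid S)
    positive []      load = subst (0 <_) (sym (∑-asgs-1 Q N)) (m^n>0 Q N)
    positive (e ∷ S) load = proj₁ (*-pos _ 2 (begin-strict
      0                                    <⟨ positive S load' ⟩
      cnt (avoid S)                        ≤⟨ half (cnt (avoid S)) (cnt (avoid (e ∷ S))) (bad∧ e S) total bound ⟩
      cnt (avoid (e ∷ S)) * 2              ∎))
      where
      open ≤-Reasoning
      load' : ∀ c → ∑ S (λ e → W e c) ≤ t
      load' c = m+n≤o⇒n≤o (W e c) (load c)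
      bound : bad∧ e S * 2 ≤ cnt (avoid S)
      bound = ≤-trans (*-monoʳ-≤ (bad∧ e S) (*-monoʳ-≤ 2 1≤st)) (conditional _ S ≤-refl load' e)
      total : cnt (avoid S) ≤ cnt (avoid (e ∷ S)) + bad∧ e S
      total = ≤-trans (∑-mono (asgs Q N) pointwise) (≤-reflexive (∑-+ (asgs Q N) _ _))
        where
        pointwise : ∀ x → 𝟙 (avoid S x) ≤ 𝟙 (avoid (e ∷ S) x) + 𝟙 (bad e x) * 𝟙 (avoid S x)
        pointwise x with bad e x
        ... | true  = ≤-reflexive (sym (*-identityˡ _))
        ... | false = ≤-reflexive (sym (+-identityʳ _))
      half : ∀ a b c → a ≤ b + c → c * 2 ≤ a → a ≤ b * 2
      half a b c h₁ h₂ = +-cancelʳ-≤ a _ _ (begin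
        a + a                ≡⟨ lem₁ a ⟩
        a * 2                ≤⟨ *-monoˡ-≤ 2 h₁ ⟩
        (b + c) * 2          ≡⟨ *-distribʳ-+ 2 b c ⟩
        b * 2 + c * 2        ≤⟨ +-monoʳ-≤ (b * 2) h₂ ⟩
        b * 2 + a            ∎)
        where
        lem₁ : ∀ a → a + a ≡ a * 2
        lem₁ = solve-∀

    avoid-∈ : ∀ S x → avoid S x ≡ true → ∀ {e} → e ∈ˡ S → bad e x ≡ false
    avoid-∈ (e ∷ S) x h (here refl) with bad e x
    ... | false = refl
    avoid-∈ (e ∷ S) x h (there i)   = avoid-∈ S x (proj₂ (∧-true h)) i

  localLemma : ∀ S → (∀ c → ∑ S (λ e → W e c) ≤ t) → Σ (Asg Q N) λ x → ∀ {e} → e ∈ˡ S → bad e x ≡ false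
  localLemma S load with ∑-pos (asgs Q N) _ (positive S load)
  ... | x , _ , h = x , avoid-∈ S x (𝟙-pos _ h)

-- Tail bounds

-- Moment method: at a point where the realized hits weigh at least θ and each of them clashes with weight at most C
-- of the others, there are at least (θ ∸ m * C) ^ m ordered m-tuples of realized, pairwise non-clashing hits.
module Tail {X H : Set} (Ω : List X) (hits : List H) (wt : H → ℕ)
  (real : H → X → Bool) (clash : H → H → Bool) (C : ℕ) where

  free : H → List H → Bool
  free h hs = all (λ h' → not (clash h' h)) hs

  reals : List H → X → Bool
  reals hs x = all (λ h → real h x) hs

  -- The condition `0 < wt h` passes the meaning of the weight on to the joint probability bounds:
  -- for survivors it says that the pair covers `b` at a genuine coordinate.
  data Separated : List H → Set where
    []  : Separated []
    add : ∀ {h hs} → 0 < wt h → free h hs ≡ true → Separated hs → Separated (h ∷ hs)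

  total : X → ℕ
  total x = ∑ hits (λ h → wt h * 𝟙 (real h x))

  Tame : X → Set
  Tame x = ∀ h → real h x ≡ true → ∑ hits (λ h' → wt h' * 𝟙 (real h' x) * 𝟙 (clash h h')) ≤ C

  private
    tuples : ℕ → List H → X → ℕ
    tuples zero    hs x = 1
    tuples (suc m) hs x = ∑ hits (λ h → wt h * 𝟙 (real h x) * (𝟙 (free h hs) * tuples m (h ∷ hs) x))

    free-or-clash : ∀ h hs → 1 ≤ 𝟙 (free h hs) + ∑ hs (λ h' → 𝟙 (clash h' h))
    free-or-clash h []        = ≤-refl
    free-or-clash h (h' ∷ hs) with clash h' h
    ... | true  = s≤s z≤n
    ... | false = free-or-clash h hs

    clashes : ∀ x → Tame x → ∀ hs → reals hs x ≡ true →
              ∑ hits (λ h → wt h * 𝟙 (real h x) * ∑ hs (λ h' → 𝟙 (clash h' h))) ≤ length hs * C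
    clashes x tame []        r = ≤-reflexive (∑-zero∀ hits (λ h → *-zeroʳ (wt h * 𝟙 (real h x))))
    clashes x tame (h' ∷ hs) r = begin
      ∑ hits (λ h → wt h * 𝟙 (real h x) * (𝟙 (clash h' h) + ∑ hs (λ h' → 𝟙 (clash h' h))))
        ≡⟨ ∑-cong hits (λ h → *-distribˡ-+ (wt h * 𝟙 (real h x)) _ _) ⟩
      ∑ hits (λ h → wt h * 𝟙 (real h x) * 𝟙 (clash h' h) + wt h * 𝟙 (real h x) * ∑ hs (λ h' → 𝟙 (clash h' h)))
        ≡⟨ ∑-+ hits _ _ ⟩
      ∑ hits (λ h → wt h * 𝟙 (real h x) * 𝟙 (clash h' h)) + ∑ hits (λ h → wt h * 𝟙 (real h x) * ∑ hs (λ h' → 𝟙 (clash h' h)))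
        ≤⟨ +-mono-≤ (tame h' (proj₁ (∧-true r))) (clashes x tame hs (proj₂ (∧-true {real h' x} r))) ⟩
      C + length hs * C ∎
      where open ≤-Reasoning

    lower : ∀ x θ M → Tame x → θ ≤ total x → ∀ m hs → length hs + m ≤ M → reals hs x ≡ true →
            (θ ∸ M * C) ^ m ≤ tuples m hs x
    lower x θ M tame θ≤ zero    hs len r = ≤-refl
    lower x θ M tame θ≤ (suc m) hs len r = begin
      (θ ∸ M * C) * K
        ≤⟨ *-monoˡ-≤ K (m≤n+o⇒m∸n≤o θ (M * C) enough) ⟩
      ∑ hits (λ h → wt h * 𝟙 (real h x) * 𝟙 (free h hs)) * K
        ≡⟨ sym (∑-*ʳ hits K _) ⟩
      ∑ hits (λ h → wt h * 𝟙 (real h x) * 𝟙 (free h hs) * K)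
        ≤⟨ ∑-mono hits each ⟩
      tuples (suc m) hs x ∎
      where
      open ≤-Reasoning
      K : ℕ
      K = (θ ∸ M * C) ^ m
      each : ∀ h → wt h * 𝟙 (real h x) * 𝟙 (free h hs) * K ≤ wt h * 𝟙 (real h x) * (𝟙 (free h hs) * tuples m (h ∷ hs) x)
      each h with real h x in rh
      ... | false rewrite *-zeroʳ (wt h) = z≤n
      ... | true  = ≤-trans (≤-reflexive (*-assoc (wt h * 1) (𝟙 (free h hs)) K))
              (*-monoʳ-≤ (wt h * 1) (*-monoʳ-≤ (𝟙 (free h hs))
                (lower x θ M tame θ≤ m (h ∷ hs) (≤-trans (≤-reflexive (sym (+-suc (length hs) m))) len)
                  (cong₂ _∧_ rh r))))
      enough : θ ≤ M * C + ∑ hits (λ h → wt h * 𝟙 (real h x) * 𝟙 (free h hs))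
      enough = begin
        θ ≤⟨ θ≤ ⟩
        ∑ hits (λ h → wt h * 𝟙 (real h x))
          ≤⟨ ∑-mono hits (λ h → ≤-trans (≤-reflexive (sym (*-identityʳ _))) (*-monoʳ-≤ (wt h * 𝟙 (real h x)) (free-or-clash h hs))) ⟩
        ∑ hits (λ h → wt h * 𝟙 (real h x) * (𝟙 (free h hs) + ∑ hs (λ h' → 𝟙 (clash h' h))))
          ≡⟨ trans (∑-cong hits (λ h → *-distribˡ-+ (wt h * 𝟙 (real h x)) _ _)) (∑-+ hits _ _) ⟩
        ∑ hits (λ h → wt h * 𝟙 (real h x) * 𝟙 (free h hs)) + ∑ hits (λ h → wt h * 𝟙 (real h x) * ∑ hs (λ h' → 𝟙 (clash h' h)))
          ≤⟨ +-monoʳ-≤ _ (≤-trans (clashes x tame hs r) (*-monoˡ-≤ C (≤-trans (m≤m+n (length hs) (suc m)) len))) ⟩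
        ∑ hits (λ h → wt h * 𝟙 (real h x) * 𝟙 (free h hs)) + M * C
          ≡⟨ +-comm _ (M * C) ⟩
        M * C + ∑ hits (λ h → wt h * 𝟙 (real h x) * 𝟙 (free h hs)) ∎

    -- Exchange of sums: a separated tuple is realized on at most v / u points, and the product
    -- weights of all `m`-tuples add up to the `m`-th power of the total weight. Extensions by a hit
    -- that clashes or has weight 0 contribute nothing, so only separated tuples meet `joint`.
    upper : ∀ u v m hs → Separated hs →
            (∀ hs' → Separated hs' → length hs' ≡ m + length hs → ∑ Ω (λ x → 𝟙 (reals hs' x)) * u ≤ v) →
            ∑ Ω (λ x → 𝟙 (reals hs x) * tuples m hs x) * u ≤ ∑ hits wt ^ m * v
    upper u v zero    hs sep joint = ≤-trans
      (≤-reflexive (cong (_* u) (∑-cong Ω (λ x → *-identityʳ _))))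
      (≤-trans (joint hs sep refl) (≤-reflexive (sym (+-identityʳ v))))
    upper u v (suc m) hs sep joint = begin
      ∑ Ω (λ x → 𝟙 (reals hs x) * tuples (suc m) hs x) * u
        ≡⟨ cong (_* u) (∑-cong Ω (λ x → sym (∑-*ˡ hits (𝟙 (reals hs x)) _))) ⟩
      ∑ Ω (λ x → ∑ hits (λ h → term x h)) * u
        ≡⟨ cong (_* u) (∑-swap Ω hits term) ⟩
      ∑ hits (λ h → ∑ Ω (λ x → term x h)) * u
        ≡⟨ sym (∑-*ʳ hits u _) ⟩
      ∑ hits (λ h → ∑ Ω (λ x → term x h) * u)
        ≤⟨ ∑-mono hits each ⟩
      ∑ hits (λ h → wt h * (∑ hits wt ^ m * v))
        ≡⟨ ∑-*ʳ hits (∑ hits wt ^ m * v) wt ⟩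
      ∑ hits wt * (∑ hits wt ^ m * v)
        ≡⟨ sym (*-assoc (∑ hits wt) _ v) ⟩
      ∑ hits wt ^ suc m * v ∎
      where
      open ≤-Reasoning
      term : X → H → ℕ
      term x h = 𝟙 (reals hs x) * (wt h * 𝟙 (real h x) * (𝟙 (free h hs) * tuples m (h ∷ hs) x))
      shuffle : ∀ a b c t → a * (b * c * (1 * t)) ≡ b * (c * a * t)
      shuffle = solve-∀
      each : ∀ h → ∑ Ω (λ x → term x h) * u ≤ wt h * (∑ hits wt ^ m * v)
      each h with wt h in e | free h hs in f
      ... | zero  | _     = ≤-reflexive (cong (_* u) (∑-zero∀ Ω (λ x → *-zeroʳ (𝟙 (reals hs x)))))
      ... | suc k | false = ≤-trans (≤-reflexive (cong (_* u) (∑-zero∀ Ω (λ x →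
                trans (cong (𝟙 (reals hs x) *_) (*-zeroʳ (suc k * 𝟙 (real h x)))) (*-zeroʳ (𝟙 (reals hs x))))))) z≤n
      ... | suc k | true  = begin
        ∑ Ω (λ x → 𝟙 (reals hs x) * (suc k * 𝟙 (real h x) * (1 * tuples m (h ∷ hs) x))) * u
          ≡⟨ cong (_* u) (∑-cong Ω (λ x → trans (shuffle (𝟙 (reals hs x)) (suc k) (𝟙 (real h x)) (tuples m (h ∷ hs) x))
               (cong (λ z → suc k * (z * tuples m (h ∷ hs) x)) (sym (𝟙-∧ (real h x) (reals hs x)))))) ⟩
        ∑ Ω (λ x → suc k * (𝟙 (reals (h ∷ hs) x) * tuples m (h ∷ hs) x)) * u
          ≡⟨ cong (_* u) (∑-*ˡ Ω (suc k) _) ⟩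
        suc k * ∑ Ω (λ x → 𝟙 (reals (h ∷ hs) x) * tuples m (h ∷ hs) x) * u
          ≡⟨ *-assoc (suc k) (∑ Ω (λ x → 𝟙 (reals (h ∷ hs) x) * tuples m (h ∷ hs) x)) u ⟩
        suc k * (∑ Ω (λ x → 𝟙 (reals (h ∷ hs) x) * tuples m (h ∷ hs) x) * u)
          ≤⟨ *-monoʳ-≤ (suc k) (upper u v m (h ∷ hs) (add (subst (0 <_) (sym e) z<s) f sep)
               (λ hs' s l → joint hs' s (trans l (+-suc m (length hs))))) ⟩
        suc k * (∑ hits wt ^ m * v) ∎

  -- Markov's inequality for the weighted number of non-clashing `m`-tuples: `lower` makes it large
  -- at every bad point, `upper` bounds its sum over all points.
  tail : ∀ θ m u v (bad : X → Bool) →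
         (∀ x → bad x ≡ true → θ ≤ total x × Tame x) →
         (∀ hs → Separated hs → length hs ≡ m → ∑ Ω (λ x → 𝟙 (reals hs x)) * u ≤ v) →
         ∑ Ω (λ x → 𝟙 (bad x)) * (θ ∸ m * C) ^ m * u ≤ ∑ hits wt ^ m * v
  tail θ m u v bad h joint = begin
    ∑ Ω (λ x → 𝟙 (bad x)) * (θ ∸ m * C) ^ m * u    ≡⟨ cong (_* u) (sym (∑-*ʳ Ω ((θ ∸ m * C) ^ m) _)) ⟩
    ∑ Ω (λ x → 𝟙 (bad x) * (θ ∸ m * C) ^ m) * u    ≤⟨ *-monoˡ-≤ u (∑-mono Ω each) ⟩
    ∑ Ω (λ x → 1 * tuples m [] x) * u              ≤⟨ upper u v m [] [] (λ hs s l → joint hs s (trans l (+-identityʳ m))) ⟩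
    ∑ hits wt ^ m * v                              ∎
    where
    open ≤-Reasoning
    each : ∀ x → 𝟙 (bad x) * (θ ∸ m * C) ^ m ≤ 1 * tuples m [] x
    each x with bad x in b
    ... | false = z≤n
    ... | true  = *-monoʳ-≤ 1 (lower x θ m (proj₂ (h x b)) (proj₁ (h x b)) m [] ≤-refl refl)

-- Joint probabilities of prescribed values and of avoided values

module _ {Q : ℕ} where

  cnt-coordinate : ∀ N (c : Fin N) (v : Fin Q) → cnt (λ (x : Asg Q N) → lookup x c == v) * Q ≡ Q ^ N
  cnt-coordinate (suc N) zero v = begin
    cnt (λ (x : Asg Q (suc N)) → lookup x zero == v) * Q
      ≡⟨ cong (_* Q) (∑-asgs Q N _) ⟩
    ∑ (fins Q) (λ v' → ∑ (asgs Q N) (λ _ → 𝟙 (v' == v))) * Q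
      ≡⟨ cong (_* Q) (∑-cong (fins Q) (λ v' → trans (∑-cong (asgs Q N) (λ _ → sym (*-identityʳ (𝟙 (v' == v))))) (∑-*ˡ (asgs Q N) (𝟙 (v' == v)) (λ _ → 1)))) ⟩
    ∑ (fins Q) (λ v' → 𝟙 (v' == v) * ∑ (asgs Q N) (λ _ → 1)) * Q
      ≡⟨ cong (_* Q) (∑-δ v (λ _ → ∑ (asgs Q N) (λ _ → 1))) ⟩
    ∑ (asgs Q N) (λ _ → 1) * Q
      ≡⟨ trans (cong (_* Q) (∑-asgs-1 Q N)) (*-comm (Q ^ N) Q) ⟩
    Q * Q ^ N ∎ where open ≡-Reasoning
  cnt-coordinate (suc N) (suc c) v = begin
    cnt (λ (x : Asg Q (suc N)) → lookup x (suc c) == v) * Q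
      ≡⟨ cong (_* Q) (∑-asgs Q N _) ⟩
    ∑ (fins Q) (λ _ → cnt (λ (x : Asg Q N) → lookup x c == v)) * Q
      ≡⟨ cong (_* Q) (∑-const-fins Q _) ⟩
    Q * cnt (λ (x : Asg Q N) → lookup x c == v) * Q
      ≡⟨ trans (*-assoc Q _ Q) (cong (Q *_) (cnt-coordinate N c v)) ⟩
    Q * Q ^ N ∎ where open ≡-Reasoning

module _ {Q N : ℕ} .{{_ : NonZero Q}} where

  Pair : Set
  Pair = Fin N × Fin Q

  _≐_ : Pair → Pair → Bool
  (c , v) ≐ (c' , v') = (c == c') ∧ (v == v')

  ≐-true : ∀ {p q} → (p ≐ q) ≡ true → p ≡ q
  ≐-true {c , v} {c' , v'} e = cong₂ _,_ (==-true (proj₁ (∧-true e))) (==-true (proj₂ (∧-true {c == c'} e)))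

  hit : Pair → Asg Q N → Bool
  hit (c , v) x = lookup x c == v

  -- Two different pairs at the same coordinate exclude each other, which makes the count 0;
  -- otherwise every pair contributes a factor 1/Q by independence. This is why the result is an
  -- inequality.
  cnt-hits : ∀ ps → AllPairs _≢_ ps → cnt (λ x → all (λ p → hit p x) ps) * Q ^ length ps ≤ Q ^ N
  cnt-hits []             _         = ≤-reflexive (trans (*-identityʳ _) (∑-asgs-1 Q N))
  cnt-hits ((c , v) ∷ ps) (p≢ ∷ ap) with any (λ p → proj₁ p == c) ps in e
  ... | true  = ≤-trans (≤-reflexive (cong (_* Q ^ suc (length ps)) (∑-zero∀ (asgs Q N) never))) z≤n
    where
    clashing : ∀ ps → All ((c , v) ≢_) ps → any (λ p → proj₁ p == c) ps ≡ true →
               ∀ x → hit (c , v) x ≡ true → all (λ p → hit p x) ps ≡ false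
    clashing ((c' , v') ∷ ps) (ne ∷ nes) an x hx with c' F.≟ c
    ... | no _     = trans (cong (hit (c' , v') x ∧_) (clashing ps nes an x hx)) (𝔹.∧-zeroʳ _)
    ... | yes refl with lookup x c F.≟ v'
    ...   | no _    = refl
    ...   | yes eq  = ⊥-elim (ne (cong (c ,_) (trans (sym (==-true hx)) eq)))
    never : ∀ x → 𝟙 (hit (c , v) x ∧ all (λ p → hit p x) ps) ≡ 0
    never x with hit (c , v) x in hx
    ... | false = refl
    ... | true rewrite clashing ps p≢ e x hx = refl
  ... | false = begin
    cnt (λ x → hit (c , v) x ∧ all (λ p → hit p x) ps) * (Q * Q ^ length ps)
      ≡⟨ sym (*-assoc (cnt (λ x → hit (c , v) x ∧ all (λ p → hit p x) ps)) Q _) ⟩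
    cnt (λ x → hit (c , v) x ∧ all (λ p → hit p x) ps) * Q * Q ^ length ps
      ≡⟨ cong (_* Q ^ length ps) step ⟩
    cnt (λ x → all (λ p → hit p x) ps) * Q ^ length ps
      ≤⟨ cnt-hits ps ap ⟩
    Q ^ N ∎
    where
    open ≤-Reasoning
    others : ∀ ps → any (λ p → proj₁ p == c) ps ≡ false →
             Local (λ c' → (c' == c) ≡ false) (λ (x : Asg Q N) → all (λ p → hit p x) ps)
    others []               an x x' h = refl
    others ((c' , v') ∷ ps) an x x' h with c' F.≟ c
    ... | no ne = cong₂ (λ w b → (w == v') ∧ b) (h c' (==-≢ ne)) (others ps an x x' h)
    one : Local (λ c' → (c' == c) ≡ true) (λ (x : Asg Q N) → hit (c , v) x)
    one x x' h = cong (_== v) (h c (==-refl c))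
    rearrange : ∀ a b c → a * b * c ≡ a * c * b
    rearrange = solve-∀
    step : cnt (λ x → hit (c , v) x ∧ all (λ p → hit p x) ps) * Q ≡ cnt (λ x → all (λ p → hit p x) ps)
    step = *-cancelʳ-≡ _ _ (Q ^ N) {{m^n≢0 Q N}} (≡.begin
      cnt (λ x → hit (c , v) x ∧ all (λ p → hit p x) ps) * Q * Q ^ N
        ≡.≡⟨ rearrange (cnt (λ x → hit (c , v) x ∧ all (λ p → hit p x) ps)) Q (Q ^ N) ⟩
      cnt (λ x → hit (c , v) x ∧ all (λ p → hit p x) ps) * Q ^ N * Q
        ≡.≡⟨ cong (λ z → z * Q ^ N * Q) (∑-cong (asgs Q N) (λ x → 𝟙-∧ (hit (c , v) x) _)) ⟩
      ∑ (asgs Q N) (λ x → 𝟙 (hit (c , v) x) * 𝟙 (all (λ p → hit p x) ps)) * Q ^ N * Q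
        ≡.≡⟨ cong (_* Q) (indep N (_== c) _ _ (λ x x' h → cong 𝟙 (one x x' h)) (λ x x' h → cong 𝟙 (others ps e x x' h))) ⟩
      cnt (hit (c , v)) * cnt (λ x → all (λ p → hit p x) ps) * Q
        ≡.≡⟨ rearrange (cnt (hit (c , v))) _ Q ⟩
      cnt (hit (c , v)) * Q * cnt (λ x → all (λ p → hit p x) ps)
        ≡.≡⟨ trans (cong (_* cnt (λ x → all (λ p → hit p x) ps)) (cnt-coordinate N c v)) (*-comm (Q ^ N) _) ⟩
      cnt (λ x → all (λ p → hit p x) ps) * Q ^ N ≡.∎)
      where module ≡ = ≡-Reasoning

module _ {Q : ℕ} where

  clear : ∀ {N} → (Fin N → Fin Q → Bool) → Asg Q N → Bool
  clear forb []      = true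
  clear forb (v ∷ x) = not (forb zero v) ∧ clear (forb ∘ suc) x

  clear-intro : ∀ {N} (forb : Fin N → Fin Q → Bool) x → (∀ c → forb c (lookup x c) ≡ false) → clear forb x ≡ true
  clear-intro forb []      h = refl
  clear-intro forb (v ∷ x) h rewrite h zero = clear-intro (forb ∘ suc) x (h ∘ suc)

  private
    avoid-one : ∀ k f → k + f ≡ Q → k * suc Q ^ f ≤ Q * Q ^ f
    avoid-one k zero    e = ≤-reflexive (cong (_* 1) (trans (sym (+-identityʳ k)) e))
    avoid-one k (suc f) e = begin
      k * (suc Q * suc Q ^ f)       ≡⟨ sym (*-assoc k (suc Q) _) ⟩
      k * suc Q * suc Q ^ f         ≤⟨ *-monoˡ-≤ (suc Q ^ f) (begin
          k * suc Q   ≡⟨ *-suc k Q ⟩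
          k + k * Q   ≤⟨ +-monoˡ-≤ (k * Q) (subst (k ≤_) e (m≤m+n k (suc f))) ⟩
          suc k * Q   ∎) ⟩
      suc k * Q * suc Q ^ f         ≡⟨ rearrange (suc k) Q (suc Q ^ f) ⟩
      Q * (suc k * suc Q ^ f)       ≤⟨ *-monoʳ-≤ Q (avoid-one (suc k) f (trans (sym (+-suc k f)) e)) ⟩
      Q * (Q * Q ^ f)               ∎
      where
      open ≤-Reasoning
      rearrange : ∀ a b c → a * b * c ≡ b * (a * c)
      rearrange = solve-∀

  -- With f forbidden values at a coordinate, `avoid-one` gives 1 - f/Q ≤ (Q / (Q + 1)) ^ f. The
  -- product over the coordinates then depends only on the total number of forbidden pairs, not on
  -- their distribution.
  cnt-clear : ∀ N (forb : Fin N → Fin Q → Bool) →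
    let size = ∑ (fins N) (λ c → ∑ (fins Q) (λ v → 𝟙 (forb c v))) in
    cnt (clear forb) * suc Q ^ size ≤ Q ^ N * Q ^ size
  cnt-clear zero    forb = ≤-refl
  cnt-clear (suc N) forb = begin
    cnt (clear forb) * suc Q ^ size
      ≡⟨ cong₂ (λ a b → a * suc Q ^ b) head (∑-suc N row) ⟩
    k * K * suc Q ^ (f + size')
      ≡⟨ cong (k * K *_) (^-distribˡ-+-* (suc Q) f size') ⟩
    k * K * (suc Q ^ f * suc Q ^ size')
      ≡⟨ rearrange k K (suc Q ^ f) (suc Q ^ size') ⟩
    k * suc Q ^ f * (K * suc Q ^ size')
      ≤⟨ *-mono-≤ (avoid-one k f k+f) (cnt-clear N (forb ∘ suc)) ⟩
    Q * Q ^ f * (Q ^ N * Q ^ size')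
      ≡⟨ rearrange Q (Q ^ f) (Q ^ N) (Q ^ size') ⟩
    Q * Q ^ N * (Q ^ f * Q ^ size')
      ≡⟨ cong (Q * Q ^ N *_) (trans (sym (^-distribˡ-+-* Q f size')) (cong (Q ^_) (sym (∑-suc N row)))) ⟩
    Q ^ suc N * Q ^ size ∎
    where
    open ≤-Reasoning
    row : Fin (suc N) → ℕ
    row c = ∑ (fins Q) (λ v → 𝟙 (forb c v))
    size size' f k K : ℕ
    size = ∑ (fins (suc N)) (λ c → ∑ (fins Q) (λ v → 𝟙 (forb c v)))
    size' = ∑ (fins N) (λ c → ∑ (fins Q) (λ v → 𝟙 (forb (suc c) v)))
    f = ∑ (fins Q) (λ v → 𝟙 (forb zero v))
    k = ∑ (fins Q) (λ v → 𝟙 (not (forb zero v)))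
    K = cnt (clear (forb ∘ suc))
    rearrange : ∀ a b c d → a * b * (c * d) ≡ a * c * (b * d)
    rearrange = solve-∀
    k+f : k + f ≡ Q
    k+f = trans (sym (∑-+ (fins Q) _ _)) (trans (∑-cong (fins Q) (λ v → trans (+-comm (𝟙 (not (forb zero v))) _) (𝟙-not (forb zero v))))
            (trans (∑-const-fins Q 1) (*-identityʳ Q)))
    head : cnt (clear forb) ≡ k * K
    head = trans (∑-asgs Q N _) (trans (∑-cong (fins Q) (λ v →
             trans (∑-cong (asgs Q N) (λ x → 𝟙-∧ (not (forb zero v)) (clear (forb ∘ suc) x)))
                   (∑-*ˡ (asgs Q N) (𝟙 (not (forb zero v))) _)))
             (∑-*ʳ (fins Q) K _))

fins-unique : ∀ n → AllPairs _≢_ (fins n)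
fins-unique zero    = []
fins-unique (suc n) = AllP.map⁺ (All.universal (λ _ ()) (fins n)) ∷ AP.map⁺ (APmap (λ h e → h (F.suc-injective e)) (fins-unique n))
  where
  APmap : {A : Set} {P R : A → A → Set} → (∀ {x y} → P x y → R x y) → ∀ {xs} → AllPairs P xs → AllPairs R xs
  APmap f []       = []
  APmap f (p ∷ ps) = All.map f p ∷ APmap f ps

any-false : {A : Set} (p : A → Bool) (xs : List A) → (∀ {x} → x ∈ˡ xs → p x ≡ false) → any p xs ≡ false
any-false p []       h = refl
any-false p (x ∷ xs) h rewrite h (here refl) = any-false p xs (h ∘ there)

any-false⁻ : {A : Set} (p : A → Bool) (xs : List A) → any p xs ≡ false → ∀ {x} → x ∈ˡ xs → p x ≡ false
any-false⁻ p (x ∷ xs) h i with p x in e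
any-false⁻ p (x ∷ xs) h (here refl) | false = e
any-false⁻ p (x ∷ xs) h (there i)   | false = any-false⁻ p xs h i

𝟙-∨ : ∀ a b → 𝟙 (a ∨ b) ≤ 𝟙 a + 𝟙 b
𝟙-∨ true  b = s≤s z≤n
𝟙-∨ false b = ≤-refl

𝟙-any : {A : Set} (p : A → Bool) (xs : List A) → 𝟙 (any p xs) ≤ ∑ xs (λ x → 𝟙 (p x))
𝟙-any p []       = z≤n
𝟙-any p (x ∷ xs) = ≤-trans (𝟙-∨ (p x) _) (+-monoʳ-≤ (𝟙 (p x)) (𝟙-any p xs))

∨-false : ∀ {a b} → a ∨ b ≡ false → a ≡ false × b ≡ false
∨-false {false} {false} _ = refl , refl

not-true : ∀ {b} → not b ≡ true → b ≡ false
not-true {false} _ = refl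

length-filter-∑ : {A : Set} (p : A → Bool) (xs : List A) → length (filterᵇ p xs) ≡ ∑ xs (λ x → 𝟙 (p x))
length-filter-∑ p []       = refl
length-filter-∑ p (x ∷ xs) with p x
... | true  = cong suc (length-filter-∑ p xs)
... | false = length-filter-∑ p xs

∈-filter⁻ : {A : Set} (p : A → Bool) (xs : List A) {x : A} → x ∈ˡ filterᵇ p xs → p x ≡ true
∈-filter⁻ p (y ∷ xs) i with p y in e
∈-filter⁻ p (y ∷ xs) (here refl) | true  = e
∈-filter⁻ p (y ∷ xs) (there i)   | true  = ∈-filter⁻ p xs i
... | false = ∈-filter⁻ p xs i

AP-filter : {A : Set} {R : A → A → Set} (p : A → Bool) {xs : List A} → AllPairs R xs → AllPairs R (filterᵇ p xs)
AP-filter p {[]}     []       = []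
AP-filter p {x ∷ xs} (r ∷ rs) with p x
... | true  = All-filter r ∷ AP-filter p rs
  where
  All-filter : ∀ {ys} → All _ ys → All _ (filterᵇ p ys)
  All-filter {[]}     []       = []
  All-filter {y ∷ ys} (q ∷ qs) with p y
  ... | true  = q ∷ All-filter qs
  ... | false = All-filter qs
... | false = AP-filter p rs

-- In the form (1 + 1/Q) ^ G ≥ 1 + G/Q it turns the exponential bound of `cnt-clear` into the factor
-- Q / (Q + G), which is the shape used in the thresholds.
bernoulli : ∀ Q G → Q ^ G * (Q + G) ≤ suc Q ^ G * Q
bernoulli Q zero    = ≤-reflexive (cong (1 *_) (+-identityʳ Q))
bernoulli Q (suc G) = begin
  Q * Q ^ G * (Q + suc G)       ≡⟨ lem (Q ^ G) Q G ⟩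
  Q ^ G * (Q * (Q + suc G))     ≤⟨ *-monoʳ-≤ (Q ^ G) (begin
      Q * (Q + suc G)               ≤⟨ m≤m+n _ G ⟩
      Q * (Q + suc G) + G           ≡⟨ lem₂ Q G ⟩
      suc Q * (Q + G)               ∎) ⟩
  Q ^ G * (suc Q * (Q + G))     ≡⟨ lem₃ (Q ^ G) (suc Q) (Q + G) ⟩
  suc Q * (Q ^ G * (Q + G))     ≤⟨ *-monoʳ-≤ (suc Q) (bernoulli Q G) ⟩
  suc Q * (suc Q ^ G * Q)       ≡⟨ sym (*-assoc (suc Q) (suc Q ^ G) Q) ⟩
  suc Q * suc Q ^ G * Q         ∎
  where
  open ≤-Reasoning
  lem : ∀ a Q G → Q * a * (Q + suc G) ≡ a * (Q * (Q + suc G))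
  lem = solve-∀
  lem₂ : ∀ Q G → Q * (Q + suc G) + G ≡ suc Q * (Q + G)
  lem₂ = solve-∀
  lem₃ : ∀ a b c → a * (b * c) ≡ b * (a * c)
  lem₃ = solve-∀

-- Each coordinate c picks a value v at random, and M u c v says that this pick covers the vertex u.
module Cover (N Q nB x y κ R A : ℕ) .{{_ : NonZero Q}}
  (M : Fin nB → Fin N → Fin Q → Bool) (active : Fin Q → Bool) (genuine : Fin N → Bool)
  where

  P : Set
  P = Fin N × Fin Q

  pairs : List P
  pairs = concatMap (λ c → map (c ,_) (fins Q)) (fins N)

  ∑-pairs : (f : P → ℕ) → ∑ pairs f ≡ ∑ (fins N) (λ c → ∑ (fins Q) (λ v → f (c , v)))
  ∑-pairs f = trans (∑-concatMap _ (fins N) f) (∑-cong (fins N) (λ c → ∑-map (c ,_) (fins Q) f))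

  ∑-pairs-δ : ∀ p (f : P → ℕ) → ∑ pairs (λ q → f q * 𝟙 (p ≐ q)) ≡ f p
  ∑-pairs-δ (c , v) f = begin
    ∑ pairs (λ q → f q * 𝟙 ((c , v) ≐ q))
      ≡⟨ ∑-pairs _ ⟩
    ∑ (fins N) (λ c' → ∑ (fins Q) (λ v' → f (c' , v') * 𝟙 ((c == c') ∧ (v == v'))))
      ≡⟨ ∑-cong (fins N) (λ c' → trans (∑-cong (fins Q) (λ v' → term c' v')) (trans (∑-*ˡ (fins Q) (𝟙 (c' == c)) _)
           (cong (𝟙 (c' == c) *_) (∑-δ v (λ v' → f (c' , v')))))) ⟩
    ∑ (fins N) (λ c' → 𝟙 (c' == c) * f (c' , v))
      ≡⟨ ∑-δ c (λ c' → f (c' , v)) ⟩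
    f (c , v) ∎
    where
    open ≡-Reasoning
    lem : ∀ a b d → a * (b * d) ≡ b * (d * a)
    lem = solve-∀
    term : ∀ c' v' → f (c' , v') * 𝟙 ((c == c') ∧ (v == v')) ≡ 𝟙 (c' == c) * (𝟙 (v' == v) * f (c' , v'))
    term c' v' rewrite ==-sym c c' | ==-sym v v' | 𝟙-∧ (c' == c) (v' == v) = lem (f (c' , v')) (𝟙 (c' == c)) _

  M' : Fin nB → P → Bool
  M' u (c , v) = M u c v

  adj : Fin N → Fin nB → ℕ
  adj c u = ∑ (fins Q) (λ v → 𝟙 (M u c v))

  hits : Fin nB → Asg Q N → ℕ
  hits u ω = ∑ pairs (λ p → 𝟙 (M' u p) * 𝟙 (hit p ω))

  -- Where survival is concerned, `row`, `active-x` and `uniform` are equalities: the more pairs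
  -- destroy an edge, the less likely it survives, so the number of destroying pairs has to be known
  -- from below as well as from above.
  record Axioms : Set where
    field
      row      : ∀ u → ∑ pairs (λ p → 𝟙 (M' u p)) ≡ y
      codegree : ∀ u w → u ≢ w → ∑ pairs (λ p → 𝟙 (M' u p) * 𝟙 (M' w p)) ≤ κ
      adj≤κ    : ∀ c u → adj c u ≤ κ
      column   : ∀ p → ∑ (fins nB) (λ u → 𝟙 (M' u p)) ≤ R
      adj-sum  : ∀ c → ∑ (fins nB) (adj c) ≤ A
      active-x : ∑ (fins Q) (λ v → 𝟙 (active v)) ≡ x
      uniform  : ∀ p b → genuine (proj₁ p) ≡ true → M' b p ≡ true → ∑ (fins nB) (λ u → 𝟙 (M' u p)) ≡ R

  module Bounds (ax : Axioms) where
    open Axioms ax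

    -- Clashing is taken to be equality of pairs, so a non-clashing tuple consists of distinct pairs
    -- and `cnt-hits` gives its joint probability. The weight of one pair, at most `μ`, is then the
    -- clash bound.
    singles : ∀ (wt : P → ℕ) μ → (∀ p → wt p ≤ μ) → ∀ θ m (bad : Asg Q N → Bool) →
              (∀ ω → bad ω ≡ true → θ ≤ ∑ pairs (λ p → wt p * 𝟙 (hit p ω))) →
              cnt bad * (θ ∸ m * μ) ^ m * Q ^ m ≤ ∑ pairs wt ^ m * Q ^ N
    singles wt μ wt≤ θ m bad h = tail θ m (Q ^ m) (Q ^ N) bad (λ ω b → h ω b , tame ω) joint
      where
      open Tail (asgs Q N) pairs wt hit _≐_ μ
      tame : ∀ ω → Tame ω
      tame ω p _ = ≤-trans (≤-reflexive (∑-pairs-δ p (λ q → wt q * 𝟙 (hit q ω))))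
        (≤-trans (*-monoʳ-≤ (wt p) (𝟙≤1 (hit p ω))) (≤-trans (≤-reflexive (*-identityʳ _)) (wt≤ p)))
      apart : ∀ p ps → free p ps ≡ true → All (p ≢_) ps
      apart p []       f = []
      apart p (q ∷ ps) f = (λ { refl → case trans (sym (not-true (proj₁ (∧-true f)))) (cong₂ _∧_ (==-refl (proj₁ q)) (==-refl (proj₂ q))) of λ () })
        ∷ apart p ps (proj₂ (∧-true {not (q ≐ p)} f))
      distinct : ∀ {ps} → Separated ps → AllPairs _≢_ ps
      distinct []          = []
      distinct (add _ f s) = apart _ _ f ∷ distinct s
      joint : ∀ ps → Separated ps → length ps ≡ m → ∑ (asgs Q N) (λ ω → 𝟙 (reals ps ω)) * Q ^ m ≤ Q ^ N
      joint ps s refl = cnt-hits ps (distinct s)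

    Trip : Set
    Trip = P × Fin nB × P

    trips : List Trip
    trips = concatMap (λ p → concatMap (λ u → map (λ q → p , u , q) pairs) (fins nB)) pairs

    ∑-trips : (f : Trip → ℕ) → ∑ trips f ≡ ∑ pairs (λ p → ∑ (fins nB) (λ u → ∑ pairs (λ q → f (p , u , q))))
    ∑-trips f = trans (∑-concatMap _ pairs f) (∑-cong pairs (λ p → trans (∑-concatMap _ (fins nB) f)
                  (∑-cong (fins nB) (λ u → ∑-map _ pairs f))))

    -- If the pick `p` fails because of `q`, every edge between the coordinate of `p` and `b` may
    -- remain; the factor `adj` counts these edges.
    conflictWt : Fin nB → Trip → ℕ
    conflictWt b (p , u , q) = adj (proj₁ p) b * (𝟙 (M' u p) * 𝟙 (M' u q))

    -- Two different picks p and q cover u; hits is capped by K so that a conflict clashes with few others.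
    conflict : ℕ → Trip → Asg Q N → Bool
    conflict K (p , u , q) ω = hit p ω ∧ (hit q ω ∧ (not (p ≐ q) ∧ (hits u ω ≤ᵇ K)))

    -- Conflicts without a common pair use `2 * m` distinct pairs, whence the power of `Q`. Two
    -- conflicts can meet in four ways, and each way weighs at most `κ * (R * K)`: a fixed pair
    -- covers at most `R` vertices, each of them has at most `K` realized partners, and each weight
    -- is at most `κ`.
    conflicts : ∀ b K θ m (bad : Asg Q N → Bool) →
                (∀ ω → bad ω ≡ true → θ ≤ ∑ trips (λ h → conflictWt b h * 𝟙 (conflict K h ω))) →
                cnt bad * (θ ∸ m * (4 * (κ * (R * K)))) ^ m * Q ^ (2 * m) ≤ (y * (A * y)) ^ m * Q ^ N
    conflicts b K θ m bad h = ≤-trans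
      (tail θ m (Q ^ (2 * m)) (Q ^ N) bad (λ ω e → h ω e , tame ω) joint)
      (*-monoˡ-≤ (Q ^ N) (^-monoˡ-≤ m weight))
      where
      open ≤-Reasoning
      share : Trip → Trip → Bool
      share (p , _ , q) (p' , _ , q') = ((p ≐ p') ∨ (p ≐ q')) ∨ ((q ≐ p') ∨ (q ≐ q'))
      open Tail (asgs Q N) trips (conflictWt b) (conflict K) share (4 * (κ * (R * K)))

      weight : ∑ trips (conflictWt b) ≤ y * (A * y)
      weight = begin
        ∑ trips (conflictWt b)
          ≡⟨ ∑-trips _ ⟩
        ∑ pairs (λ p → ∑ (fins nB) (λ u → ∑ pairs (λ q → adj (proj₁ p) b * (𝟙 (M' u p) * 𝟙 (M' u q)))))
          ≡⟨ ∑-cong pairs (λ p → trans (∑-cong (fins nB) (λ u → trans (∑-*ˡ pairs (adj (proj₁ p) b) _)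
               (cong (adj (proj₁ p) b *_) (trans (∑-*ˡ pairs (𝟙 (M' u p)) _) (cong (𝟙 (M' u p) *_) (row u))))))
               (∑-*ˡ (fins nB) (adj (proj₁ p) b) _)) ⟩
        ∑ pairs (λ p → adj (proj₁ p) b * ∑ (fins nB) (λ u → 𝟙 (M' u p) * y))
          ≡⟨ ∑-cong pairs (λ p → cong (adj (proj₁ p) b *_) (∑-*ʳ (fins nB) y _)) ⟩
        ∑ pairs (λ p → adj (proj₁ p) b * (∑ (fins nB) (λ u → 𝟙 (M' u p)) * y))
          ≡⟨ trans (∑-pairs _) (∑-cong (fins N) (λ c → trans (∑-*ˡ (fins Q) (adj c b) _) (cong (adj c b *_) (∑-*ʳ (fins Q) y _)))) ⟩
        ∑ (fins N) (λ c → adj c b * (∑ (fins Q) (λ v → ∑ (fins nB) (λ u → 𝟙 (M u c v))) * y))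
          ≤⟨ ∑-mono (fins N) (λ c → *-monoʳ-≤ (adj c b) (*-monoˡ-≤ y
               (≤-trans (≤-reflexive (∑-swap (fins Q) (fins nB) (λ v u → 𝟙 (M u c v)))) (adj-sum c)))) ⟩
        ∑ (fins N) (λ c → adj c b * (A * y))
          ≡⟨ trans (∑-*ʳ (fins N) (A * y) _) (cong (_* (A * y)) (trans (sym (∑-pairs _)) (row b))) ⟩
        y * (A * y) ∎

      few : ∀ ω u → ∑ pairs (λ q → 𝟙 (M' u q) * (𝟙 (hit q ω) * 𝟙 (hits u ω ≤ᵇ K))) ≤ K
      few ω u = ≤-trans (≤-reflexive (trans (∑-cong pairs (λ q → sym (*-assoc (𝟙 (M' u q)) _ _))) (∑-*ʳ pairs (𝟙 (hits u ω ≤ᵇ K)) _))) lem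
        where
        lem : hits u ω * 𝟙 (hits u ω ≤ᵇ K) ≤ K
        lem with hits u ω ≤ᵇ K in e
        ... | true  = ≤-trans (≤-reflexive (*-identityʳ _)) (≤ᵇ-true {hits u ω} e)
        ... | false = ≤-trans (≤-reflexive (*-zeroʳ (hits u ω))) z≤n

      real≤q : ∀ p u q ω → 𝟙 (conflict K (p , u , q) ω) ≤ 𝟙 (hit q ω) * 𝟙 (hits u ω ≤ᵇ K)
      real≤q p u q ω with hit p ω | hit q ω | not (p ≐ q) | hits u ω ≤ᵇ K
      ... | true  | true  | true  | true  = ≤-refl
      ... | true  | true  | true  | false = z≤n
      ... | true  | true  | false | _     = z≤n
      ... | true  | false | _     | _     = z≤n
      ... | false | _     | _     | _     = z≤n

      real≤p : ∀ p u q ω → 𝟙 (conflict K (p , u , q) ω) ≤ 𝟙 (hit p ω) * 𝟙 (hits u ω ≤ᵇ K)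
      real≤p p u q ω with hit p ω | hit q ω | not (p ≐ q) | hits u ω ≤ᵇ K
      ... | true  | true  | true  | true  = ≤-refl
      ... | true  | true  | true  | false = z≤n
      ... | true  | true  | false | _     = z≤n
      ... | true  | false | _     | _     = z≤n
      ... | false | _     | _     | _     = z≤n

      G₁ : ∀ ω r → ∑ trips (λ { h@(p , u , q) → conflictWt b h * 𝟙 (conflict K h ω) * 𝟙 (r ≐ p) }) ≤ κ * (R * K)
      G₁ ω r = begin
        ∑ trips (λ { h@(p , u , q) → conflictWt b h * 𝟙 (conflict K h ω) * 𝟙 (r ≐ p) })
          ≡⟨ ∑-trips _ ⟩
        ∑ pairs (λ p → ∑ (fins nB) (λ u → ∑ pairs (λ q → adj (proj₁ p) b * (𝟙 (M' u p) * 𝟙 (M' u q)) * 𝟙 (conflict K (p , u , q) ω) * 𝟙 (r ≐ p))))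
          ≡⟨ ∑-cong pairs (λ p → trans (∑-cong (fins nB) (λ u → ∑-*ʳ pairs (𝟙 (r ≐ p)) _)) (∑-*ʳ (fins nB) (𝟙 (r ≐ p)) _)) ⟩
        ∑ pairs (λ p → ∑ (fins nB) (λ u → ∑ pairs (λ q → adj (proj₁ p) b * (𝟙 (M' u p) * 𝟙 (M' u q)) * 𝟙 (conflict K (p , u , q) ω))) * 𝟙 (r ≐ p))
          ≡⟨ ∑-pairs-δ r (λ p → ∑ (fins nB) (λ u → ∑ pairs (λ q → adj (proj₁ p) b * (𝟙 (M' u p) * 𝟙 (M' u q)) * 𝟙 (conflict K (p , u , q) ω)))) ⟩
        ∑ (fins nB) (λ u → ∑ pairs (λ q → adj (proj₁ r) b * (𝟙 (M' u r) * 𝟙 (M' u q)) * 𝟙 (conflict K (r , u , q) ω)))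
          ≤⟨ ∑-mono (fins nB) (λ u → ≤-trans (∑-mono pairs (λ q → begin
               adj (proj₁ r) b * (𝟙 (M' u r) * 𝟙 (M' u q)) * 𝟙 (conflict K (r , u , q) ω)
                 ≤⟨ *-mono-≤ (*-monoˡ-≤ (𝟙 (M' u r) * 𝟙 (M' u q)) (adj≤κ (proj₁ r) b)) (real≤q r u q ω) ⟩
               κ * (𝟙 (M' u r) * 𝟙 (M' u q)) * (𝟙 (hit q ω) * 𝟙 (hits u ω ≤ᵇ K))
                 ≡⟨ lem κ (𝟙 (M' u r)) (𝟙 (M' u q)) _ ⟩
               κ * 𝟙 (M' u r) * (𝟙 (M' u q) * (𝟙 (hit q ω) * 𝟙 (hits u ω ≤ᵇ K))) ∎))
               (≤-trans (≤-reflexive (∑-*ˡ pairs (κ * 𝟙 (M' u r)) _)) (*-monoʳ-≤ (κ * 𝟙 (M' u r)) (few ω u)))) ⟩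
        ∑ (fins nB) (λ u → κ * 𝟙 (M' u r) * K)
          ≡⟨ trans (∑-*ʳ (fins nB) K _) (cong (_* K) (∑-*ˡ (fins nB) κ _)) ⟩
        κ * ∑ (fins nB) (λ u → 𝟙 (M' u r)) * K
          ≤⟨ *-monoˡ-≤ K (*-monoʳ-≤ κ (column r)) ⟩
        κ * R * K
          ≡⟨ *-assoc κ R K ⟩
        κ * (R * K) ∎
        where
        lem : ∀ a b c d → a * (b * c) * d ≡ a * b * (c * d)
        lem = solve-∀

      G₂ : ∀ ω r → ∑ trips (λ { h@(p , u , q) → conflictWt b h * 𝟙 (conflict K h ω) * 𝟙 (r ≐ q) }) ≤ κ * (R * K)
      G₂ ω r = begin
        ∑ trips (λ { h@(p , u , q) → conflictWt b h * 𝟙 (conflict K h ω) * 𝟙 (r ≐ q) })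
          ≡⟨ ∑-trips _ ⟩
        ∑ pairs (λ p → ∑ (fins nB) (λ u → ∑ pairs (λ q → adj (proj₁ p) b * (𝟙 (M' u p) * 𝟙 (M' u q)) * 𝟙 (conflict K (p , u , q) ω) * 𝟙 (r ≐ q))))
          ≡⟨ ∑-cong pairs (λ p → ∑-cong (fins nB) (λ u → ∑-pairs-δ r (λ q → adj (proj₁ p) b * (𝟙 (M' u p) * 𝟙 (M' u q)) * 𝟙 (conflict K (p , u , q) ω)))) ⟩
        ∑ pairs (λ p → ∑ (fins nB) (λ u → adj (proj₁ p) b * (𝟙 (M' u p) * 𝟙 (M' u r)) * 𝟙 (conflict K (p , u , r) ω)))
          ≤⟨ ∑-mono pairs (λ p → ∑-mono (fins nB) (λ u → begin
               adj (proj₁ p) b * (𝟙 (M' u p) * 𝟙 (M' u r)) * 𝟙 (conflict K (p , u , r) ω)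
                 ≤⟨ *-mono-≤ (*-monoˡ-≤ (𝟙 (M' u p) * 𝟙 (M' u r)) (adj≤κ (proj₁ p) b)) (real≤p p u r ω) ⟩
               κ * (𝟙 (M' u p) * 𝟙 (M' u r)) * (𝟙 (hit p ω) * 𝟙 (hits u ω ≤ᵇ K))
                 ≡⟨ lem κ (𝟙 (M' u p)) (𝟙 (M' u r)) _ ⟩
               κ * 𝟙 (M' u r) * (𝟙 (M' u p) * (𝟙 (hit p ω) * 𝟙 (hits u ω ≤ᵇ K))) ∎)) ⟩
        ∑ pairs (λ p → ∑ (fins nB) (λ u → κ * 𝟙 (M' u r) * (𝟙 (M' u p) * (𝟙 (hit p ω) * 𝟙 (hits u ω ≤ᵇ K)))))
          ≡⟨ ∑-swap pairs (fins nB) _ ⟩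
        ∑ (fins nB) (λ u → ∑ pairs (λ p → κ * 𝟙 (M' u r) * (𝟙 (M' u p) * (𝟙 (hit p ω) * 𝟙 (hits u ω ≤ᵇ K)))))
          ≤⟨ ∑-mono (fins nB) (λ u → ≤-trans (≤-reflexive (∑-*ˡ pairs (κ * 𝟙 (M' u r)) _)) (*-monoʳ-≤ (κ * 𝟙 (M' u r)) (few ω u))) ⟩
        ∑ (fins nB) (λ u → κ * 𝟙 (M' u r) * K)
          ≡⟨ trans (∑-*ʳ (fins nB) K _) (cong (_* K) (∑-*ˡ (fins nB) κ _)) ⟩
        κ * ∑ (fins nB) (λ u → 𝟙 (M' u r)) * K
          ≤⟨ *-monoˡ-≤ K (*-monoʳ-≤ κ (column r)) ⟩
        κ * R * K
          ≡⟨ *-assoc κ R K ⟩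
        κ * (R * K) ∎
        where
        lem : ∀ a b c d → a * (b * c) * d ≡ a * c * (b * d)
        lem = solve-∀

      tame : ∀ ω → Tame ω
      tame ω h@(p , u , q) _ = begin
        ∑ trips (λ h' → c h' * 𝟙 (share h h'))
          ≤⟨ ∑-mono trips (λ { h'@(p' , u' , q') → *-monoʳ-≤ (c h') (≤-trans (𝟙-∨ ((p ≐ p') ∨ (p ≐ q')) _) (+-mono-≤ (𝟙-∨ (p ≐ p') _) (𝟙-∨ (q ≐ p') _))) }) ⟩
        ∑ trips (λ { h'@(p' , u' , q') → c h' * ((𝟙 (p ≐ p') + 𝟙 (p ≐ q')) + (𝟙 (q ≐ p') + 𝟙 (q ≐ q'))) })
          ≡⟨ ∑-cong trips (λ { h'@(p' , u' , q') → lem (c h') (𝟙 (p ≐ p')) (𝟙 (p ≐ q')) (𝟙 (q ≐ p')) (𝟙 (q ≐ q')) }) ⟩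
        ∑ trips (λ h' → (c₁ p h' + c₂ p h') + (c₁ q h' + c₂ q h'))
          ≡⟨ trans (∑-+ trips _ _) (cong₂ _+_ (∑-+ trips (c₁ p) (c₂ p)) (∑-+ trips (c₁ q) (c₂ q))) ⟩
        (∑ trips (c₁ p) + ∑ trips (c₂ p)) + (∑ trips (c₁ q) + ∑ trips (c₂ q))
          ≤⟨ +-mono-≤ (+-mono-≤ (G₁ ω p) (G₂ ω p)) (+-mono-≤ (G₁ ω q) (G₂ ω q)) ⟩
        (κ * (R * K) + κ * (R * K)) + (κ * (R * K) + κ * (R * K))
          ≡⟨ lem₂ (κ * (R * K)) ⟩
        4 * (κ * (R * K)) ∎
        where
        c : Trip → ℕ
        c h' = conflictWt b h' * 𝟙 (conflict K h' ω)
        c₁ c₂ : P → Trip → ℕ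
        c₁ r = λ { h'@(p' , u' , q') → conflictWt b h' * 𝟙 (conflict K h' ω) * 𝟙 (r ≐ p') }
        c₂ r = λ { h'@(p' , u' , q') → conflictWt b h' * 𝟙 (conflict K h' ω) * 𝟙 (r ≐ q') }
        lem : ∀ a b c d e → a * ((b + c) + (d + e)) ≡ (a * b + a * c) + (a * d + a * e)
        lem = solve-∀
        lem₂ : ∀ a → (a + a) + (a + a) ≡ 4 * a
        lem₂ = solve-∀

      flat : List Trip → List P
      flat []                 = []
      flat ((p , _ , q) ∷ hs) = p ∷ q ∷ flat hs

      length-flat : ∀ hs → length (flat hs) ≡ 2 * length hs
      length-flat []       = refl
      length-flat (_ ∷ hs) = trans (cong 2+ (length-flat hs)) (lem (length hs))
        where
        lem : ∀ n → 2+ (2 * n) ≡ 2 * suc n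
        lem = solve-∀

      proper : List Trip → Bool
      proper hs = all (λ { (p , _ , q) → not (p ≐ q) }) hs

      improper : ∀ hs ω → proper hs ≡ false → reals hs ω ≡ false
      improper ((p , u , q) ∷ hs) ω h with hit p ω | hit q ω | not (p ≐ q)
      ... | false | _     | _     = refl
      ... | true  | false | _     = refl
      ... | true  | true  | false = refl
      ... | true  | true  | true  = trans (cong ((hits u ω ≤ᵇ K) ∧_) (improper hs ω h)) (𝔹.∧-zeroʳ _)

      reals-hit : ∀ hs ω → 𝟙 (reals hs ω) ≤ 𝟙 (all (λ p → hit p ω) (flat hs))
      reals-hit []                  ω = ≤-refl
      reals-hit ((p , u , q) ∷ hs) ω with hit p ω | hit q ω | not (p ≐ q) | hits u ω ≤ᵇ K
      ... | false | _     | _     | _     = z≤n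
      ... | true  | false | _     | _     = z≤n
      ... | true  | true  | false | _     = z≤n
      ... | true  | true  | true  | false = z≤n
      ... | true  | true  | true  | true  = reals-hit hs ω

      ≐-false : ∀ {p q : P} → (p ≐ q) ≡ false → p ≢ q
      ≐-false {p} e refl = case trans (sym e) (cong₂ _∧_ (==-refl (proj₁ p)) (==-refl (proj₂ p))) of λ ()

      apart : ∀ p u q hs → free (p , u , q) hs ≡ true → All (p ≢_) (flat hs) × All (q ≢_) (flat hs)
      apart p u q []                      f = [] , []
      apart p u q ((p' , u' , q') ∷ hs) f with ∧-true {not (share (p' , u' , q') (p , u , q))} f
      ... | f₁ , f₂ with ∨-false {(p' ≐ p) ∨ (p' ≐ q)} (not-true f₁)
      ... | g₁ , g₂ with ∨-false {p' ≐ p} g₁ | ∨-false {q' ≐ p} g₂ | apart p u q hs f₂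
      ... | a , b' | c , d | ps , qs =
        (≐-false a ∘ sym) ∷ (≐-false c ∘ sym) ∷ ps , (≐-false b' ∘ sym) ∷ (≐-false d ∘ sym) ∷ qs

      distinct : ∀ {hs} → Separated hs → proper hs ≡ true → AllPairs _≢_ (flat hs)
      distinct []                               pr = []
      distinct (add {p , u , q} {hs} _ f s) pr with ∧-true {not (p ≐ q)} pr | apart p u q hs f
      ... | pq , pr' | ps , qs = (≐-false (not-true pq) ∷ ps) ∷ qs ∷ distinct s pr'

      joint : ∀ hs → Separated hs → length hs ≡ m → ∑ (asgs Q N) (λ ω → 𝟙 (reals hs ω)) * Q ^ (2 * m) ≤ Q ^ N
      joint hs s refl with proper hs in pr
      ... | false = ≤-trans (≤-reflexive (cong (_* Q ^ (2 * length hs)) (∑-zero∀ (asgs Q N) (λ ω → cong 𝟙 (improper hs ω pr))))) z≤n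
      ... | true  = begin
        ∑ (asgs Q N) (λ ω → 𝟙 (reals hs ω)) * Q ^ (2 * length hs)
          ≤⟨ *-monoˡ-≤ (Q ^ (2 * length hs)) (∑-mono (asgs Q N) (reals-hit hs)) ⟩
        cnt (λ ω → all (λ p → hit p ω) (flat hs)) * Q ^ (2 * length hs)
          ≡⟨ cong (λ k → cnt (λ ω → all (λ p → hit p ω) (flat hs)) * Q ^ k) (sym (length-flat hs)) ⟩
        cnt (λ ω → all (λ p → hit p ω) (flat hs)) * Q ^ length (flat hs)
          ≤⟨ cnt-hits (flat hs) (distinct s pr) ⟩
        Q ^ N ∎

-- Survival of the edges at a B-vertex

^-distribʳ-* : ∀ m a b → (a * b) ^ m ≡ a ^ m * b ^ m
^-distribʳ-* zero    a b = refl
^-distribʳ-* (suc m) a b = trans (cong (a * b *_) (^-distribʳ-* m a b)) (lem a b (a ^ m) (b ^ m))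
  where
  lem : ∀ a b c d → a * b * (c * d) ≡ a * c * (b * d)
  lem = solve-∀

clear-elim : ∀ {Q N} (forb : Fin N → Fin Q → Bool) x → clear forb x ≡ true → ∀ c → forb c (lookup x c) ≡ false
clear-elim forb (v ∷ x) h zero    = not-true (proj₁ (∧-true h))
clear-elim forb (v ∷ x) h (suc c) = clear-elim (forb ∘ suc) x (proj₂ (∧-true {not (forb zero v)} h)) c

any-++ : {A : Set} (p : A → Bool) (xs ys : List A) → any p (xs ++ ys) ≡ any p xs ∨ any p ys
any-++ p []       ys = refl
any-++ p (x ∷ xs) ys = trans (cong (p x ∨_) (any-++ p xs ys)) (sym (𝔹.∨-assoc (p x) _ _))

𝟙-∨-∧ : ∀ a b → 𝟙 a + 𝟙 b ≤ 𝟙 (a ∨ b) + 𝟙 a * 𝟙 b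
𝟙-∨-∧ true  b = s≤s (m≤m+n (𝟙 b) 0)
𝟙-∨-∧ false b = m≤m+n (𝟙 b) 0

module Survival (N Q nB x y κ R A : ℕ) .{{_ : NonZero Q}}
  (M : Fin nB → Fin N → Fin Q → Bool) (active : Fin Q → Bool) (genuine : Fin N → Bool)
  (ax : Cover.Axioms N Q nB x y κ R A M active genuine) (b : Fin nB)
  where

  open Cover N Q nB x y κ R A M active genuine
  open Axioms ax

  -- A label names something that must not happen if an edge is to survive: `inj₁ c` that the
  -- coordinate `c` becomes active, `inj₂ u` that `u` is covered. `block` is the set of pairs
  -- causing it.
  Label : Set
  Label = Fin N ⊎ Fin nB

  block : Label → P → Bool
  block (inj₁ c) (c' , v) = (c' == c) ∧ active v
  block (inj₂ u) p        = M' u p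

  -- The vertex `b` is left out: it lies on every edge counted at `b`, so its block would be common
  -- to all of them and their survivals would be far from independent. Leaving it out only enlarges
  -- the count that is bounded from above.
  other : Fin nB → P → Bool
  other u p = not (u == b) ∧ M' u p

  labels : P → List Label
  labels p = inj₁ (proj₁ p) ∷ map inj₂ (filterᵇ (λ u → other u p) (fins nB))

  forbidden : P → P → Bool
  forbidden p r = any (λ l → block l r) (labels p)

  survives : P → Asg Q N → Bool
  survives p = clear (λ c v → forbidden p (c , v))

  touches : P → P → Bool
  touches p p' = (proj₁ p == proj₁ p') ∨ any (λ u → other u p ∧ M' u p') (fins nB)

  wt : P → ℕ
  wt p = 𝟙 (M' b p) * 𝟙 (genuine (proj₁ p))

  open Tail (asgs Q N) pairs wt survives touches (κ + R * κ)

  private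
    -- For pairwise non-touching p₁ … pₘ the labels are distinct, so the forbidden blocks overlap in few pairs and
    -- the events survives pᵢ are jointly as unlikely as if they were independent.
    size : Label → ℕ
    size (inj₁ _) = x
    size (inj₂ _) = y

    block-size : ∀ l → ∑ pairs (λ r → 𝟙 (block l r)) ≡ size l
    block-size (inj₂ u) = row u
    block-size (inj₁ c) = begin
      ∑ pairs (λ r → 𝟙 (block (inj₁ c) r))
        ≡⟨ ∑-pairs _ ⟩
      ∑ (fins N) (λ c' → ∑ (fins Q) (λ v → 𝟙 ((c' == c) ∧ active v)))
        ≡⟨ ∑-cong (fins N) (λ c' → trans (∑-cong (fins Q) (λ v → 𝟙-∧ (c' == c) (active v))) (∑-*ˡ (fins Q) (𝟙 (c' == c)) _)) ⟩
      ∑ (fins N) (λ c' → 𝟙 (c' == c) * ∑ (fins Q) (λ v → 𝟙 (active v)))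
        ≡⟨ ∑-δ c _ ⟩
      ∑ (fins Q) (λ v → 𝟙 (active v))
        ≡⟨ active-x ⟩
      x ∎ where open ≡-Reasoning

    at-coordinate : ∀ c u → ∑ pairs (λ r → 𝟙 (c == proj₁ r) * 𝟙 (M' u r)) ≡ adj c u
    at-coordinate c u = begin
      ∑ pairs (λ r → 𝟙 (c == proj₁ r) * 𝟙 (M' u r))
        ≡⟨ ∑-pairs _ ⟩
      ∑ (fins N) (λ c' → ∑ (fins Q) (λ v → 𝟙 (c == c') * 𝟙 (M u c' v)))
        ≡⟨ ∑-cong (fins N) (λ c' → trans (∑-*ˡ (fins Q) (𝟙 (c == c')) _) (cong (λ z → 𝟙 z * adj c' u) (==-sym c c'))) ⟩
      ∑ (fins N) (λ c' → 𝟙 (c' == c) * adj c' u)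
        ≡⟨ ∑-δ c (λ c' → adj c' u) ⟩
      adj c u ∎ where open ≡-Reasoning

    mixed : ∀ c u → ∑ pairs (λ r → 𝟙 (block (inj₁ c) r) * 𝟙 (M' u r)) ≤ κ
    mixed c u = ≤-trans (∑-mono pairs (λ { (c' , v) → *-monoˡ-≤ (𝟙 (M u c' v)) (le c' v) }))
      (≤-trans (≤-reflexive (at-coordinate c u)) (adj≤κ c u))
      where
      le : ∀ c' v → 𝟙 ((c' == c) ∧ active v) ≤ 𝟙 (c == c')
      le c' v rewrite ==-sym c c' = 𝟙-mono _ _ (λ h → proj₁ (∧-true h))

    overlap≤ : ∀ l l' → l ≢ l' → ∑ pairs (λ r → 𝟙 (block l r) * 𝟙 (block l' r)) ≤ κ
    overlap≤ (inj₂ u) (inj₂ u') ne = codegree u u' (ne ∘ cong inj₂)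
    overlap≤ (inj₁ c) (inj₂ u)  ne = mixed c u
    overlap≤ (inj₂ u) (inj₁ c)  ne = ≤-trans (≤-reflexive (∑-cong pairs (λ r → *-comm (𝟙 (M' u r)) _))) (mixed c u)
    overlap≤ (inj₁ c) (inj₁ c') ne = ≤-trans (≤-reflexive (∑-zero∀ pairs zero-at)) z≤n
      where
      zero-at : ∀ r → 𝟙 (block (inj₁ c) r) * 𝟙 (block (inj₁ c') r) ≡ 0
      zero-at (d , v) with d F.≟ c
      ... | no _     = refl
      ... | yes refl rewrite ==-≢ {i = d} {c'} (ne ∘ cong inj₁) = *-zeroʳ (𝟙 (active v))

    covered : List Label → P → Bool
    covered ls r = any (λ l → block l r) ls

    -- Bonferroni's inequality: distinct blocks overlap in at most `κ` pairs, and the square of the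
    -- length is a generous bound for the number of pairs of labels.
    union : ∀ ls → AllPairs _≢_ ls →
            ∑ ls size ≤ ∑ pairs (λ r → 𝟙 (covered ls r)) + κ * (length ls * length ls)
    union []       _          = z≤n
    union (l ∷ ls) (ne ∷ nes) = begin
      size l + ∑ ls size
        ≤⟨ +-mono-≤ (≤-reflexive (sym (block-size l))) (union ls nes) ⟩
      ∑ pairs (λ r → 𝟙 (block l r)) + (∑ pairs (λ r → 𝟙 (covered ls r)) + κ * (n * n))
        ≡⟨ trans (sym (+-assoc (∑ pairs (λ r → 𝟙 (block l r))) _ (κ * (n * n))))
             (cong (_+ κ * (n * n)) (sym (∑-+ pairs (λ r → 𝟙 (block l r)) (λ r → 𝟙 (covered ls r))))) ⟩
      ∑ pairs (λ r → 𝟙 (block l r) + 𝟙 (covered ls r)) + κ * (n * n)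
        ≤⟨ +-monoˡ-≤ (κ * (n * n)) (≤-trans (∑-mono pairs (λ r → 𝟙-∨-∧ (block l r) (covered ls r))) (≤-reflexive (∑-+ pairs _ _))) ⟩
      C + ∑ pairs (λ r → 𝟙 (block l r) * 𝟙 (covered ls r)) + κ * (n * n)
        ≤⟨ +-monoˡ-≤ (κ * (n * n)) (+-monoʳ-≤ C over) ⟩
      C + n * κ + κ * (n * n)
        ≤⟨ m≤m+n _ (κ * suc n) ⟩
      C + n * κ + κ * (n * n) + κ * suc n
        ≡⟨ lem C κ n ⟩
      C + κ * (suc n * suc n) ∎
      where
      open ≤-Reasoning
      n C : ℕ
      n = length ls
      C = ∑ pairs (λ r → 𝟙 (covered (l ∷ ls) r))
      lem : ∀ C κ n → C + n * κ + κ * (n * n) + κ * suc n ≡ C + κ * (suc n * suc n)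
      lem = solve-∀
      sumκ : ∀ ls → All (l ≢_) ls → ∑ ls (λ l' → ∑ pairs (λ r → 𝟙 (block l r) * 𝟙 (block l' r))) ≤ length ls * κ
      sumκ []        []       = z≤n
      sumκ (l' ∷ ls) (h ∷ hs) = +-mono-≤ (overlap≤ l l' h) (sumκ ls hs)
      over : ∑ pairs (λ r → 𝟙 (block l r) * 𝟙 (covered ls r)) ≤ n * κ
      over = begin
        ∑ pairs (λ r → 𝟙 (block l r) * 𝟙 (covered ls r))
          ≤⟨ ∑-mono pairs (λ r → *-monoʳ-≤ (𝟙 (block l r)) (𝟙-any (λ l' → block l' r) ls)) ⟩
        ∑ pairs (λ r → 𝟙 (block l r) * ∑ ls (λ l' → 𝟙 (block l' r)))
          ≡⟨ ∑-cong pairs (λ r → sym (∑-*ˡ ls (𝟙 (block l r)) _)) ⟩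
        ∑ pairs (λ r → ∑ ls (λ l' → 𝟙 (block l r) * 𝟙 (block l' r)))
          ≡⟨ ∑-swap pairs ls _ ⟩
        ∑ ls (λ l' → ∑ pairs (λ r → 𝟙 (block l r) * 𝟙 (block l' r)))
          ≤⟨ sumκ ls ne ⟩
        n * κ ∎

    tame : ∀ ω → Tame ω
    tame ω p _ = begin
      ∑ pairs (λ p' → wt p' * 𝟙 (survives p' ω) * 𝟙 (touches p p'))
        ≤⟨ ∑-mono pairs (λ p' → *-mono-≤ (weight p' ω) (≤-trans (𝟙-∨ (proj₁ p == proj₁ p') _) (+-monoʳ-≤ (𝟙 (proj₁ p == proj₁ p'))
             (≤-trans (𝟙-any _ (fins nB)) (≤-reflexive (∑-cong (fins nB) (λ u → 𝟙-∧ (other u p) (M' u p')))))))) ⟩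
      ∑ pairs (λ p' → 𝟙 (M' b p') * (𝟙 (proj₁ p == proj₁ p') + ∑ (fins nB) (λ u → 𝟙 (other u p) * 𝟙 (M' u p'))))
        ≡⟨ trans (∑-cong pairs (λ p' → trans (*-distribˡ-+ (𝟙 (M' b p')) _ _) (cong₂ _+_ (*-comm (𝟙 (M' b p')) _)
             (trans (sym (∑-*ˡ (fins nB) (𝟙 (M' b p')) _)) (∑-cong (fins nB) (λ u → lem (𝟙 (M' b p')) (𝟙 (other u p)) _)))))) (∑-+ pairs _ _) ⟩
      ∑ pairs (λ p' → 𝟙 (proj₁ p == proj₁ p') * 𝟙 (M' b p')) + ∑ pairs (λ p' → ∑ (fins nB) (λ u → 𝟙 (other u p) * (𝟙 (M' u p') * 𝟙 (M' b p'))))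
        ≤⟨ +-mono-≤ (≤-trans (≤-reflexive (at-coordinate (proj₁ p) b)) (adj≤κ _ b)) second ⟩
      κ + R * κ ∎
      where
      open ≤-Reasoning
      lem : ∀ a c d → a * (c * d) ≡ c * (d * a)
      lem = solve-∀
      weight : ∀ p' ω → wt p' * 𝟙 (survives p' ω) ≤ 𝟙 (M' b p')
      weight p' ω = ≤-trans (*-mono-≤ (*-monoʳ-≤ (𝟙 (M' b p')) (𝟙≤1 (genuine (proj₁ p')))) (𝟙≤1 (survives p' ω)))
        (≤-reflexive (trans (*-identityʳ _) (*-identityʳ _)))
      each : ∀ u → 𝟙 (other u p) * ∑ pairs (λ p' → 𝟙 (M' u p') * 𝟙 (M' b p')) ≤ 𝟙 (M' u p) * κ
      each u with u F.≟ b
      ... | yes _ = z≤n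
      ... | no ne = *-monoʳ-≤ (𝟙 (M' u p)) (codegree u b ne)
      second : ∑ pairs (λ p' → ∑ (fins nB) (λ u → 𝟙 (other u p) * (𝟙 (M' u p') * 𝟙 (M' b p')))) ≤ R * κ
      second = begin
        ∑ pairs (λ p' → ∑ (fins nB) (λ u → 𝟙 (other u p) * (𝟙 (M' u p') * 𝟙 (M' b p'))))
          ≡⟨ trans (∑-swap pairs (fins nB) _) (∑-cong (fins nB) (λ u → ∑-*ˡ pairs (𝟙 (other u p)) _)) ⟩
        ∑ (fins nB) (λ u → 𝟙 (other u p) * ∑ pairs (λ p' → 𝟙 (M' u p') * 𝟙 (M' b p')))
          ≤⟨ ∑-mono (fins nB) each ⟩
        ∑ (fins nB) (λ u → 𝟙 (M' u p) * κ)
          ≡⟨ ∑-*ʳ (fins nB) κ _ ⟩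
        ∑ (fins nB) (λ u → 𝟙 (M' u p)) * κ
          ≤⟨ *-monoˡ-≤ κ (column p) ⟩
        R * κ ∎

    all-labels : List P → List Label
    all-labels []       = []
    all-labels (p ∷ ps) = labels p ++ all-labels ps

  ∈-labels : ∀ {u} p → inj₂ u ∈ˡ labels p → other u p ≡ true
  ∈-labels p (there i) with ∈-map⁻ inj₂ i
  ... | _ , j , refl = ∈-filter⁻ (λ u → other u p) (fins nB) j

  ∈-labels₁ : ∀ {c} p → inj₁ c ∈ˡ labels p → c ≡ proj₁ p
  ∈-labels₁ p (here refl) = refl
  ∈-labels₁ p (there i) with ∈-map⁻ inj₂ i
  ... | _ , _ , ()

  private
    true≢false : ∀ {b : Bool} → b ≡ true → b ≡ false → ⊥
    true≢false refl ()

    disjoint : ∀ p ps → free p ps ≡ true → ∀ {l} → l ∈ˡ labels p → l ∈ˡ all-labels ps → ⊥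
    disjoint p (p' ∷ ps) f {l} i j with ∈-++⁻ (labels p') j
    ... | inj₂ k = disjoint p ps (proj₂ (∧-true {not (touches p' p)} f)) i k
    ... | inj₁ k with ∨-false {proj₁ p' == proj₁ p} (not-true (proj₁ (∧-true f)))
    disjoint p (p' ∷ ps) f {inj₁ c} i j | inj₁ k | e , _ =
      true≢false (trans (cong₂ _==_ (sym (∈-labels₁ p' k)) (sym (∈-labels₁ p i))) (==-refl c)) e
    disjoint p (p' ∷ ps) f {inj₂ u} i j | inj₁ k | _ , e =
      true≢false (cong₂ _∧_ (∈-labels p' k) (proj₂ (∧-true {not (u == b)} (∈-labels p i)))) (any-false⁻ _ (fins nB) e (∈-fins u))

    labels-distinct : ∀ p → AllPairs _≢_ (labels p)
    labels-distinct p = AllP.map⁺ (All.universal (λ _ ()) (filterᵇ (λ u → other u p) (fins nB)))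
      ∷ AP.map⁺ (injected (AP-filter (λ u → other u p) (fins-unique nB)))
      where
      injected : ∀ {xs : List (Fin nB)} → AllPairs _≢_ xs → AllPairs (λ u w → inj₂ {A = Fin N} u ≢ inj₂ w) xs
      injected []       = []
      injected (h ∷ hs) = All.map (λ { ne refl → ne refl }) h ∷ injected hs

    distinct : ∀ {ps} → Separated ps → AllPairs _≢_ (all-labels ps)
    distinct []                      = []
    distinct (add {p} {ps} _ f s) = AP.++⁺ (labels-distinct p) (distinct s)
      (All.tabulate (λ i → All.tabulate (λ { j refl → disjoint p ps f i j })))

    module _ (1≤R : 1 ≤ R) where

      others : ∀ p → 0 < wt p → suc (∑ (fins nB) (λ u → 𝟙 (other u p))) ≡ R
      others p w = begin
        suc (∑ (fins nB) (λ u → 𝟙 (other u p)))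
          ≡⟨ cong (_+ ∑ (fins nB) (λ u → 𝟙 (other u p))) (sym (trans (∑-δ b (λ u → 𝟙 (M' u p))) (cong 𝟙 Mbp))) ⟩
        ∑ (fins nB) (λ u → 𝟙 (u == b) * 𝟙 (M' u p)) + ∑ (fins nB) (λ u → 𝟙 (other u p))
          ≡⟨ trans (sym (∑-+ (fins nB) _ _)) (∑-cong (fins nB) each) ⟩
        ∑ (fins nB) (λ u → 𝟙 (M' u p))
          ≡⟨ uniform p b (𝟙-pos _ (proj₂ (*-pos (𝟙 (M' b p)) _ w))) Mbp ⟩
        R ∎
        where
        open ≡-Reasoning
        Mbp : M' b p ≡ true
        Mbp = 𝟙-pos _ (proj₁ (*-pos (𝟙 (M' b p)) _ w))
        each : ∀ u → 𝟙 (u == b) * 𝟙 (M' u p) + 𝟙 (other u p) ≡ 𝟙 (M' u p)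
        each u with u == b
        ... | true  = trans (+-identityʳ _) (*-identityˡ _)
        ... | false = refl

      labels-length : ∀ {ps} → Separated ps → length (all-labels ps) ≡ length ps * R
      labels-length []                  = refl
      labels-length (add {p} {ps} w _ s) = trans (L.length-++ (labels p))
        (cong₂ _+_ (trans (cong suc (trans (L.length-map inj₂ (filterᵇ (λ u → other u p) (fins nB))) (length-filter-∑ (λ u → other u p) (fins nB)))) (others p w))
                   (labels-length s))

      labels-size : ∀ {ps} → Separated ps → ∑ (all-labels ps) size ≡ length ps * (x + (R ∸ 1) * y)
      labels-size []                  = refl
      labels-size (add {p} {ps} w _ s) = trans (∑-++ (labels p) _ size)
        (cong₂ _+_ (cong (x +_) (begin
            ∑ (map inj₂ (filterᵇ (λ u → other u p) (fins nB))) size   ≡⟨ ∑-map inj₂ (filterᵇ (λ u → other u p) (fins nB)) size ⟩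
            ∑ (filterᵇ (λ u → other u p) (fins nB)) (λ _ → y)         ≡⟨ ∑-const (filterᵇ (λ u → other u p) (fins nB)) y ⟩
            length (filterᵇ (λ u → other u p) (fins nB)) * y          ≡⟨ cong (_* y) (length-filter-∑ (λ u → other u p) (fins nB)) ⟩
            ∑ (fins nB) (λ u → 𝟙 (other u p)) * y                     ≡⟨ cong (_* y) (cong (_∸ 1) (others p w)) ⟩
            (R ∸ 1) * y                                              ∎)) (labels-size s))
        where open ≡-Reasoning

      reals-clear : ∀ ps ω → 𝟙 (reals ps ω) ≤ 𝟙 (clear (λ c v → covered (all-labels ps) (c , v)) ω)
      reals-clear ps ω = 𝟙-mono _ _ (λ h → clear-intro _ ω (λ c → go ps h c))
        where
        go : ∀ ps → reals ps ω ≡ true → ∀ c → covered (all-labels ps) (c , lookup ω c) ≡ false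
        go []       h c = refl
        go (p ∷ ps) h c = trans (any-++ _ (labels p) (all-labels ps))
          (cong₂ _∨_ (clear-elim _ ω (proj₁ (∧-true h)) c) (go ps (proj₂ (∧-true {survives p ω} h)) c))

      -- By `union` and `room` the labels of `m` separated pairs forbid at least `m * G` pairs.
      -- Hence `cnt-clear` bounds the joint probability by (1 + 1/Q) ^ (-m G), and Bernoulli's
      -- inequality by (Q / (Q + G)) ^ m. The forbidden pairs beyond `m * G` are given away through
      -- Q ≤ Q + 1.
      joint : ∀ m G → m * G + κ * (m * R * (m * R)) ≤ m * (x + (R ∸ 1) * y) →
              ∀ ps → Separated ps → length ps ≡ m → ∑ (asgs Q N) (λ ω → 𝟙 (reals ps ω)) * (Q + G) ^ m ≤ Q ^ m * Q ^ N
      joint m G room ps s refl = *-cancelʳ-≤ _ _ (Q ^ S) {{m^n≢0 Q S}} (begin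
        X * (Q + G) ^ m * Q ^ S
          ≡⟨ cong (X * (Q + G) ^ m *_) (trans (cong (Q ^_) (sym (m+[n∸m]≡n mG≤S))) (^-distribˡ-+-* Q (m * G) r)) ⟩
        X * (Q + G) ^ m * (Q ^ (m * G) * Q ^ r)
          ≡⟨ lem₁ X ((Q + G) ^ m) (Q ^ (m * G)) (Q ^ r) ⟩
        X * (Q ^ (m * G) * (Q + G) ^ m) * Q ^ r
          ≤⟨ *-mono-≤ (*-monoʳ-≤ X bern) (^-monoˡ-≤ r (n≤1+n Q)) ⟩
        X * (suc Q ^ (m * G) * Q ^ m) * suc Q ^ r
          ≡⟨ lem₂ X (suc Q ^ (m * G)) (Q ^ m) (suc Q ^ r) ⟩
        X * (suc Q ^ (m * G) * suc Q ^ r) * Q ^ m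
          ≡⟨ cong (λ z → X * z * Q ^ m) (trans (sym (^-distribˡ-+-* (suc Q) (m * G) r)) (cong (suc Q ^_) (m+[n∸m]≡n mG≤S))) ⟩
        X * suc Q ^ S * Q ^ m
          ≤⟨ *-monoˡ-≤ (Q ^ m) (≤-trans (*-monoˡ-≤ (suc Q ^ S) (∑-mono (asgs Q N) (reals-clear ps)))
               (subst (λ z → cnt (clear forb) * suc Q ^ z ≤ Q ^ N * Q ^ z) (sym (∑-pairs _)) (cnt-clear N forb))) ⟩
        Q ^ N * Q ^ S * Q ^ m
          ≡⟨ lem₃ (Q ^ N) (Q ^ S) (Q ^ m) ⟩
        Q ^ m * Q ^ N * Q ^ S ∎)
        where
        open ≤-Reasoning
        forb : Fin N → Fin Q → Bool
        forb c v = covered (all-labels ps) (c , v)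
        X S r : ℕ
        X = ∑ (asgs Q N) (λ ω → 𝟙 (reals ps ω))
        S = ∑ pairs (λ r → 𝟙 (covered (all-labels ps) r))
        r = S ∸ m * G
        mG≤S : m * G ≤ S
        mG≤S = +-cancelʳ-≤ (κ * (m * R * (m * R))) _ _ (begin
          m * G + κ * (m * R * (m * R))    ≤⟨ room ⟩
          m * (x + (R ∸ 1) * y)            ≡⟨ sym (labels-size s) ⟩
          ∑ (all-labels ps) size           ≤⟨ union (all-labels ps) (distinct s) ⟩
          S + κ * (length (all-labels ps) * length (all-labels ps))
            ≡⟨ cong (λ k → S + κ * (k * k)) (labels-length s) ⟩
          S + κ * (m * R * (m * R))        ∎)
        bern : Q ^ (m * G) * (Q + G) ^ m ≤ suc Q ^ (m * G) * Q ^ m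
        bern = begin
          Q ^ (m * G) * (Q + G) ^ m        ≡⟨ cong (λ z → Q ^ z * (Q + G) ^ m) (*-comm m G) ⟩
          Q ^ (G * m) * (Q + G) ^ m        ≡⟨ cong (_* (Q + G) ^ m) (sym (^-*-assoc Q G m)) ⟩
          (Q ^ G) ^ m * (Q + G) ^ m        ≡⟨ sym (^-distribʳ-* m (Q ^ G) (Q + G)) ⟩
          (Q ^ G * (Q + G)) ^ m            ≤⟨ ^-monoˡ-≤ m (bernoulli Q G) ⟩
          (suc Q ^ G * Q) ^ m              ≡⟨ ^-distribʳ-* m (suc Q ^ G) Q ⟩
          (suc Q ^ G) ^ m * Q ^ m          ≡⟨ cong (_* Q ^ m) (trans (^-*-assoc (suc Q) G m) (cong (suc Q ^_) (*-comm G m))) ⟩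
          suc Q ^ (m * G) * Q ^ m          ∎
        lem₁ : ∀ a b c d → a * b * (c * d) ≡ a * (c * b) * d
        lem₁ = solve-∀
        lem₂ : ∀ a b c d → a * (b * c) * d ≡ a * (b * d) * c
        lem₂ = solve-∀
        lem₃ : ∀ a b c → a * b * c ≡ c * a * b
        lem₃ = solve-∀

  -- `G` stands for the number of pairs whose realization destroys an edge: `x` for its own A-end
  -- and `y` for each of the `R ∸ 1` other vertices, less the share of the overlap term in the
  -- hypothesis on `G`.
  survivors : 1 ≤ R → ∀ θ m G → m * G + κ * (m * R * (m * R)) ≤ m * (x + (R ∸ 1) * y) →
              (bad : Asg Q N → Bool) →
              (∀ ω → bad ω ≡ true → θ ≤ ∑ pairs (λ p → wt p * 𝟙 (survives p ω))) →
              cnt bad * (θ ∸ m * (κ + R * κ)) ^ m * (Q + G) ^ m ≤ y ^ m * (Q ^ m * Q ^ N)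
  survivors 1≤R θ m G room bad h = ≤-trans
    (tail θ m ((Q + G) ^ m) (Q ^ m * Q ^ N) bad (λ ω e → h ω e , tame ω) (joint 1≤R m G room))
    (*-monoˡ-≤ (Q ^ m * Q ^ N) (^-monoˡ-≤ m (≤-trans (∑-mono pairs (λ p → ≤-trans (*-monoʳ-≤ (𝟙 (M' b p)) (𝟙≤1 (genuine (proj₁ p)))) (≤-reflexive (*-identityʳ _))))
      (≤-reflexive (row b)))))

-- One nibble

-- A bipartite hypergraph: I b a j says that the B-vertex b lies on the j-th edge at the A-vertex a. An A-vertex all
-- of whose incidences are false counts as already matched.
record System (nB nA x y κ R : ℕ) : Set where
  field
    I         : Fin nB → Fin nA → Fin x → Bool
    uniform   : ∀ a j b → I b a j ≡ true → ∑ (fins nB) (λ u → 𝟙 (I u a j)) ≡ R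
    degree    : ∀ b → ∑ (fins nA) (λ a → ∑ (fins x) (λ j → 𝟙 (I b a j))) ≤ y
    codegree  : ∀ u w → u ≢ w → ∑ (fins nA) (λ a → ∑ (fins x) (λ j → 𝟙 (I u a j) * 𝟙 (I w a j))) ≤ κ
    codegreeA : ∀ u a → ∑ (fins x) (λ j → 𝟙 (I u a j)) ≤ κ

∑-<-⊓ : ∀ n k → ∑ (fins n) (λ t → 𝟙 (toℕ t <ᵇ k)) ≡ n ⊓ k
∑-<-⊓ zero    k       = refl
∑-<-⊓ (suc n) zero    = ∑-zero∀ (fins (suc n)) (λ t → refl)
∑-<-⊓ (suc n) (suc k) = trans (∑-suc n (λ t → 𝟙 (toℕ t <ᵇ suc k))) (cong suc (∑-<-⊓ n k))

-- The `W` additional values mean staying inactive, so a coordinate is active with probability x /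
-- (x + W). The value `v₀` is an arbitrary active one, reserved for the dummies to cover with.
module Experiment {nB nA x y κ R : ℕ} (S : System nB nA x y κ R) (W : ℕ) (v₀ : Fin x)
  .{{_ : NonZero (x + W)}} (1≤R : 1 ≤ R) (1≤κ : 1 ≤ κ) where

  open System S

  Q N : ℕ
  Q = x + W
  N = nA + nB * y

  deg : Fin nB → ℕ
  deg b = ∑ (fins nA) (λ a → ∑ (fins x) (λ j → 𝟙 (I b a j)))

  padding : Fin nB → Fin nB × Fin y → Fin x → Bool
  padding b (b' , t) j = (b' == b) ∧ ((toℕ t <ᵇ (y ∸ deg b)) ∧ (j == v₀))

  -- The coordinates inj₂ (b , t) with t < y ∸ deg b are dummies: each covers b alone, with one value, which
  -- brings the number of (coordinate, value) pairs covering b up to exactly y.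
  cover : Fin nB → Fin nA ⊎ Fin (nB * y) → Fin x ⊎ Fin W → Bool
  cover b (inj₁ a) (inj₁ j) = I b a j
  cover b (inj₂ d) (inj₁ j) = padding b (remQuot y d) j
  cover b _        (inj₂ _) = false

  M : Fin nB → Fin N → Fin Q → Bool
  M b c v = cover b (splitAt nA c) (splitAt x v)

  left : {A B : Set} → A ⊎ B → Bool
  left (inj₁ _) = true
  left (inj₂ _) = false

  active : Fin Q → Bool
  active v = left (splitAt x v)

  genuine : Fin N → Bool
  genuine c = left (splitAt nA c)

  ∑-values : (f : Fin x ⊎ Fin W → ℕ) →
             ∑ (fins Q) (λ v → f (splitAt x v)) ≡ ∑ (fins x) (λ j → f (inj₁ j)) + ∑ (fins W) (λ w → f (inj₂ w))
  ∑-values f = trans (∑-split+ x W _)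
    (cong₂ _+_ (∑-cong (fins x) (λ j → cong f (F.splitAt-↑ˡ x j W))) (∑-cong (fins W) (λ w → cong f (F.splitAt-↑ʳ x W w))))

  M-real : ∀ b a j → M b (a ↑ˡ (nB * y)) (j ↑ˡ W) ≡ I b a j
  M-real b a j rewrite F.splitAt-↑ˡ nA a (nB * y) | F.splitAt-↑ˡ x j W = refl

  open Cover N Q nB x y κ R (x * R) M active genuine public

  private
    row-of : ∀ s u (φ : Fin x ⊎ Fin W → ℕ) →
             ∑ (fins Q) (λ v → 𝟙 (cover u s (splitAt x v)) * φ (splitAt x v)) ≡ ∑ (fins x) (λ j → 𝟙 (cover u s (inj₁ j)) * φ (inj₁ j))
    row-of s u φ = trans (∑-values (λ t → 𝟙 (cover u s t) * φ t))
      (trans (cong (∑ (fins x) (λ j → 𝟙 (cover u s (inj₁ j)) * φ (inj₁ j)) +_) (∑-zero∀ (fins W) (λ w → cong (λ z → 𝟙 z * φ (inj₂ w)) (inactive s w)))) (+-identityʳ _))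
      where
      inactive : ∀ s w → cover u s (inj₂ w) ≡ false
      inactive (inj₁ _) w = refl
      inactive (inj₂ _) w = refl

    cover-combine : ∀ u b t j → cover u (inj₂ (combine b t)) (inj₁ j) ≡ padding u (b , t) j
    cover-combine u b t j = cong (λ p → padding u p j) (F.remQuot-combine {nB} {y} b t)

    dummy-row : ∀ u b t (φ : Fin x ⊎ Fin W → ℕ) →
                ∑ (fins x) (λ j → 𝟙 (cover u (inj₂ (combine b t)) (inj₁ j)) * φ (inj₁ j))
                ≡ 𝟙 (b == u) * (𝟙 (toℕ t <ᵇ (y ∸ deg u)) * φ (inj₁ v₀))
    dummy-row u b t φ = begin
      ∑ (fins x) (λ j → 𝟙 (cover u (inj₂ (combine b t)) (inj₁ j)) * φ (inj₁ j))
        ≡⟨ ∑-cong (fins x) (λ j → cong (λ z → 𝟙 z * φ (inj₁ j)) (cover-combine u b t j)) ⟩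
      ∑ (fins x) (λ j → 𝟙 (padding u (b , t) j) * φ (inj₁ j))
        ≡⟨ ∑-cong (fins x) (λ j → trans (cong (_* φ (inj₁ j)) (trans (𝟙-∧ (b == u) _) (cong (𝟙 (b == u) *_) (𝟙-∧ (toℕ t <ᵇ (y ∸ deg u)) (j == v₀)))))
             (lem (𝟙 (b == u)) (𝟙 (toℕ t <ᵇ (y ∸ deg u))) (𝟙 (j == v₀)) (φ (inj₁ j)))) ⟩
      ∑ (fins x) (λ j → 𝟙 (b == u) * 𝟙 (toℕ t <ᵇ (y ∸ deg u)) * (𝟙 (j == v₀) * φ (inj₁ j)))
        ≡⟨ trans (∑-*ˡ (fins x) (𝟙 (b == u) * 𝟙 (toℕ t <ᵇ (y ∸ deg u))) _) (cong (𝟙 (b == u) * 𝟙 (toℕ t <ᵇ (y ∸ deg u)) *_) (∑-δ v₀ (λ j → φ (inj₁ j)))) ⟩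
      𝟙 (b == u) * 𝟙 (toℕ t <ᵇ (y ∸ deg u)) * φ (inj₁ v₀)
        ≡⟨ *-assoc (𝟙 (b == u)) _ _ ⟩
      𝟙 (b == u) * (𝟙 (toℕ t <ᵇ (y ∸ deg u)) * φ (inj₁ v₀)) ∎
      where
      open ≡-Reasoning
      lem : ∀ a b c d → a * (b * c) * d ≡ a * b * (c * d)
      lem = solve-∀

    -- Only the dummies of `u` itself contribute besides the genuine coordinates. The test function
    -- `φ` serves two purposes: constant 1 yields the row sums, the incidence with another vertex
    -- yields the codegrees.
    expand : ∀ u (φ : Fin nA ⊎ Fin (nB * y) → Fin x ⊎ Fin W → ℕ) →
             ∑ pairs (λ { (c , v) → 𝟙 (M u c v) * φ (splitAt nA c) (splitAt x v) })
             ≡ ∑ (fins nA) (λ a → ∑ (fins x) (λ j → 𝟙 (I u a j) * φ (inj₁ a) (inj₁ j)))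
               + ∑ (fins y) (λ t → 𝟙 (toℕ t <ᵇ (y ∸ deg u)) * φ (inj₂ (combine u t)) (inj₁ v₀))
    expand u φ = begin
      ∑ pairs (λ { (c , v) → 𝟙 (M u c v) * φ (splitAt nA c) (splitAt x v) })
        ≡⟨ trans (∑-pairs _) (∑-cong (fins N) (λ c → row-of (splitAt nA c) u (φ (splitAt nA c)))) ⟩
      ∑ (fins N) (λ c → g (splitAt nA c))
        ≡⟨ ∑-split+ nA (nB * y) (λ c → g (splitAt nA c)) ⟩
      ∑ (fins nA) (λ a → g (splitAt nA (a ↑ˡ (nB * y)))) + ∑ (fins (nB * y)) (λ d → g (splitAt nA (nA ↑ʳ d)))
        ≡⟨ cong₂ _+_ (∑-cong (fins nA) (λ a → cong g (F.splitAt-↑ˡ nA a (nB * y)))) (∑-cong (fins (nB * y)) (λ d → cong g (F.splitAt-↑ʳ nA (nB * y) d))) ⟩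
      ∑ (fins nA) (λ a → g (inj₁ a)) + ∑ (fins (nB * y)) (λ d → g (inj₂ d))
        ≡⟨ cong (∑ (fins nA) (λ a → g (inj₁ a)) +_) dummies ⟩
      ∑ (fins nA) (λ a → g (inj₁ a)) + ∑ (fins y) (λ t → 𝟙 (toℕ t <ᵇ (y ∸ deg u)) * φ (inj₂ (combine u t)) (inj₁ v₀)) ∎
      where
      open ≡-Reasoning
      g : Fin nA ⊎ Fin (nB * y) → ℕ
      g s = ∑ (fins x) (λ j → 𝟙 (cover u s (inj₁ j)) * φ s (inj₁ j))
      dummies : ∑ (fins (nB * y)) (λ d → g (inj₂ d)) ≡ ∑ (fins y) (λ t → 𝟙 (toℕ t <ᵇ (y ∸ deg u)) * φ (inj₂ (combine u t)) (inj₁ v₀))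
      dummies = begin
        ∑ (fins (nB * y)) (λ d → g (inj₂ d))
          ≡⟨ ∑-split* nB y (λ d → g (inj₂ d)) ⟩
        ∑ (fins nB) (λ b → ∑ (fins y) (λ t → g (inj₂ (combine b t))))
          ≡⟨ ∑-cong (fins nB) (λ b → trans (∑-cong (fins y) (λ t → dummy-row u b t (φ (inj₂ (combine b t))))) (∑-*ˡ (fins y) (𝟙 (b == u)) _)) ⟩
        ∑ (fins nB) (λ b → 𝟙 (b == u) * ∑ (fins y) (λ t → 𝟙 (toℕ t <ᵇ (y ∸ deg u)) * φ (inj₂ (combine b t)) (inj₁ v₀)))
          ≡⟨ ∑-δ u (λ b → ∑ (fins y) (λ t → 𝟙 (toℕ t <ᵇ (y ∸ deg u)) * φ (inj₂ (combine b t)) (inj₁ v₀))) ⟩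
        ∑ (fins y) (λ t → 𝟙 (toℕ t <ᵇ (y ∸ deg u)) * φ (inj₂ (combine u t)) (inj₁ v₀)) ∎

    column-of : ∀ s t → ∑ (fins nB) (λ u → 𝟙 (cover u s t)) ≤ R
    column-of (inj₁ a) (inj₁ j) with ∑ (fins nB) (λ u → 𝟙 (I u a j)) in e
    ... | zero  = z≤n
    ... | suc k with ∑-pos (fins nB) (λ u → 𝟙 (I u a j)) (subst (0 <_) (sym e) z<s)
    ...   | b , _ , p = ≤-reflexive (trans (sym e) (uniform a j b (𝟙-pos _ p)))
    column-of (inj₂ d) (inj₁ j) = ≤-trans (∑-mono (fins nB) (λ u → ≤-trans (𝟙-mono _ _ (λ h → proj₁ (∧-true h))) (≤-reflexive (cong 𝟙 (==-sym _ u)))))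
      (≤-trans (≤-reflexive (∑-δ1 (proj₁ (remQuot {nB} y d)))) 1≤R)
    column-of (inj₁ _) (inj₂ _) = ≤-trans (≤-reflexive (∑-zero (fins nB))) z≤n
    column-of (inj₂ _) (inj₂ _) = ≤-trans (≤-reflexive (∑-zero (fins nB))) z≤n

    adj-of : ∀ c u → adj c u ≡ ∑ (fins x) (λ j → 𝟙 (cover u (splitAt nA c) (inj₁ j)))
    adj-of c u = trans (∑-cong (fins Q) (λ v → sym (*-identityʳ (𝟙 (M u c v))))) (trans (row-of (splitAt nA c) u (λ _ → 1)) (∑-cong (fins x) (λ j → *-identityʳ _)))

    adj≤ : ∀ s u → ∑ (fins x) (λ j → 𝟙 (cover u s (inj₁ j))) ≤ κ
    adj≤ (inj₁ a) u = codegreeA u a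
    adj≤ (inj₂ d) u = ≤-trans (∑-mono (fins x) (λ j → 𝟙-mono _ _ (λ h → proj₂ (∧-true {toℕ (proj₂ (remQuot {nB} y d)) <ᵇ (y ∸ deg u)} (proj₂ (∧-true {proj₁ (remQuot {nB} y d) == u} h))))))
      (≤-trans (≤-reflexive (∑-δ1 v₀)) 1≤κ)

    cover-dummy : ∀ u w t j → u ≢ w → cover w (inj₂ (combine u t)) (inj₁ j) ≡ false
    cover-dummy u w t j ne = trans (cover-combine w u t j) (cong (_∧ ((toℕ t <ᵇ (y ∸ deg w)) ∧ (j == v₀))) (==-≢ ne))

    uniform-of : ∀ s t b → left s ≡ true → cover b s t ≡ true → ∑ (fins nB) (λ u → 𝟙 (cover u s t)) ≡ R
    uniform-of (inj₁ a) (inj₁ j) b _ h = uniform a j b h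

  axioms : Axioms
  axioms = record
    { row      = λ u → begin
        ∑ pairs (λ p → 𝟙 (M' u p))        ≡⟨ ∑-cong pairs (λ p → sym (*-identityʳ (𝟙 (M' u p)))) ⟩
        ∑ pairs (λ p → 𝟙 (M' u p) * 1)    ≡⟨ expand u (λ _ _ → 1) ⟩
        _                                 ≡⟨ cong₂ _+_ (∑-cong (fins nA) (λ a → ∑-cong (fins x) (λ j → *-identityʳ _))) (∑-cong (fins y) (λ t → *-identityʳ _)) ⟩
        deg u + ∑ (fins y) (λ t → 𝟙 (toℕ t <ᵇ (y ∸ deg u))) ≡⟨ cong (deg u +_) (trans (∑-<-⊓ y (y ∸ deg u)) (m≥n⇒m⊓n≡n (m∸n≤m y (deg u)))) ⟩
        deg u + (y ∸ deg u)               ≡⟨ m+[n∸m]≡n (degree u) ⟩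
        y                                 ∎
    ; codegree = λ u w ne → ≤-trans (≤-reflexive (begin
        ∑ pairs (λ p → 𝟙 (M' u p) * 𝟙 (M' w p))
          ≡⟨ expand u (λ s t → 𝟙 (cover w s t)) ⟩
        _ ≡⟨ cong (∑ (fins nA) (λ a → ∑ (fins x) (λ j → 𝟙 (I u a j) * 𝟙 (I w a j))) +_)
               (∑-zero∀ (fins y) (λ t → trans (cong (λ z → 𝟙 (toℕ t <ᵇ (y ∸ deg u)) * 𝟙 z) (cover-dummy u w t v₀ ne)) (*-zeroʳ (𝟙 (toℕ t <ᵇ (y ∸ deg u)))))) ⟩
        ∑ (fins nA) (λ a → ∑ (fins x) (λ j → 𝟙 (I u a j) * 𝟙 (I w a j))) + 0 ≡⟨ +-identityʳ _ ⟩
        ∑ (fins nA) (λ a → ∑ (fins x) (λ j → 𝟙 (I u a j) * 𝟙 (I w a j))) ∎)) (codegree u w ne)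
    ; adj≤κ    = λ c u → ≤-trans (≤-reflexive (adj-of c u)) (adj≤ (splitAt nA c) u)
    ; column   = λ { (c , v) → column-of (splitAt nA c) (splitAt x v) }
    ; adj-sum  = λ c → ≤-trans (≤-reflexive (trans (∑-cong (fins nB) (adj-of c)) (∑-swap (fins nB) (fins x) _)))
        (∑-≤ x (λ j → column-of (splitAt nA c) (inj₁ j)))
    ; active-x = trans (∑-values (λ t → 𝟙 (left t))) (trans (cong₂ _+_ (trans (∑-const-fins x 1) (*-identityʳ x)) (∑-zero (fins W))) (+-identityʳ x))
    ; uniform  = λ { (c , v) b → uniform-of (splitAt nA c) (splitAt x v) b }
    }
    where open ≡-Reasoning

-- Making all vertices good at once

clear-local : ∀ {Q N} (forb : Fin N → Fin Q → Bool) x x' →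
              (∀ c v → forb c v ≡ true → lookup x c ≡ lookup x' c) → clear forb x ≡ clear forb x'
clear-local forb []      []        h = refl
clear-local forb (v ∷ x) (v' ∷ x') h = cong₂ (λ a b → not a ∧ b) head (clear-local (forb ∘ suc) x x' (h ∘ suc))
  where
  head : forb zero v ≡ forb zero v'
  head with forb zero v in e | forb zero v' in e'
  ... | true  | true  = refl
  ... | false | false = refl
  ... | true  | false = trans (sym e) (trans (cong (forb zero) (h zero v e)) e')
  ... | false | true  = trans (sym e) (trans (cong (forb zero) (h zero v' e')) e')

rare-enough : ∀ c U V Z B → 0 < V → c * V ≤ U * B → U * Z ≤ V → c * Z ≤ B
rare-enough c U V Z B 0<V h₁ h₂ = *-cancelʳ-≤ _ _ V {{>-nonZero 0<V}} (begin
  c * Z * V     ≡⟨ lem c Z V ⟩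
  c * V * Z     ≤⟨ *-monoˡ-≤ Z h₁ ⟩
  U * B * Z     ≡⟨ lem U B Z ⟩
  U * Z * B     ≤⟨ *-monoˡ-≤ B h₂ ⟩
  V * B         ≡⟨ *-comm V B ⟩
  B * V         ∎)
  where
  open ≤-Reasoning
  lem : ∀ a b c → a * b * c ≡ a * c * b
  lem = solve-∀

-- θᵃ, θ¹ and θ² bound the edges lost at an A-vertex, the surviving edges at a B-vertex whose A-end stayed
-- inactive, and those whose A-end was active but unsuccessful; K bounds the picks covering one B-vertex.
record Thresholds (x y κ R Q : ℕ) : Set where
  field
    Z θᵃ θ¹ θ² K G mᵃ mᴷ m¹ m² : ℕ
    enough : 12 * (2 * (x * R) ^ 3 * (3 * (x * R) ^ 3)) ≤ Z
    posᵃ  : 0 < θᵃ ∸ mᵃ * (R * κ)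
    rareᵃ : (x * R * y) ^ mᵃ * Z ≤ (θᵃ ∸ mᵃ * (R * κ)) ^ mᵃ * Q ^ mᵃ
    posᴷ  : 0 < suc K ∸ mᴷ * 1
    rareᴷ : y ^ mᴷ * Z ≤ (suc K ∸ mᴷ * 1) ^ mᴷ * Q ^ mᴷ
    pos²  : 0 < θ² ∸ m² * (4 * (κ * (R * K)))
    rare² : (y * (x * R * y)) ^ m² * Z ≤ (θ² ∸ m² * (4 * (κ * (R * K)))) ^ m² * Q ^ (2 * m²)
    pos¹  : 0 < θ¹ ∸ m¹ * (κ + R * κ)
    room  : m¹ * G + κ * (m¹ * R * (m¹ * R)) ≤ m¹ * (x + (R ∸ 1) * y)
    rare¹ : y ^ m¹ * Q ^ m¹ * Z ≤ (θ¹ ∸ m¹ * (κ + R * κ)) ^ m¹ * (Q + G) ^ m¹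

module Concentration {nB nA x y κ R : ℕ} (S : System nB nA x y κ R) (W : ℕ) (v₀ : Fin x)
  .{{_ : NonZero (x + W)}} (1≤R : 1 ≤ R) (1≤κ : 1 ≤ κ) (y≤x : y ≤ x) where

  open System S using (I)
  open Experiment S W v₀ 1≤R 1≤κ
  open Axioms axioms
  open Bounds axioms

  surviving : Fin nB → Asg Q N → ℕ
  surviving b ω = ∑ pairs (λ p → wt p * 𝟙 (survives p ω))
    where open Survival N Q nB x y κ R (x * R) M active genuine axioms b

  coord : Fin nA → Fin N
  coord a = a ↑ˡ (nB * y)

  -- An edge is counted once for every hit on one of its vertices. This bounds the number of lost
  -- edges and is linear in the hits, as `singles` requires.
  loss : Fin nA → Asg Q N → ℕ
  loss a ω = ∑ (fins x) (λ j → ∑ (fins nB) (λ u → 𝟙 (I u a j) * hits u ω))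

  conflicting : ℕ → Fin nB → Asg Q N → ℕ
  conflicting K b ω = ∑ trips (λ h → conflictWt b h * 𝟙 (conflict K h ω))

  A : ℕ
  A = x * R

  1≤x : 1 ≤ x
  1≤x = ≤-trans (s≤s z≤n) (F.toℕ<n v₀)

  1≤A : 1 ≤ A
  1≤A = *-mono-≤ 1≤x 1≤R

  y≤A : y ≤ A
  y≤A = ≤-trans y≤x (≤-trans (≤-reflexive (sym (*-identityʳ x))) (*-monoʳ-≤ x 1≤R))

  adj²  : Fin N → Fin N → ℕ
  adj² c c' = ∑ (fins nB) (λ u → adj c u * adj c' u)

  -- Walk counts in the incidence graph of coordinates and B-vertices. The event at an A-vertex
  -- reads coordinates two steps away, that at a B-vertex coordinates one or three steps away. Since
  -- each step multiplies by at most `A` or `y`, and y ≤ A, the row and load bounds are small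
  -- multiples of A ^ 3.
  reach : Fin nA ⊎ Fin nB → Fin N → ℕ
  reach (inj₁ a) c = adj² (coord a) c
  reach (inj₂ b) c = adj c b + ∑ (fins N) (λ c' → adj c' b * adj² c' c)

  private
    adj-column : ∀ u → ∑ (fins N) (λ c → adj c u) ≡ y
    adj-column u = trans (sym (∑-pairs _)) (row u)

    adj²-row : ∀ c' → ∑ (fins N) (adj² c') ≤ A * y
    adj²-row c' = begin
      ∑ (fins N) (λ c → ∑ (fins nB) (λ u → adj c' u * adj c u))   ≡⟨ ∑-swap (fins N) (fins nB) _ ⟩
      ∑ (fins nB) (λ u → ∑ (fins N) (λ c → adj c' u * adj c u))   ≡⟨ ∑-cong (fins nB) (λ u → trans (∑-*ˡ (fins N) (adj c' u) _) (cong (adj c' u *_) (adj-column u))) ⟩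
      ∑ (fins nB) (λ u → adj c' u * y)                            ≡⟨ ∑-*ʳ (fins nB) y _ ⟩
      ∑ (fins nB) (adj c') * y                                    ≤⟨ *-monoˡ-≤ y (adj-sum c') ⟩
      A * y                                                       ∎ where open ≤-Reasoning

    adj²-column : ∀ c → ∑ (fins N) (λ c' → adj² c' c) ≤ A * y
    adj²-column c = ≤-trans (≤-reflexive (∑-cong (fins N) (λ c' → ∑-cong (fins nB) (λ u → *-comm (adj c' u) _)))) (adj²-row c)

    s t : ℕ
    s = 2 * A ^ 3
    t = 3 * A ^ 3

    A*y≤A³ : A * y ≤ A ^ 3
    A*y≤A³ = begin
      A * y         ≤⟨ *-monoʳ-≤ A y≤A ⟩
      A * A         ≡⟨ sym (*-identityʳ (A * A)) ⟩
      A * A * 1     ≤⟨ *-monoʳ-≤ (A * A) 1≤A ⟩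
      A * A * A     ≡⟨ lem A ⟩
      A ^ 3         ∎
      where
      open ≤-Reasoning
      lem : ∀ A → A * A * A ≡ A * (A * (A * 1))
      lem = solve-∀

    A≤A³ : A ≤ A ^ 3
    A≤A³ = ≤-trans (≤-reflexive (sym (*-identityʳ A))) (^-monoʳ-≤ A {{>-nonZero 1≤A}} {1} {3} (s≤s z≤n))

    A*[A*y]≤A³ : A * (A * y) ≤ A ^ 3
    A*[A*y]≤A³ = *-monoʳ-≤ A (≤-trans (*-monoʳ-≤ A y≤A) (≤-reflexive (cong (A *_) (sym (*-identityʳ A)))))

    twice : ∀ k → k + k ≡ 2 * k
    twice = solve-∀

    reach-row : ∀ e → ∑ (fins N) (reach e) ≤ s
    reach-row (inj₁ a) = ≤-trans (adj²-row (coord a)) (≤-trans A*y≤A³ (m≤m+n _ _))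
    reach-row (inj₂ b) = begin
      ∑ (fins N) (λ c → adj c b + ∑ (fins N) (λ c' → adj c' b * adj² c' c))
        ≡⟨ ∑-+ (fins N) _ _ ⟩
      ∑ (fins N) (λ c → adj c b) + ∑ (fins N) (λ c → ∑ (fins N) (λ c' → adj c' b * adj² c' c))
        ≡⟨ cong₂ _+_ (adj-column b) (trans (∑-swap (fins N) (fins N) _) (∑-cong (fins N) (λ c' → ∑-*ˡ (fins N) (adj c' b) _))) ⟩
      y + ∑ (fins N) (λ c' → adj c' b * ∑ (fins N) (adj² c'))
        ≤⟨ +-monoʳ-≤ y (∑-mono (fins N) (λ c' → *-monoʳ-≤ (adj c' b) (adj²-row c'))) ⟩
      y + ∑ (fins N) (λ c' → adj c' b * (A * y))
        ≡⟨ cong (y +_) (trans (∑-*ʳ (fins N) (A * y) _) (cong (_* (A * y)) (adj-column b))) ⟩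
      y + y * (A * y)
        ≤⟨ +-mono-≤ (≤-trans y≤A A≤A³) (≤-trans (*-monoˡ-≤ (A * y) y≤A) A*[A*y]≤A³) ⟩
      A ^ 3 + A ^ 3
        ≡⟨ twice (A ^ 3) ⟩
      s ∎ where open ≤-Reasoning

    everything : List (Fin nA ⊎ Fin nB)
    everything = map inj₁ (fins nA) ++ map inj₂ (fins nB)

    load : ∀ c → ∑ everything (λ e → reach e c) ≤ t
    load c = begin
      ∑ everything (λ e → reach e c)
        ≡⟨ trans (∑-++ (map inj₁ (fins nA)) _ _) (cong₂ _+_ (∑-map inj₁ (fins nA) _) (∑-map inj₂ (fins nB) _)) ⟩
      ∑ (fins nA) (λ a → adj² (coord a) c) + ∑ (fins nB) (λ b → adj c b + ∑ (fins N) (λ c' → adj c' b * adj² c' c))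
        ≤⟨ +-mono-≤ (≤-trans (m≤m+n _ _) (≤-trans (≤-reflexive (sym (∑-split+ nA (nB * y) (λ c' → adj² c' c)))) (adj²-column c)))
             (≤-reflexive (trans (∑-+ (fins nB) _ _) (cong (∑ (fins nB) (adj c) +_) (trans (∑-swap (fins nB) (fins N) _)
               (∑-cong (fins N) (λ c' → ∑-*ʳ (fins nB) (adj² c' c) (adj c'))))))) ⟩
      A * y + (∑ (fins nB) (adj c) + ∑ (fins N) (λ c' → ∑ (fins nB) (adj c') * adj² c' c))
        ≤⟨ +-monoʳ-≤ (A * y) (+-mono-≤ (adj-sum c) (≤-trans (∑-mono (fins N) (λ c' → *-monoˡ-≤ (adj² c' c) (adj-sum c')))
             (≤-trans (≤-reflexive (∑-*ˡ (fins N) A _)) (*-monoʳ-≤ A (adj²-column c))))) ⟩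
      A * y + (A + A * (A * y))
        ≤⟨ +-mono-≤ A*y≤A³ (+-mono-≤ A≤A³ A*[A*y]≤A³) ⟩
      A ^ 3 + (A ^ 3 + A ^ 3)
        ≡⟨ thrice (A ^ 3) ⟩
      t ∎
      where
      open ≤-Reasoning
      thrice : ∀ k → k + (k + k) ≡ 3 * k
      thrice = solve-∀

  adj-pos : ∀ {u c v} → M u c v ≡ true → 0 < adj c u
  adj-pos {u} {c} {v} h = ≤-trans (≤-reflexive (cong 𝟙 (sym h))) (∑-fin (λ v → 𝟙 (M u c v)) v)

  I-M : ∀ {u a j} → I u a j ≡ true → M u (coord a) (j ↑ˡ W) ≡ true
  I-M h = trans (M-real _ _ _) h

  private
    hits-local : ∀ u → Local (λ c → 0 < adj c u) (hits u)
    hits-local u ω ω' h = ∑-cong pairs each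
      where
      each : ∀ p → 𝟙 (M' u p) * 𝟙 (hit p ω) ≡ 𝟙 (M' u p) * 𝟙 (hit p ω')
      each (c , v) with M u c v in e
      ... | true  = cong (λ z → 1 * 𝟙 (z == v)) (h c (adj-pos e))
      ... | false = refl

    adj²-pos : ∀ c c' u → 0 < adj c u → 0 < adj c' u → 0 < adj² c c'
    adj²-pos c c' u h h' = ≤-trans (*-mono-≤ h h') (∑-fin (λ u → adj c u * adj c' u) u)

    reach-pos₂ : ∀ b c c' u → 0 < adj c b → 0 < adj c u → 0 < adj c' u → 0 < reach (inj₂ b) c'
    reach-pos₂ b c c' u h h' h'' = ≤-trans (≤-trans (*-mono-≤ h (adj²-pos c c' u h' h''))
      (∑-fin (λ c → adj c b * adj² c c') c)) (m≤n+m _ (adj c' b))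

    reach-pos₁ : ∀ b c → 0 < adj c b → 0 < reach (inj₂ b) c
    reach-pos₁ b c h = ≤-trans h (m≤m+n _ _)

    loss-local : ∀ a → Local (λ c → 0 < reach (inj₁ a) c) (loss a)
    loss-local a ω ω' h = ∑-cong (fins x) (λ j → ∑-cong (fins nB) (each j))
      where
      each : ∀ j u → 𝟙 (I u a j) * hits u ω ≡ 𝟙 (I u a j) * hits u ω'
      each j u with I u a j in e
      ... | false = refl
      ... | true  = cong (1 *_) (hits-local u ω ω' (λ c p → h c (adj²-pos (coord a) c u (adj-pos (I-M e)) p)))

    conflicting-local : ∀ K b → Local (λ c → 0 < reach (inj₂ b) c) (conflicting K b)
    conflicting-local K b ω ω' h = ∑-cong trips each
      where
      each : ∀ h → conflictWt b h * 𝟙 (conflict K h ω) ≡ conflictWt b h * 𝟙 (conflict K h ω')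
      each ((c , v) , u , (c' , v')) with adj c b in e | M u c v in e₁ | M u c' v' in e₂
      ... | zero  | _     | _     = refl
      ... | suc k | false | _     = trans (cong (_* 𝟙 (conflict K ((c , v) , u , (c' , v')) ω)) (*-zeroʳ k)) (cong (_* 𝟙 (conflict K ((c , v) , u , (c' , v')) ω')) (sym (*-zeroʳ k)))
      ... | suc k | true  | false = trans (cong (_* 𝟙 (conflict K ((c , v) , u , (c' , v')) ω)) (*-zeroʳ k)) (cong (_* 𝟙 (conflict K ((c , v) , u , (c' , v')) ω')) (sym (*-zeroʳ k)))
      ... | suc k | true  | true  = cong (λ z → suc k * 1 * 𝟙 z)
            (cong₂ _∧_ (cong (_== v) (h c (reach-pos₁ b c c~b)))
            (cong₂ _∧_ (cong (_== v') (h c' (reach-pos₂ b c c' u c~b (adj-pos e₁) (adj-pos e₂))))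
            (cong (λ z → not ((c , v) ≐ (c' , v')) ∧ (z ≤ᵇ K)) (hits-local u ω ω' (λ c'' p → h c'' (reach-pos₂ b c c'' u c~b (adj-pos e₁) p))))))
        where
        c~b : 0 < adj c b
        c~b = subst (0 <_) (sym e) z<s

    surviving-local : ∀ b → Local (λ c → 0 < reach (inj₂ b) c) (surviving b)
    surviving-local b ω ω' h = ∑-cong pairs each
      where
      open Survival N Q nB x y κ R (x * R) M active genuine axioms b
      each : ∀ p → wt p * 𝟙 (survives p ω) ≡ wt p * 𝟙 (survives p ω')
      each p@(c , v) with M b c v in e
      ... | false = refl
      ... | true  = cong (λ z → 1 * 𝟙 (genuine c) * 𝟙 z) (clear-local _ ω ω' same)
        where
        same : ∀ c' v' → forbidden p (c' , v') ≡ true → lookup ω c' ≡ lookup ω' c'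
        same c' v' f with lookup ω c' F.≟ lookup ω' c'
        ... | yes eq = eq
        ... | no ne  = case trans (sym f) (any-false (λ l → block l (c' , v')) (labels p) none) of λ ()
          where
          none : ∀ {l} → l ∈ˡ labels p → block l (c' , v') ≡ false
          none {inj₁ d} i with ∈-labels₁ p i
          ... | refl with c' F.≟ d
          ...   | no _     = refl
          ...   | yes refl = ⊥-elim (ne (h c' (reach-pos₁ b c' (adj-pos e))))
          none {inj₂ u} i with M u c' v' in e'
          ... | false = refl
          ... | true  = ⊥-elim (ne (h c' (reach-pos₂ b c c' u (adj-pos e) (adj-pos (proj₂ (∧-true {not (u == b)} (∈-labels p i)))) (adj-pos e'))))

    loss-wt : Fin nA → P → ℕ
    loss-wt a p = ∑ (fins x) (λ j → ∑ (fins nB) (λ u → 𝟙 (I u a j) * 𝟙 (M' u p)))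

    loss-as-hits : ∀ a ω → loss a ω ≡ ∑ pairs (λ p → loss-wt a p * 𝟙 (hit p ω))
    loss-as-hits a ω = begin
      ∑ (fins x) (λ j → ∑ (fins nB) (λ u → 𝟙 (I u a j) * ∑ pairs (λ p → 𝟙 (M' u p) * 𝟙 (hit p ω))))
        ≡⟨ ∑-cong (fins x) (λ j → trans (∑-cong (fins nB) (λ u → sym (∑-*ˡ pairs (𝟙 (I u a j)) _))) (∑-swap (fins nB) pairs _)) ⟩
      ∑ (fins x) (λ j → ∑ pairs (λ p → ∑ (fins nB) (λ u → 𝟙 (I u a j) * (𝟙 (M' u p) * 𝟙 (hit p ω)))))
        ≡⟨ ∑-swap (fins x) pairs _ ⟩
      ∑ pairs (λ p → ∑ (fins x) (λ j → ∑ (fins nB) (λ u → 𝟙 (I u a j) * (𝟙 (M' u p) * 𝟙 (hit p ω)))))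
        ≡⟨ ∑-cong pairs (λ p → trans (∑-cong (fins x) (λ j → trans (∑-cong (fins nB) (λ u → sym (*-assoc (𝟙 (I u a j)) _ _))) (∑-*ʳ (fins nB) (𝟙 (hit p ω)) _))) (∑-*ʳ (fins x) (𝟙 (hit p ω)) _)) ⟩
      ∑ pairs (λ p → loss-wt a p * 𝟙 (hit p ω)) ∎ where open ≡-Reasoning

    loss-wt≤ : ∀ a p → loss-wt a p ≤ R * κ
    loss-wt≤ a p = begin
      ∑ (fins x) (λ j → ∑ (fins nB) (λ u → 𝟙 (I u a j) * 𝟙 (M' u p)))
        ≡⟨ trans (∑-swap (fins x) (fins nB) _) (∑-cong (fins nB) (λ u → trans (∑-*ʳ (fins x) (𝟙 (M' u p)) _) (*-comm _ (𝟙 (M' u p))))) ⟩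
      ∑ (fins nB) (λ u → 𝟙 (M' u p) * ∑ (fins x) (λ j → 𝟙 (I u a j)))
        ≤⟨ ∑-mono (fins nB) (λ u → *-monoʳ-≤ (𝟙 (M' u p)) (System.codegreeA S u a)) ⟩
      ∑ (fins nB) (λ u → 𝟙 (M' u p) * κ)
        ≡⟨ ∑-*ʳ (fins nB) κ _ ⟩
      ∑ (fins nB) (λ u → 𝟙 (M' u p)) * κ
        ≤⟨ *-monoˡ-≤ κ (column p) ⟩
      R * κ ∎ where open ≤-Reasoning

    loss-total : ∀ a → ∑ pairs (loss-wt a) ≤ x * R * y
    loss-total a = begin
      ∑ pairs (λ p → ∑ (fins x) (λ j → ∑ (fins nB) (λ u → 𝟙 (I u a j) * 𝟙 (M' u p))))
        ≡⟨ trans (∑-swap pairs (fins x) _) (∑-cong (fins x) (λ j → trans (∑-swap pairs (fins nB) _)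
             (trans (∑-cong (fins nB) (λ u → trans (∑-*ˡ pairs (𝟙 (I u a j)) _) (cong (𝟙 (I u a j) *_) (row u)))) (∑-*ʳ (fins nB) y _)))) ⟩
      ∑ (fins x) (λ j → ∑ (fins nB) (λ u → 𝟙 (I u a j)) * y)
        ≤⟨ ∑-≤ x (λ j → *-monoˡ-≤ y (≤-trans (≤-reflexive (∑-cong (fins nB) (λ u → cong 𝟙 (sym (M-real u a j))))) (column (coord a , j ↑ˡ W)))) ⟩
      x * (R * y)
        ≡⟨ sym (*-assoc x R y) ⟩
      x * R * y ∎ where open ≤-Reasoning

  record Good (τ : Thresholds x y κ R Q) (ω : Asg Q N) : Set where
    open Thresholds τ
    field
      lossOK : ∀ a → loss a ω < θᵃ
      hitsOK : ∀ b → hits b ω ≤ K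
      confOK : ∀ b → conflicting K b ω < θ²
      survOK : ∀ b → surviving b ω < θ¹

  module _ (τ : Thresholds x y κ R Q) where
    open Thresholds τ

    private
      badᴷ bad² bad¹ : Fin nB → Asg Q N → Bool
      badᴷ b ω = suc K ≤ᵇ hits b ω
      bad² b ω = θ² ≤ᵇ conflicting K b ω
      bad¹ b ω = θ¹ ≤ᵇ surviving b ω

      bad : Fin nA ⊎ Fin nB → Asg Q N → Bool
      bad (inj₁ a) ω = θᵃ ≤ᵇ loss a ω
      bad (inj₂ b) ω = badᴷ b ω ∨ (bad² b ω ∨ bad¹ b ω)

      bad-local : ∀ e → Local (λ c → 0 < reach e c) (bad e)
      bad-local (inj₁ a) ω ω' h = cong (θᵃ ≤ᵇ_) (loss-local a ω ω' h)
      bad-local (inj₂ b) ω ω' h = cong₂ _∨_ (cong (suc K ≤ᵇ_) (hits-local b ω ω' (λ c p → h c (reach-pos₁ b c p))))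
        (cong₂ _∨_ (cong (θ² ≤ᵇ_) (conflicting-local K b ω ω' h)) (cong (θ¹ ≤ᵇ_) (surviving-local b ω ω' h)))

      d : ℕ
      d = s * t

      pow-pos : ∀ {k} m → 0 < k → 0 < k ^ m
      pow-pos {k} m h = m^n>0 k {{>-nonZero h}} m

      Q-pos : 0 < Q
      Q-pos = >-nonZero⁻¹ Q

      rareA : ∀ a → cnt (bad (inj₁ a)) * Z ≤ Q ^ N
      rareA a = rare-enough (cnt (bad (inj₁ a))) ((x * R * y) ^ mᵃ) _ Z (Q ^ N) (*-mono-≤ (pow-pos mᵃ posᵃ) (pow-pos mᵃ Q-pos))
        (≤-trans (≤-reflexive (sym (*-assoc (cnt (bad (inj₁ a))) _ _)))
          (≤-trans (singles (loss-wt a) (R * κ) (loss-wt≤ a) θᵃ mᵃ (bad (inj₁ a))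
                      (λ ω h → subst (θᵃ ≤_) (loss-as-hits a ω) (≤ᵇ-true {θᵃ} h)))
            (*-monoˡ-≤ (Q ^ N) (^-monoˡ-≤ mᵃ (loss-total a))))) rareᵃ

      rareK : ∀ b → cnt (badᴷ b) * Z ≤ Q ^ N
      rareK b = rare-enough (cnt (badᴷ b)) (y ^ mᴷ) _ Z (Q ^ N) (*-mono-≤ (pow-pos mᴷ posᴷ) (pow-pos mᴷ Q-pos))
        (≤-trans (≤-reflexive (sym (*-assoc (cnt (badᴷ b)) _ _)))
          (≤-trans (singles (λ p → 𝟙 (M' b p)) 1 (λ p → 𝟙≤1 (M' b p)) (suc K) mᴷ (badᴷ b) (λ ω h → ≤ᵇ-true {suc K} {hits b ω} h))
            (≤-reflexive (cong (λ z → z ^ mᴷ * Q ^ N) (row b))))) rareᴷ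

      rareC : ∀ b → cnt (bad² b) * Z ≤ Q ^ N
      rareC b = rare-enough (cnt (bad² b)) ((y * (x * R * y)) ^ m²) _ Z (Q ^ N) (*-mono-≤ (pow-pos m² pos²) (pow-pos (2 * m²) Q-pos))
        (≤-trans (≤-reflexive (sym (*-assoc (cnt (bad² b)) _ _)))
          (conflicts b K θ² m² (bad² b) (λ ω h → ≤ᵇ-true {θ²} h))) rare²

      rareS : ∀ b → cnt (bad¹ b) * Z ≤ Q ^ N
      rareS b = rare-enough (cnt (bad¹ b)) (y ^ m¹ * Q ^ m¹) _ Z (Q ^ N) (*-mono-≤ (pow-pos m¹ pos¹) (pow-pos m¹ (≤-trans Q-pos (m≤m+n Q G))))
        (≤-trans (≤-reflexive (sym (*-assoc (cnt (bad¹ b)) _ _)))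
          (≤-trans (Survival.survivors N Q nB x y κ R (x * R) M active genuine axioms b 1≤R θ¹ m¹ G room (bad¹ b) (λ ω h → ≤ᵇ-true {θ¹} h))
            (≤-reflexive (sym (*-assoc (y ^ m¹) _ _))))) rare¹

      -- The local lemma asks for 4 d, and the event at a B-vertex is a union of three events that
      -- are rare one by one; this is the 12 in `enough`.
      rare : ∀ e → cnt (bad e) * (4 * d) ≤ Q ^ N
      rare (inj₁ a) = ≤-trans (*-monoʳ-≤ (cnt (bad (inj₁ a))) (≤-trans (*-monoˡ-≤ d (m≤m+n 4 8)) enough)) (rareA a)
      rare (inj₂ b) = *-cancelˡ-≤ 3 (begin
        3 * (cnt (bad (inj₂ b)) * (4 * d))   ≡⟨ lem (cnt (bad (inj₂ b))) d ⟩
        cnt (bad (inj₂ b)) * (12 * d)        ≤⟨ *-mono-≤ union-bound enough ⟩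
        (cnt (badᴷ b) + (cnt (bad² b) + cnt (bad¹ b))) * Z
          ≡⟨ trans (*-distribʳ-+ Z (cnt (badᴷ b)) _) (cong (cnt (badᴷ b) * Z +_) (*-distribʳ-+ Z (cnt (bad² b)) _)) ⟩
        cnt (badᴷ b) * Z + (cnt (bad² b) * Z + cnt (bad¹ b) * Z)
          ≤⟨ +-mono-≤ (rareK b) (+-mono-≤ (rareC b) (rareS b)) ⟩
        Q ^ N + (Q ^ N + Q ^ N)              ≡⟨ lem₂ (Q ^ N) ⟩
        3 * Q ^ N                            ∎)
        where
        open ≤-Reasoning
        lem : ∀ c d → 3 * (c * (4 * d)) ≡ c * (12 * d)
        lem = solve-∀
        lem₂ : ∀ k → k + (k + k) ≡ 3 * k
        lem₂ = solve-∀
        union-bound : cnt (bad (inj₂ b)) ≤ cnt (badᴷ b) + (cnt (bad² b) + cnt (bad¹ b))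
        union-bound = ≤-trans (∑-mono (asgs Q N) (λ ω → ≤-trans (𝟙-∨ (badᴷ b ω) _) (+-monoʳ-≤ (𝟙 (badᴷ b ω)) (𝟙-∨ (bad² b ω) _))))
          (≤-reflexive (trans (∑-+ (asgs Q N) _ _) (cong (cnt (badᴷ b) +_) (∑-+ (asgs Q N) _ _))))

    good : Σ (Asg Q N) (Good τ)
    good with LocalLemma.localLemma bad reach bad-local s t
               (*-mono-≤ {1} {s} (*-mono-≤ {1} {2} (s≤s z≤n) (pow-pos 3 1≤A)) (*-mono-≤ {1} {3} (s≤s z≤n) (pow-pos 3 1≤A)))
               reach-row rare everything load
    ... | ω , h = ω , record
      { lossOK = λ a → ≤ᵇ-false (h (∈-++⁺ˡ (∈-map⁺ inj₁ (∈-fins a))))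
      ; hitsOK = λ b → ≤-pred (≤ᵇ-false (proj₁ (∨-false (onB b))))
      ; confOK = λ b → ≤ᵇ-false (proj₁ (∨-false (proj₂ (∨-false {badᴷ b ω} (onB b)))))
      ; survOK = λ b → ≤ᵇ-false (proj₂ (∨-false {bad² b ω} (proj₂ (∨-false {badᴷ b ω} (onB b)))))
      }
      where
      onB : ∀ b → bad (inj₂ b) ω ≡ false
      onB b = h (∈-++⁺ʳ (map inj₁ (fins nA)) (∈-map⁺ inj₂ (∈-fins b)))

-- The inequality between sums is injectivity of the selection in the only form in which it is used,
-- namely to bound degrees and codegrees after edges have been discarded.
select : ∀ {x} (p : Fin x → Bool) k → k ≤ ∑ (fins x) (λ j → 𝟙 (p j)) →
         Σ (Fin k → Fin x) λ ρ → (∀ i → p (ρ i) ≡ true) ×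
           (∀ f → ∑ (fins k) (f ∘ ρ) ≤ ∑ (fins x) (λ j → 𝟙 (p j) * f j))
select {zero}  p zero h = (λ ()) , (λ ()) , λ f → z≤n
select {suc x} p k    h = go (p zero) refl k h
  where
  Selection : ℕ → Set
  Selection k = Σ (Fin k → Fin (suc x)) λ ρ → (∀ i → p (ρ i) ≡ true) ×
    (∀ f → ∑ (fins k) (f ∘ ρ) ≤ ∑ (fins (suc x)) (λ j → 𝟙 (p j) * f j))
  open ≤-Reasoning
  go : ∀ b → p zero ≡ b → ∀ k → k ≤ ∑ (fins (suc x)) (λ j → 𝟙 (p j)) → Selection k
  go false e k h = suc ∘ ρ , proj₁ (proj₂ rest) , λ f → begin
      ∑ (fins k) (λ i → f (suc (ρ i)))                                      ≤⟨ proj₂ (proj₂ rest) (f ∘ suc) ⟩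
      ∑ (fins x) (λ j → 𝟙 (p (suc j)) * f (suc j))                          ≤⟨ m≤n+m _ (𝟙 (p zero) * f zero) ⟩
      𝟙 (p zero) * f zero + ∑ (fins x) (λ j → 𝟙 (p (suc j)) * f (suc j))    ≡⟨ sym (∑-suc x (λ j → 𝟙 (p j) * f j)) ⟩
      ∑ (fins (suc x)) (λ j → 𝟙 (p j) * f j)                                ∎
    where
    rest = select (p ∘ suc) k (≤-trans h (≤-reflexive (trans (∑-suc x (λ j → 𝟙 (p j))) (cong (λ b → 𝟙 b + ∑ (fins x) (λ j → 𝟙 (p (suc j)))) e))))
    ρ : Fin k → Fin x
    ρ = proj₁ rest
  go true e zero    h = (λ ()) , (λ ()) , λ f → z≤n
  go true e (suc k) h = ρ⁺ , (λ { zero → e ; (suc i) → proj₁ (proj₂ rest) i }) , λ f → begin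
      ∑ (fins (suc k)) (f ∘ ρ⁺)                                             ≡⟨ ∑-suc k (f ∘ ρ⁺) ⟩
      f zero + ∑ (fins k) (λ i → f (suc (ρ i)))                             ≤⟨ +-mono-≤ (≤-reflexive (sym (trans (cong (λ b → 𝟙 b * f zero) e) (*-identityˡ _)))) (proj₂ (proj₂ rest) (f ∘ suc)) ⟩
      𝟙 (p zero) * f zero + ∑ (fins x) (λ j → 𝟙 (p (suc j)) * f (suc j))    ≡⟨ sym (∑-suc x (λ j → 𝟙 (p j) * f j)) ⟩
      ∑ (fins (suc x)) (λ j → 𝟙 (p j) * f j)                                ∎
    where
    rest = select (p ∘ suc) k (≤-pred (≤-trans h (≤-reflexive (trans (∑-suc x (λ j → 𝟙 (p j))) (cong (λ b → 𝟙 b + ∑ (fins x) (λ j → 𝟙 (p (suc j)))) e)))))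
    ρ : Fin k → Fin x
    ρ = proj₁ rest
    ρ⁺ : Fin (suc k) → Fin (suc x)
    ρ⁺ zero    = zero
    ρ⁺ (suc i) = suc (ρ i)

all-true : {A : Set} (p : A → Bool) (xs : List A) → all p xs ≡ true → ∀ {x} → x ∈ˡ xs → p x ≡ true
all-true p (x ∷ xs) h (here refl) = proj₁ (∧-true h)
all-true p (x ∷ xs) h (there i)   = all-true p xs (proj₂ (∧-true {p x} h)) i

all-false : {A : Set} (p : A → Bool) (xs : List A) → all p xs ≡ false → ∃ λ x → p x ≡ false
all-false p (x ∷ xs) h with p x in e
... | false = x , e
... | true  = all-false p xs h

⇒-true : ∀ {a b} → not a ∨ b ≡ true → a ≡ true → b ≡ true
⇒-true {true} h refl = h

⇒-false : ∀ {a b} → not a ∨ b ≡ false → a ≡ true × b ≡ false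
⇒-false {true} h = refl , h

Matching : ∀ {nB nA x y κ R} → System nB nA x y κ R → Set
Matching {nA = nA} {x} S = Σ (Fin nA → Fin x) λ σ →
  ∀ a a' u → a ≢ a' → I u a (σ a) ≡ true → I u a' (σ a') ≡ true → ⊥
  where open System S

module Nibble {nB nA x y κ R : ℕ} (S : System nB nA x y κ R) (W : ℕ) (v₀ : Fin x)
  .{{_ : NonZero (x + W)}} (1≤R : 1 ≤ R) (1≤κ : 1 ≤ κ) where

  open System S using (I)
  open Experiment S W v₀ 1≤R 1≤κ
  open Axioms axioms

  survive : Fin nB → P → Asg Q N → Bool
  survive b = Survival.survives N Q nB x y κ R (x * R) M active genuine axioms b

  edge# : Fin nA → Fin x → P
  edge# a j = a ↑ˡ (nB * y) , j ↑ˡ W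

  edge#-≢ : ∀ {a a' j j'} → a ≢ a' → edge# a j ≢ edge# a' j'
  edge#-≢ ne e = ne (F.↑ˡ-injective (nB * y) _ _ (cong proj₁ e))

  private
    hit₁ : ∀ u p ω → M' u p ≡ true → hit p ω ≡ true → 𝟙 (M' u p) * 𝟙 (hit p ω) ≡ 1
    hit₁ u p ω m h rewrite m | h = refl

  one-hit : ∀ u p ω → M' u p ≡ true → hit p ω ≡ true → 1 ≤ hits u ω
  one-hit u p ω m h = begin
    1                                                            ≡⟨ sym (hit₁ u p ω m h) ⟩
    𝟙 (M' u p) * 𝟙 (hit p ω)                                     ≡⟨ sym (∑-pairs-δ p (λ r → 𝟙 (M' u r) * 𝟙 (hit r ω))) ⟩
    ∑ pairs (λ r → 𝟙 (M' u r) * 𝟙 (hit r ω) * 𝟙 (p ≐ r))         ≤⟨ ∑-mono pairs (λ r → ≤-trans (*-monoʳ-≤ (𝟙 (M' u r) * 𝟙 (hit r ω)) (𝟙≤1 (p ≐ r))) (≤-reflexive (*-identityʳ _))) ⟩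
    hits u ω                                                     ∎ where open ≤-Reasoning

  two-hits : ∀ u p q ω → p ≢ q → M' u p ≡ true → M' u q ≡ true → hit p ω ≡ true → hit q ω ≡ true → 2 ≤ hits u ω
  two-hits u p q ω ne mp mq hp hq = begin
    1 + 1                                                        ≡⟨ sym (cong₂ _+_ (trans (∑-pairs-δ p f) (hit₁ u p ω mp hp)) (trans (∑-pairs-δ q f) (hit₁ u q ω mq hq))) ⟩
    ∑ pairs (λ r → f r * 𝟙 (p ≐ r)) + ∑ pairs (λ r → f r * 𝟙 (q ≐ r)) ≡⟨ sym (∑-+ pairs _ _) ⟩
    ∑ pairs (λ r → f r * 𝟙 (p ≐ r) + f r * 𝟙 (q ≐ r))            ≤⟨ ∑-mono pairs (λ r → ≤-trans (≤-reflexive (sym (*-distribˡ-+ (f r) _ _))) (≤-trans (*-monoʳ-≤ (f r) (once r)) (≤-reflexive (*-identityʳ _)))) ⟩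
    hits u ω                                                     ∎
    where
    open ≤-Reasoning
    f : P → ℕ
    f r = 𝟙 (M' u r) * 𝟙 (hit r ω)
    once : ∀ r → 𝟙 (p ≐ r) + 𝟙 (q ≐ r) ≤ 1
    once r with p ≐ r in e | q ≐ r in e'
    ... | true  | true  = ⊥-elim (ne (trans (≐-true e) (sym (≐-true e'))))
    ... | true  | false = ≤-refl
    ... | false | b     = 𝟙≤1 b

  second-hit : ∀ u p ω → 2 ≤ hits u ω → ∃ λ q → (p ≐ q) ≡ false × M' u q ≡ true × hit q ω ≡ true
  second-hit u p ω h with ∑-pos pairs (λ r → f r * 𝟙 (not (p ≐ r))) (+-cancelˡ-≤ 1 _ _ (begin
      2                                                                   ≤⟨ h ⟩
      ∑ pairs f                                                           ≡⟨ ∑-cong pairs (λ r → sym (trans (cong (f r *_) (𝟙-not (p ≐ r))) (*-identityʳ (f r)))) ⟩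
      ∑ pairs (λ r → f r * (𝟙 (p ≐ r) + 𝟙 (not (p ≐ r))))                 ≡⟨ trans (∑-cong pairs (λ r → *-distribˡ-+ (f r) _ _)) (∑-+ pairs _ _) ⟩
      ∑ pairs (λ r → f r * 𝟙 (p ≐ r)) + ∑ pairs (λ r → f r * 𝟙 (not (p ≐ r)))
        ≤⟨ +-monoˡ-≤ _ (≤-trans (≤-reflexive (∑-pairs-δ p f)) (*-mono-≤ (𝟙≤1 (M' u p)) (𝟙≤1 (hit p ω)))) ⟩
      1 + ∑ pairs (λ r → f r * 𝟙 (not (p ≐ r))) ∎))
    where
    open ≤-Reasoning
    f : P → ℕ
    f r = 𝟙 (M' u r) * 𝟙 (hit r ω)
  ... | q , _ , pos with *-pos (𝟙 (M' u q) * 𝟙 (hit q ω)) _ pos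
  ...   | pos₁ , pos₂ with *-pos (𝟙 (M' u q)) _ pos₁
  ...     | pos₃ , pos₄ = q , not-true (𝟙-pos _ pos₂) , 𝟙-pos _ pos₃ , 𝟙-pos _ pos₄

  choice : Asg Q N → Fin nA → Fin x ⊎ Fin W
  choice ω a = splitAt x (lookup ω (a ↑ˡ (nB * y)))

  choice-hit : ∀ ω a {j} → choice ω a ≡ inj₁ j → hit (edge# a j) ω ≡ true
  choice-hit ω a {j} e = subst (λ z → (z == (j ↑ˡ W)) ≡ true) (F.splitAt⁻¹-↑ˡ e) (==-refl (j ↑ˡ W))

  edge-M : ∀ {u a j} → I u a j ≡ true → M' u (edge# a j) ≡ true
  edge-M {u} {a} {j} h = trans (M-real u a j) h

  module Next (y≤x : y ≤ x) (τ : Thresholds x y κ R Q) (ω : Asg Q N)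
    (good : Concentration.Good S W v₀ 1≤R 1≤κ y≤x τ ω)
    (x' y' : ℕ) (x'≤ : x' + Thresholds.θᵃ τ ≤ x) (y'≥ : Thresholds.θ¹ τ + Thresholds.θ² τ ≤ y') where

    open Thresholds τ
    open Concentration S W v₀ 1≤R 1≤κ y≤x using (loss; conflicting; surviving)
    open Concentration.Good good
    open Bounds axioms using (conflictWt; conflict; trips; ∑-trips)

    -- Hits from dummies count as well: a vertex covered by a dummy is deleted although nothing was
    -- matched there. This waste makes all B-vertices equally exposed.
    keep : Fin nA → Fin x → Bool
    keep a j = all (λ u → not (I u a j) ∨ (hits u ω ≤ᵇ 0)) (fins nB)

    sole : Fin nA → Fin x → Bool
    sole a j = all (λ u → not (I u a j) ∨ (hits u ω ≤ᵇ 1)) (fins nB)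

    done : Fin nA → Bool
    done a = [ sole a , (λ _ → false) ]′ (choice ω a)

    keep-hits : ∀ {u a j} → keep a j ≡ true → I u a j ≡ true → hits u ω ≡ 0
    keep-hits {u} k i = n≤0⇒n≡0 (≤ᵇ-true {hits u ω} (⇒-true (all-true _ (fins nB) k (∈-fins u)) i))

    sole-hits : ∀ {u a j} → sole a j ≡ true → I u a j ≡ true → hits u ω ≤ 1
    sole-hits {u} k i = ≤ᵇ-true {hits u ω} (⇒-true (all-true _ (fins nB) k (∈-fins u)) i)

    kept : ∀ a → x' ≤ ∑ (fins x) (λ j → 𝟙 (keep a j))
    kept a = +-cancelʳ-≤ θᵃ _ _ (begin
      x' + θᵃ                                              ≤⟨ x'≤ ⟩
      x                                                    ≡⟨ sym (trans (∑-const-fins x 1) (*-identityʳ x)) ⟩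
      ∑ (fins x) (λ j → 1)                                 ≤⟨ ∑-mono (fins x) each ⟩
      ∑ (fins x) (λ j → 𝟙 (keep a j) + ∑ (fins nB) (λ u → 𝟙 (I u a j) * hits u ω)) ≡⟨ ∑-+ (fins x) _ _ ⟩
      ∑ (fins x) (λ j → 𝟙 (keep a j)) + loss a ω           ≤⟨ +-monoʳ-≤ _ (<⇒≤ (lossOK a)) ⟩
      ∑ (fins x) (λ j → 𝟙 (keep a j)) + θᵃ                 ∎)
      where
      open ≤-Reasoning
      each : ∀ j → 1 ≤ 𝟙 (keep a j) + ∑ (fins nB) (λ u → 𝟙 (I u a j) * hits u ω)
      each j with keep a j in e
      ... | true  = s≤s z≤n
      ... | false with all-false _ (fins nB) e
      ...   | u , f with ⇒-false f
      ...     | i , h = ≤-trans (*-mono-≤ (≤-reflexive (cong 𝟙 (sym i))) (≤ᵇ-false {hits u ω} h)) (∑-fin (λ u → 𝟙 (I u a j) * hits u ω) u)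

    ρ : Fin nA → Fin x' → Fin x
    ρ a = proj₁ (select (keep a) x' (kept a))

    ρ-keep : ∀ a j → keep a (ρ a j) ≡ true
    ρ-keep a = proj₁ (proj₂ (select (keep a) x' (kept a)))

    ρ-sum : ∀ a f → ∑ (fins x') (f ∘ ρ a) ≤ ∑ (fins x) (λ j → 𝟙 (keep a j) * f j)
    ρ-sum a = proj₂ (proj₂ (select (keep a) x' (kept a)))

    ρ-sum' : ∀ a f → ∑ (fins x') (f ∘ ρ a) ≤ ∑ (fins x) f
    ρ-sum' a f = ≤-trans (ρ-sum a f) (∑-mono (fins x) (λ j → ≤-trans (*-monoˡ-≤ (f j) (𝟙≤1 (keep a j))) (≤-reflexive (*-identityˡ (f j)))))

    I' : Fin nB → Fin nA → Fin x' → Bool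
    I' u a j = not (done a) ∧ I u a (ρ a j)

    I'≤I : ∀ u a j → 𝟙 (I' u a j) ≤ 𝟙 (I u a (ρ a j))
    I'≤I u a j = 𝟙-mono _ _ (λ h → proj₂ (∧-true {not (done a)} h))

    private
      survives-inactive : ∀ b a j w → choice ω a ≡ inj₂ w → keep a j ≡ true →
        survive b (edge# a j) ω ≡ true
      survives-inactive b a j w e k = clear-intro _ ω (λ c → any-false _ (labels (edge# a j)) (none c))
        where
        open Survival N Q nB x y κ R (x * R) M active genuine axioms b
        none : ∀ c {l} → l ∈ˡ labels (edge# a j) → block l (c , lookup ω c) ≡ false
        none c {inj₁ d} i with ∈-labels₁ (edge# a j) i
        ... | refl with c F.≟ (a ↑ˡ (nB * y))
        ...   | no _     = refl
        ...   | yes refl = cong left e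
        none c {inj₂ u} i with M u c (lookup ω c) in m
        ... | false = refl
        ... | true  = ⊥-elim (<-irrefl refl (≤-trans (one-hit u (c , lookup ω c) ω m (==-refl (lookup ω c)))
                        (≤-reflexive (keep-hits {u} {a} {j} k (trans (sym (M-real u a j)) (proj₂ (∧-true {not (u == b)} (∈-labels (edge# a j) i))))))))

      restrict : ∀ (f : P → ℕ) → ∑ (fins nA) (λ a → ∑ (fins Q) (λ v → f (a ↑ˡ (nB * y) , v))) ≤ ∑ pairs f
      restrict f = ≤-trans (m≤m+n _ _) (≤-reflexive (trans (sym (∑-split+ nA (nB * y) (λ c → ∑ (fins Q) (λ v → f (c , v))))) (sym (∑-pairs f))))

      restrict-active : ∀ (f : Fin Q → ℕ) → ∑ (fins x) (λ j → f (j ↑ˡ W)) ≤ ∑ (fins Q) f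
      restrict-active f = ≤-trans (m≤m+n _ _) (≤-reflexive (sym (∑-split+ x W f)))

      clashes : Fin nB → P → ℕ
      clashes b p = ∑ (fins nB) (λ u → ∑ pairs (λ q → conflictWt b (p , u , q) * 𝟙 (conflict K (p , u , q) ω)))

      -- If `a` is inactive, its kept edges at `b` survive in the sense of `survive`. If `a` picked
      -- a sole edge, it is done and contributes nothing. Otherwise some vertex of the picked edge
      -- has a second hit, and this single conflict already weighs at least as much as all edges
      -- between `a` and `b`.
      remaining : ∀ b a → 𝟙 (not (done a)) * ∑ (fins x) (λ j → 𝟙 (keep a j) * 𝟙 (I b a j))
        ≤ ∑ (fins x) (λ j → 𝟙 (M' b (edge# a j)) * 𝟙 (genuine (proj₁ (edge# a j))) * 𝟙 (survive b (edge# a j) ω))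
          + ∑ (fins Q) (λ v → clashes b (a ↑ˡ (nB * y) , v))
      remaining b a with choice ω a in e
      ... | inj₂ w = ≤-trans (≤-reflexive (*-identityˡ _)) (≤-trans (∑-mono (fins x) each) (m≤m+n _ _))
        where
        each : ∀ j → 𝟙 (keep a j) * 𝟙 (I b a j) ≤ 𝟙 (M' b (edge# a j)) * 𝟙 (genuine (proj₁ (edge# a j))) * 𝟙 (survive b (edge# a j) ω)
        each j with keep a j in k
        ... | false = z≤n
        ... | true rewrite M-real b a j | survives-inactive b a j w e k | F.splitAt-↑ˡ nA a (nB * y) =
                ≤-reflexive (trans (*-identityˡ _) (sym (trans (*-identityʳ _) (*-identityʳ _))))
      ... | inj₁ j₀ with sole a j₀ in so
      ...   | true  = z≤n
      ...   | false with all-false _ (fins nB) so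
      ...     | u , f with ⇒-false f
      ...       | i , h with second-hit u (edge# a j₀) ω (≤ᵇ-false {hits u ω} h)
      ...         | q , p≐q , mq , hq = begin
        1 * ∑ (fins x) (λ j → 𝟙 (keep a j) * 𝟙 (I b a j))
          ≤⟨ ≤-trans (≤-reflexive (*-identityˡ _)) (∑-mono (fins x) (λ j → ≤-trans (*-monoˡ-≤ (𝟙 (I b a j)) (𝟙≤1 (keep a j)))
               (≤-reflexive (trans (*-identityˡ _) (cong 𝟙 (sym (M-real b a j))))))) ⟩
        ∑ (fins x) (λ j → 𝟙 (M' b (edge# a j)))
          ≤⟨ restrict-active (λ v → 𝟙 (M b (a ↑ˡ (nB * y)) v)) ⟩
        adj (a ↑ˡ (nB * y)) b
          ≡⟨ sym (trans (cong₂ _*_ (trans (cong₂ (λ m m' → adj (a ↑ˡ (nB * y)) b * (𝟙 m * 𝟙 m')) (edge-M {u} {a} {j₀} i) mq) (*-identityʳ (adj (a ↑ˡ (nB * y)) b))) conflict₁) (*-identityʳ (adj (a ↑ˡ (nB * y)) b))) ⟩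
        conflictWt b (edge# a j₀ , u , q) * 𝟙 (conflict K (edge# a j₀ , u , q) ω)
          ≡⟨ sym (∑-pairs-δ q (λ q → conflictWt b (edge# a j₀ , u , q) * 𝟙 (conflict K (edge# a j₀ , u , q) ω))) ⟩
        ∑ pairs (λ r → conflictWt b (edge# a j₀ , u , r) * 𝟙 (conflict K (edge# a j₀ , u , r) ω) * 𝟙 (q ≐ r))
          ≤⟨ ∑-mono pairs (λ r → ≤-trans (*-monoʳ-≤ (conflictWt b (edge# a j₀ , u , r) * 𝟙 (conflict K (edge# a j₀ , u , r) ω)) (𝟙≤1 (q ≐ r))) (≤-reflexive (*-identityʳ _))) ⟩
        ∑ pairs (λ q → conflictWt b (edge# a j₀ , u , q) * 𝟙 (conflict K (edge# a j₀ , u , q) ω))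
          ≤⟨ ∑-fin (λ u → ∑ pairs (λ q → conflictWt b (edge# a j₀ , u , q) * 𝟙 (conflict K (edge# a j₀ , u , q) ω))) u ⟩
        clashes b (edge# a j₀)
          ≤⟨ ∑-fin (λ v → clashes b (a ↑ˡ (nB * y) , v)) (j₀ ↑ˡ W) ⟩
        ∑ (fins Q) (λ v → clashes b (a ↑ˡ (nB * y) , v))
          ≤⟨ m≤n+m _ _ ⟩
        _ ∎
        where
        open ≤-Reasoning
        conflict₁ : 𝟙 (conflict K (edge# a j₀ , u , q) ω) ≡ 1
        -- A good assignment respects the cap `K` at every vertex, so the capped definition misses
        -- no conflict here.
        conflict₁ = cong 𝟙 (cong₂ _∧_ (choice-hit ω a e) (cong₂ _∧_ hq (cong₂ _∧_ (cong not p≐q) (true-≤ᵇ (hitsOK u)))))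

      new-degree : ∀ b → ∑ (fins nA) (λ a → ∑ (fins x') (λ j → 𝟙 (I' b a j))) ≤ y'
      new-degree b = begin
        ∑ (fins nA) (λ a → ∑ (fins x') (λ j → 𝟙 (I' b a j)))
          ≤⟨ ∑-mono (fins nA) (λ a → ≤-trans (≤-reflexive (trans (∑-cong (fins x') (λ j → 𝟙-∧ (not (done a)) _)) (∑-*ˡ (fins x') (𝟙 (not (done a))) _)))
               (≤-trans (*-monoʳ-≤ (𝟙 (not (done a))) (ρ-sum a (λ j → 𝟙 (I b a j)))) (remaining b a))) ⟩
        ∑ (fins nA) (λ a → ∑ (fins x) (λ j → sv (edge# a j)) + ∑ (fins Q) (λ v → clashes b (a ↑ˡ (nB * y) , v)))
          ≡⟨ ∑-+ (fins nA) _ _ ⟩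
        ∑ (fins nA) (λ a → ∑ (fins x) (λ j → sv (edge# a j))) + ∑ (fins nA) (λ a → ∑ (fins Q) (λ v → clashes b (a ↑ˡ (nB * y) , v)))
          ≤⟨ +-mono-≤ (≤-trans (∑-mono (fins nA) (λ a → restrict-active (λ v → sv (a ↑ˡ (nB * y) , v)))) (restrict sv))
               (≤-trans (restrict (clashes b)) (≤-reflexive (sym (∑-trips _)))) ⟩
        surviving b ω + conflicting K b ω
          ≤⟨ +-mono-≤ (<⇒≤ (survOK b)) (<⇒≤ (confOK b)) ⟩
        θ¹ + θ²
          ≤⟨ y'≥ ⟩
        y' ∎
        where
        open ≤-Reasoning
        sv : P → ℕ
        sv p = 𝟙 (M' b p) * 𝟙 (genuine (proj₁ p)) * 𝟙 (survive b p ω)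

    next : System nB nA x' y' κ R
    next = record
      { I         = I'
      ; uniform   = λ a j b h → trans (∑-cong (fins nB) (λ u → cong (λ d → 𝟙 (d ∧ I u a (ρ a j))) (proj₁ (∧-true h))))
                      (System.uniform S a (ρ a j) b (proj₂ (∧-true {not (done a)} h)))
      ; degree    = new-degree
      ; codegree  = λ u w ne → ≤-trans (∑-mono (fins nA) (λ a → ≤-trans (∑-mono (fins x') (λ j → *-mono-≤ (I'≤I u a j) (I'≤I w a j)))
                      (ρ-sum' a (λ j → 𝟙 (I u a j) * 𝟙 (I w a j))))) (System.codegree S u w ne)
      ; codegreeA = λ u a → ≤-trans (∑-mono (fins x') (I'≤I u a)) (≤-trans (ρ-sum' a (λ j → 𝟙 (I u a j))) (System.codegreeA S u a))
      }

    -- Two A-vertices that succeeded now cannot share a vertex, as it would have two hits. One that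
    -- succeeded and one matched later cannot either, because kept edges avoid covered vertices. Two
    -- matched later are separated by the given matching.
    extend : Matching next → Matching S
    extend (σ' , disj) = (λ a → proj₁ (σ⁺ a)) , λ a a' u ne → clash ne (proj₂ (σ⁺ a)) (proj₂ (σ⁺ a'))
      where
      Status : Fin nA → Fin x → Set
      Status a j = (sole a j ≡ true × hit (edge# a j) ω ≡ true) ⊎ (done a ≡ false × j ≡ ρ a (σ' a))
      σ⁺ : ∀ a → Σ (Fin x) (Status a)
      σ⁺ a with choice ω a in e
      ... | inj₂ w = ρ a (σ' a) , inj₂ (refl , refl)
      ... | inj₁ j with sole a j in so
      ...   | true  = j , inj₁ (so , choice-hit ω a e)
      ...   | false = ρ a (σ' a) , inj₂ (refl , refl)
      0≢1 : ∀ {u a j a' j'} → hit (edge# a j) ω ≡ true → I u a j ≡ true → keep a' j' ≡ true → I u a' j' ≡ true → ⊥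
      0≢1 {u} {a} {j} {a'} {j'} h i k i' = <-irrefl refl (≤-trans (one-hit u (edge# a j) ω (edge-M {u} {a} {j} i) h) (≤-reflexive (keep-hits {u} {a'} {j'} k i')))
      clash : ∀ {a a' j j' u} → a ≢ a' → Status a j → Status a' j' → I u a j ≡ true → I u a' j' ≡ true → ⊥
      clash {a} {a'} {j} {j'} {u} ne (inj₁ (so , h)) (inj₁ (_ , h')) i i' =
        <-irrefl refl (≤-trans (two-hits u (edge# a j) (edge# a' j') ω (edge#-≢ ne) (edge-M {u} {a} {j} i) (edge-M {u} {a'} {j'} i') h h') (sole-hits {u} {a} {j} so i))
      clash {a} {a'} {u = u} ne (inj₁ (_ , h)) (inj₂ (_ , refl)) i i' = 0≢1 {u} h i (ρ-keep a' (σ' a')) i'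
      clash {a} {a'} {u = u} ne (inj₂ (_ , refl)) (inj₁ (_ , h)) i i' = 0≢1 {u} h i' (ρ-keep a (σ' a)) i
      clash {a} {a'} {u = u} ne (inj₂ (d , refl)) (inj₂ (d' , refl)) i i' =
        disj a a' u ne (cong₂ (λ b c → not b ∧ c) d i) (cong₂ (λ b c → not b ∧ c) d' i')

nibble : ∀ {nB nA x y κ R} (S : System nB nA x y κ R) W → 1 ≤ x → 1 ≤ R → 1 ≤ κ → y ≤ x →
         (τ : Thresholds x y κ R (x + W)) → ∀ x' y' → x' + Thresholds.θᵃ τ ≤ x → Thresholds.θ¹ τ + Thresholds.θ² τ ≤ y' →
         Σ (System nB nA x' y' κ R) λ S' → Matching S' → Matching S
nibble {x = suc x} S W _ 1≤R 1≤κ y≤x τ x' y' hx hy = next , extend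
  where
  ω✓ = Concentration.good S W zero 1≤R 1≤κ y≤x τ
  open Nibble.Next S W zero 1≤R 1≤κ y≤x τ (proj₁ ω✓) (proj₂ ω✓) x' y' hx hy

-- Finishing with a large gap

-- With `W = 0` every A-vertex picks an edge, and a bad event is a pair of distinct picks at one
-- vertex. Its probability is at most 1 / Q ^ 2, its row sum at most 2 and the load at most 2 x R y,
-- so the condition 4 d P ≤ 1 becomes 16 x R y ≤ x ^ 2, which is `spread`.
module Finish {nB nA x y κ R : ℕ} (S : System nB nA x y κ R) (v₀ : Fin x) .{{_ : NonZero (x + 0)}}
  (1≤R : 1 ≤ R) (1≤κ : 1 ≤ κ) (1≤y : 1 ≤ y) (spread : 16 * (R * y) ≤ x) where

  open System S using (I)
  open Experiment S 0 v₀ 1≤R 1≤κ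
  open Axioms axioms
  open Nibble S 0 v₀ 1≤R 1≤κ

  private
    E : Set
    E = Fin nB × P × P

    bad : E → Asg Q N → Bool
    bad (b , p , q) ω = (M' b p ∧ M' b q) ∧ (not (p ≐ q) ∧ (hit p ω ∧ hit q ω))

    reach : E → Fin N → ℕ
    reach (b , p , q) c = 𝟙 (M' b p) * 𝟙 (M' b q) * (𝟙 (c == proj₁ p) + 𝟙 (c == proj₁ q))

    everything : List E
    everything = concatMap (λ b → concatMap (λ p → map (λ q → b , p , q) pairs) pairs) (fins nB)

    ∑-everything : (f : E → ℕ) → ∑ everything f ≡ ∑ (fins nB) (λ b → ∑ pairs (λ p → ∑ pairs (λ q → f (b , p , q))))
    ∑-everything f = trans (∑-concatMap _ (fins nB) f) (∑-cong (fins nB) (λ b → trans (∑-concatMap _ pairs f) (∑-cong pairs (λ p → ∑-map _ pairs f))))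

    bad-local : ∀ e → Local (λ c → 0 < reach e c) (bad e)
    bad-local (b , p@(c , v) , q@(c' , v')) ω ω' h with M' b p | M' b q
    ... | false | _     = refl
    ... | true  | false = refl
    ... | true  | true  = cong (not (p ≐ q) ∧_) (cong₂ _∧_
          (cong (_== v) (h c (subst (λ z → 0 < 1 * (𝟙 z + 𝟙 (c == c'))) (sym (==-refl c)) z<s)))
          (cong (_== v') (h c' (subst (λ z → 0 < 1 * (𝟙 (c' == c) + 𝟙 z)) (sym (==-refl c')) (≤-trans (m≤n+m 1 (𝟙 (c' == c))) (m≤m+n _ 0))))))

    reach-row : ∀ e → ∑ (fins N) (reach e) ≤ 2
    reach-row (b , p , q) = begin
      ∑ (fins N) (reach (b , p , q))
        ≡⟨ trans (∑-*ˡ (fins N) (𝟙 (M' b p) * 𝟙 (M' b q)) _) (cong (𝟙 (M' b p) * 𝟙 (M' b q) *_) (trans (∑-+ (fins N) _ _) (cong₂ _+_ (∑-δ1 (proj₁ p)) (∑-δ1 (proj₁ q))))) ⟩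
      𝟙 (M' b p) * 𝟙 (M' b q) * 2
        ≤⟨ *-monoˡ-≤ 2 (*-mono-≤ (𝟙≤1 (M' b p)) (𝟙≤1 (M' b q))) ⟩
      2 ∎ where open ≤-Reasoning

    at : ∀ c b → ∑ pairs (λ p → 𝟙 (M' b p) * 𝟙 (c == proj₁ p)) ≡ adj c b
    at c b = begin
      ∑ pairs (λ p → 𝟙 (M' b p) * 𝟙 (c == proj₁ p))
        ≡⟨ trans (∑-pairs _) (∑-cong (fins N) (λ c' → trans (∑-*ʳ (fins Q) (𝟙 (c == c')) _) (trans (*-comm _ (𝟙 (c == c'))) (cong (λ z → 𝟙 z * adj c' b) (==-sym c c'))))) ⟩
      ∑ (fins N) (λ c' → 𝟙 (c' == c) * adj c' b)
        ≡⟨ ∑-δ c (λ c' → adj c' b) ⟩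
      adj c b ∎ where open ≡-Reasoning

    load : ∀ c → ∑ everything (λ e → reach e c) ≤ 2 * (x * R * y)
    load c = begin
      ∑ everything (λ e → reach e c)
        ≡⟨ ∑-everything _ ⟩
      ∑ (fins nB) (λ b → ∑ pairs (λ p → ∑ pairs (λ q → 𝟙 (M' b p) * 𝟙 (M' b q) * (𝟙 (c == proj₁ p) + 𝟙 (c == proj₁ q)))))
        ≡⟨ ∑-cong (fins nB) (λ b → each b) ⟩
      ∑ (fins nB) (λ b → adj c b * (2 * y))
        ≡⟨ ∑-*ʳ (fins nB) (2 * y) _ ⟩
      ∑ (fins nB) (adj c) * (2 * y)
        ≤⟨ *-monoˡ-≤ (2 * y) (adj-sum c) ⟩
      x * R * (2 * y)
        ≡⟨ lem₃ (x * R) y ⟩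
      2 * (x * R * y) ∎
      where
      open ≤-Reasoning
      lem : ∀ a b c d → a * b * (c + d) ≡ a * c * b + a * (b * d)
      lem = solve-∀
      lem₃ : ∀ a y → a * (2 * y) ≡ 2 * (a * y)
      lem₃ = solve-∀
      lem₂ : ∀ a y → a * y + y * a ≡ a * (2 * y)
      lem₂ = solve-∀
      each : ∀ b → ∑ pairs (λ p → ∑ pairs (λ q → 𝟙 (M' b p) * 𝟙 (M' b q) * (𝟙 (c == proj₁ p) + 𝟙 (c == proj₁ q)))) ≡ adj c b * (2 * y)
      each b = ≡.begin
        ∑ pairs (λ p → ∑ pairs (λ q → 𝟙 (M' b p) * 𝟙 (M' b q) * (𝟙 (c == proj₁ p) + 𝟙 (c == proj₁ q))))
          ≡.≡⟨ ∑-cong pairs (λ p → trans (trans (∑-cong pairs (λ q → lem (𝟙 (M' b p)) (𝟙 (M' b q)) (𝟙 (c == proj₁ p)) _)) (∑-+ pairs _ _))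
               (cong₂ _+_ (trans (∑-*ˡ pairs (𝟙 (M' b p) * 𝟙 (c == proj₁ p)) _) (cong (𝟙 (M' b p) * 𝟙 (c == proj₁ p) *_) (row b)))
                          (trans (∑-*ˡ pairs (𝟙 (M' b p)) _) (cong (𝟙 (M' b p) *_) (at c b))))) ⟩
        ∑ pairs (λ p → 𝟙 (M' b p) * 𝟙 (c == proj₁ p) * y + 𝟙 (M' b p) * adj c b)
          ≡.≡⟨ trans (∑-+ pairs _ _) (cong₂ _+_ (trans (∑-*ʳ pairs y _) (cong (_* y) (at c b))) (trans (∑-*ʳ pairs (adj c b) _) (cong (_* adj c b) (row b)))) ⟩
        adj c b * y + y * adj c b
          ≡.≡⟨ lem₂ (adj c b) y ⟩
        adj c b * (2 * y) ≡.∎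
        where module ≡ = ≡-Reasoning

    rare : ∀ e → cnt (bad e) * (4 * (2 * (2 * (x * R * y)))) ≤ Q ^ N
    rare (b , p , q) with p ≐ q in e
    ... | true  = ≤-trans (≤-reflexive (cong (_* (4 * (2 * (2 * (x * R * y))))) (∑-zero∀ (asgs Q N) (λ ω → cong 𝟙 (𝔹.∧-zeroʳ (M' b p ∧ M' b q)))))) z≤n
    ... | false = begin
      cnt (λ ω → (M' b p ∧ M' b q) ∧ (hit p ω ∧ hit q ω)) * (4 * (2 * (2 * (x * R * y))))
        ≤⟨ *-mono-≤ (∑-mono (asgs Q N) (λ ω → 𝟙-mono _ _ (λ h → trans (cong (hit p ω ∧_) (𝔹.∧-identityʳ (hit q ω))) (proj₂ (∧-true {M' b p ∧ M' b q} h))))) bound ⟩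
      cnt (λ ω → all (λ p → hit p ω) (p ∷ q ∷ [])) * Q ^ 2
        ≤⟨ cnt-hits (p ∷ q ∷ []) (((λ { refl → case trans (sym e) (cong₂ _∧_ (==-refl (proj₁ p)) (==-refl (proj₂ p))) of λ () }) ∷ []) ∷ [] ∷ []) ⟩
      Q ^ N ∎
      where
      open ≤-Reasoning
      lem : ∀ x R y → 4 * (2 * (2 * (x * R * y))) ≡ x * (16 * (R * y))
      lem = solve-∀
      bound : 4 * (2 * (2 * (x * R * y))) ≤ Q ^ 2
      bound = begin
        4 * (2 * (2 * (x * R * y)))   ≡⟨ lem x R y ⟩
        x * (16 * (R * y))            ≤⟨ *-monoʳ-≤ x spread ⟩
        x * x                         ≤⟨ *-mono-≤ (m≤m+n x 0) (≤-trans (m≤m+n x 0) (≤-reflexive (sym (*-identityʳ Q)))) ⟩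
        Q ^ 2                         ∎

    1≤x : 1 ≤ x
    1≤x = ≤-trans (s≤s z≤n) (F.toℕ<n v₀)

    outcome : Σ (Asg Q N) λ ω → ∀ {e} → e ∈ˡ everything → bad e ω ≡ false
    outcome = LocalLemma.localLemma bad reach bad-local 2 (2 * (x * R * y))
      (*-mono-≤ {1} {2} (s≤s z≤n) (*-mono-≤ {1} {2} (s≤s z≤n) (*-mono-≤ (*-mono-≤ 1≤x 1≤R) 1≤y)))
      reach-row rare everything load

  from : ∀ ω → (∀ {e} → e ∈ˡ everything → bad e ω ≡ false) → Matching S
  from ω clean = (λ a → proj₁ (σ a)) , λ a a' u ne i i' →
    avoided u (edge# a (proj₁ (σ a))) (edge# a' (proj₁ (σ a'))) (edge#-≢ ne) (edge-M {u} {a} i) (edge-M {u} {a'} i') (proj₂ (σ a)) (proj₂ (σ a'))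
    where
    σ : ∀ a → Σ (Fin x) λ j → hit (edge# a j) ω ≡ true
    -- `Fin 0` has no inactive value, so the active case is the only one.
    σ a with choice ω a in e
    ... | inj₁ j = j , choice-hit ω a e
    avoided : ∀ u p q → p ≢ q → M' u p ≡ true → M' u q ≡ true → hit p ω ≡ true → hit q ω ≡ true → ⊥
    -- Membership of the event in `everything` is found by counting: the indicator of the triple
    -- sums to 1, so some listed entry equals it.
    avoided u p q ne mp mq hp hq with ∑-pos everything (λ { (b , r , s) → 𝟙 (b == u) * (𝟙 (p ≐ r) * 𝟙 (q ≐ s)) }) (≤-trans (≤-reflexive (sym picked)) ≤-refl)
      where
      picked : ∑ everything (λ { (b , r , s) → 𝟙 (b == u) * (𝟙 (p ≐ r) * 𝟙 (q ≐ s)) }) ≡ 1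
      picked = trans (∑-everything _) (trans (∑-cong (fins nB) (λ b →
          trans (∑-cong pairs (λ r → trans (∑-*ˡ pairs (𝟙 (b == u)) _) (cong (𝟙 (b == u) *_) (trans (∑-*ˡ pairs (𝟙 (p ≐ r)) _)
            (cong (𝟙 (p ≐ r) *_) (trans (∑-cong pairs (λ s → sym (*-identityˡ _))) (∑-pairs-δ q (λ _ → 1))))))))
            (trans (∑-*ˡ pairs (𝟙 (b == u)) _) (cong (𝟙 (b == u) *_) (trans (∑-cong pairs (λ r → *-comm (𝟙 (p ≐ r)) 1)) (∑-pairs-δ p (λ _ → 1)))))))
          (trans (∑-cong (fins nB) (λ b → *-identityʳ _)) (∑-δ1 u)))
    ... | (b , r , s) , ∈all , pos with *-pos (𝟙 (b == u)) _ pos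
    ...   | pos₁ , pos₂ with *-pos (𝟙 (p ≐ r)) _ pos₂
    ...     | pos₃ , pos₄ with ==-true {i = b} {u} (𝟙-pos (b == u) pos₁) | ≐-true {p = p} {r} (𝟙-pos (p ≐ r) pos₃) | ≐-true {p = q} {s} (𝟙-pos (q ≐ s) pos₄)
    ...       | refl | refl | refl = case trans (sym (clean ∈all)) is-bad of λ ()
      where
      is-bad : bad (u , p , q) ω ≡ true
      is-bad with p ≐ q in e
      ... | true  = ⊥-elim (ne (≐-true e))
      ... | false rewrite mp | mq | hp | hq = refl

  matching : Matching S
  matching = from (proj₁ outcome) (proj₂ outcome)

finish : ∀ {nB nA x y κ R} (S : System nB nA x y κ R) → 1 ≤ x → 1 ≤ R → 1 ≤ κ → 1 ≤ y → 16 * (R * y) ≤ x → Matching S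
finish {x = suc x} S _ 1≤R 1≤κ 1≤y h = Finish.matching S zero 1≤R 1≤κ 1≤y h

-- Parameters and iteration

-- A relative excess 1/j doubles when raised to the power `j`, by Bernoulli's inequality. The moment
-- of order `j * l` thus turns it into the factor 2 ^ l; this decides the orders of the moments
-- below.
ratio : ∀ U V j l → 1 ≤ j → U * suc j ≤ V * j → U ^ (j * l) * 2 ^ l ≤ V ^ (j * l)
ratio U V j l 1≤j h = *-cancelʳ-≤ _ _ (j ^ (j * l)) {{m^n≢0 j (j * l) {{>-nonZero 1≤j}}}} (begin
  U ^ (j * l) * 2 ^ l * j ^ (j * l)         ≡⟨ trans (*-assoc (U ^ (j * l)) _ _) (cong (U ^ (j * l) *_) (trans (*-comm (2 ^ l) _) (cong (_* 2 ^ l) (sym (^-*-assoc j j l))))) ⟩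
  U ^ (j * l) * ((j ^ j) ^ l * 2 ^ l)       ≡⟨ cong (U ^ (j * l) *_) (sym (^-distribʳ-* l (j ^ j) 2)) ⟩
  U ^ (j * l) * (j ^ j * 2) ^ l             ≤⟨ *-monoʳ-≤ (U ^ (j * l)) (^-monoˡ-≤ l double) ⟩
  U ^ (j * l) * (suc j ^ j) ^ l             ≡⟨ cong (U ^ (j * l) *_) (^-*-assoc (suc j) j l) ⟩
  U ^ (j * l) * suc j ^ (j * l)             ≡⟨ sym (^-distribʳ-* (j * l) U (suc j)) ⟩
  (U * suc j) ^ (j * l)                     ≤⟨ ^-monoˡ-≤ (j * l) h ⟩
  (V * j) ^ (j * l)                         ≡⟨ ^-distribʳ-* (j * l) V j ⟩
  V ^ (j * l) * j ^ (j * l)                 ∎)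
  where
  open ≤-Reasoning
  lem : ∀ a j → a * 2 * j ≡ a * (j + j)
  lem = solve-∀
  double : j ^ j * 2 ≤ suc j ^ j
  double = *-cancelʳ-≤ _ _ j {{>-nonZero 1≤j}} (≤-trans (≤-reflexive (lem (j ^ j) j)) (bernoulli j j))

module Division (m n : ℕ) .{{_ : NonZero n}} where
  -- The floor plus one even when `n` divides `m`: besides saving a case distinction this is always
  -- positive, and the thresholds built from it must be.
  ceil : ℕ
  ceil = m / n + 1

  ceil-lower : m ≤ ceil * n
  ceil-lower = begin
    m                    ≡⟨ m≡m%n+[m/n]*n m n ⟩
    m % n + m / n * n    ≤⟨ +-monoˡ-≤ (m / n * n) (<⇒≤ (m%n<n m n)) ⟩
    n + m / n * n        ≡⟨ lem n (m / n) ⟩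
    (m / n + 1) * n      ∎
    where
    open ≤-Reasoning
    lem : ∀ n k → n + k * n ≡ (k + 1) * n
    lem = solve-∀

  ceil-upper : ceil * n ≤ m + n
  ceil-upper = ≤-trans (≤-reflexive (lem n (m / n))) (+-monoˡ-≤ n (m/n*n≤m m n))
    where
    lem : ∀ n k → (k + 1) * n ≡ k * n + n
    lem = solve-∀

-- The gap Λx ≥ (Λ + q)y survives one nibble, with q replaced by q + p; v and w are the leading terms of the
-- thresholds, and everything has been multiplied by U * F to keep it integral.
module Gap (R' g κ x y w v G e q p c : ℕ) where
  R a T F Λ Q U : ℕ
  R = suc R'
  a = g * g
  T = a * g
  F = a * T
  Λ = 2 * (g * T)
  Q = x * T
  U = Q + G

  -- Once `hv` is inserted, the leading terms reproduce the old gap and leave the surplus q * y * x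
  -- * F, which is at least 2 * p * y * Q * F because q is at least p * (2 * T). One half pays for
  -- replacing q by q + p, the other half for the error terms `S`.
  gap-step : 1 ≤ g → 1 ≤ x → 1 ≤ w →
    26 * c + (2 + (4 * (R * R) + 16 * R)) ≤ g →
    Λ + q + p ≤ c * Λ → 1 ≤ p → p * (2 * T) ≤ q → (Λ + q) * y ≤ Λ * x → y ≤ x → R ≤ T →
    G + e ≡ x + R' * y → w * F ≤ y + F → w * F ≤ 2 * y →
    2 * (g * g) * (R * F) ≤ y → 2 * (g * g) * e ≤ y →
    v * (U * F) ≤ y * Q * (F + 1) + U * F →
    (Λ + q + p) * (v + 2 * w) + Λ * (R * w * (a + 2)) ≤ Λ * x
  gap-step 1≤g 1≤x 1≤w g≥ Γ≤ 1≤p q≥ gap y≤x R≤T Ge wF₁ wF₂ big₁ big₂ hv =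
    *-cancelʳ-≤ _ _ (U * F) {{>-nonZero UF-pos}} (+-cancelʳ-≤ (Λ * x * e * F) _ _ (begin
      ((Λ + q + p) * (v + 2 * w) + Λ * (R * w * (a + 2))) * (U * F) + Λ * x * e * F
        ≡⟨ expand₁ (Λ + q + p) v w Λ (R * w) a U F (Λ * x * e * F) ⟩
      (Λ + q + p) * (v * (U * F)) + ((Λ + q + p) * (2 * w) * (U * F) + Λ * (R * w) * (a * F * U) + 2 * (Λ * (R * w)) * (U * F) + Λ * x * e * F)
        ≤⟨ +-mono-≤ (*-monoʳ-≤ (Λ + q + p) hv) (+-monoˡ-≤ (Λ * x * e * F) (+-mono-≤ (+-mono-≤
             (*-monoʳ-≤ ((Λ + q + p) * (2 * w)) (*-monoˡ-≤ F U≤2Q))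
             main₁)
             (*-monoʳ-≤ (2 * (Λ * (R * w))) (*-monoˡ-≤ F U≤2Q)))) ⟩
      (Λ + q + p) * (y * Q * (F + 1) + U * F) + ((Λ + q + p) * (2 * w) * (2 * Q * F) + (Λ * R * (y * F * x) + Λ * R * (F * F * x) + Λ * (R * R) * (w * (a * F) * x)) + 2 * (Λ * (R * w)) * (2 * Q * F) + Λ * x * e * F)
        ≤⟨ +-monoˡ-≤ _ (*-monoʳ-≤ (Λ + q + p) (+-monoʳ-≤ (y * Q * (F + 1)) (*-monoˡ-≤ F U≤2Q))) ⟩
      (Λ + q + p) * (y * Q * (F + 1) + 2 * Q * F) + ((Λ + q + p) * (2 * w) * (2 * Q * F) + (Λ * R * (y * F * x) + Λ * R * (F * F * x) + Λ * (R * R) * (w * (a * F) * x)) + 2 * (Λ * (R * w)) * (2 * Q * F) + Λ * x * e * F)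
        ≡⟨ expand₂ (Λ + q) p y Q F w (Λ * R * (y * F * x)) (Λ * R * (F * F * x)) (Λ * (R * R) * (w * (a * F) * x)) (Λ * (R * w)) (Λ * x * e * F) ⟩
      (Λ + q) * y * (Q * F) + (Λ * R * (y * F * x) + p * (y * (Q * F))) + S
        ≤⟨ +-monoʳ-≤ _ S≤ ⟩
      (Λ + q) * y * (Q * F) + (Λ * R * (y * F * x) + p * (y * (Q * F))) + p * (y * (Q * F))
        ≡⟨ expand₃ ((Λ + q) * y * (Q * F)) (Λ * R * (y * F * x)) p y x T F ⟩
      (Λ + q) * y * (Q * F) + (Λ * R * (y * F * x) + p * (2 * T) * (y * (x * F)))
        ≤⟨ +-mono-≤ (*-monoˡ-≤ (Q * F) gap) (+-monoʳ-≤ (Λ * R * (y * F * x)) (*-monoˡ-≤ (y * (x * F)) q≥)) ⟩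
      Λ * x * (Q * F) + (Λ * R * (y * F * x) + q * (y * (x * F)))
        ≡⟨ cong (Λ * x * (Q * F) +_) (expand₄ Λ R' y F x q) ⟩
      Λ * x * (Q * F) + ((Λ + q) * y + Λ * (R' * y)) * (x * F)
        ≤⟨ +-monoʳ-≤ (Λ * x * (Q * F)) (*-monoˡ-≤ (x * F) (+-monoˡ-≤ (Λ * (R' * y)) gap)) ⟩
      Λ * x * (Q * F) + (Λ * x + Λ * (R' * y)) * (x * F)
        ≡⟨ cong (λ z → Λ * x * (Q * F) + z * (x * F)) (trans (sym (*-distribˡ-+ Λ x (R' * y))) (cong (Λ *_) (sym Ge))) ⟩
      Λ * x * (Q * F) + (Λ * (G + e)) * (x * F)
        ≡⟨ expand₅ Λ x Q F G e ⟩
      Λ * x * (U * F) + Λ * x * e * F ∎))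
    where
    open ≤-Reasoning
    T-pos : 1 ≤ T
    T-pos = *-mono-≤ (*-mono-≤ 1≤g 1≤g) 1≤g
    F-pos : 1 ≤ F
    F-pos = *-mono-≤ (*-mono-≤ 1≤g 1≤g) T-pos
    UF-pos : 1 ≤ U * F
    UF-pos = *-mono-≤ (≤-trans (*-mono-≤ 1≤x T-pos) (m≤m+n Q G)) F-pos
    G≤Rx : G ≤ R * x
    G≤Rx = ≤-trans (m≤m+n G e) (≤-trans (≤-reflexive Ge) (+-monoʳ-≤ x (*-monoʳ-≤ R' y≤x)))
    U≤2Q : U ≤ 2 * Q
    U≤2Q = ≤-trans (+-monoʳ-≤ Q (≤-trans G≤Rx (≤-trans (*-monoˡ-≤ x R≤T) (≤-reflexive (*-comm T x))))) (≤-reflexive (twice Q))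
      where
      twice : ∀ k → k + k ≡ 2 * k
      twice = solve-∀
    expand₁ : ∀ Γ v w Λ Rw a U F z → (Γ * (v + 2 * w) + Λ * (Rw * (a + 2))) * (U * F) + z
      ≡ Γ * (v * (U * F)) + (Γ * (2 * w) * (U * F) + Λ * Rw * (a * F * U) + 2 * (Λ * Rw) * (U * F) + z)
    expand₁ = solve-∀
    main₁ : Λ * (R * w) * (a * F * U) ≤ Λ * R * (y * F * x) + Λ * R * (F * F * x) + Λ * (R * R) * (w * (a * F) * x)
    main₁ = begin
      Λ * (R * w) * (a * F * (Q + G))
        ≤⟨ *-monoʳ-≤ (Λ * (R * w)) (*-monoʳ-≤ (a * F) (+-monoʳ-≤ Q G≤Rx)) ⟩
      Λ * (R * w) * (a * F * (x * T + R * x))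
        ≡⟨ lem Λ R w a F x T ⟩
      Λ * R * (w * (a * T) * F * x) + Λ * (R * R) * (w * (a * F) * x)
        ≤⟨ +-monoˡ-≤ _ (*-monoʳ-≤ (Λ * R) (*-monoˡ-≤ x (*-monoˡ-≤ F wF₁))) ⟩
      Λ * R * ((y + F) * F * x) + Λ * (R * R) * (w * (a * F) * x)
        ≡⟨ cong (_+ Λ * (R * R) * (w * (a * F) * x)) (lem₂ (Λ * R) y F x) ⟩
      Λ * R * (y * F * x) + Λ * R * (F * F * x) + Λ * (R * R) * (w * (a * F) * x) ∎
      where
      lem : ∀ Λ R w a F x T → Λ * (R * w) * (a * F * (x * T + R * x)) ≡ Λ * R * (w * (a * T) * F * x) + Λ * (R * R) * (w * (a * F) * x)
      lem = solve-∀
      lem₂ : ∀ k y F x → k * ((y + F) * F * x) ≡ k * (y * F * x) + k * (F * F * x)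
      lem₂ = solve-∀
    -- All that is of lower order. Each of the six terms is a bounded multiple of `B`, divided by
    -- `g`; the lower bound on `g` is the sum of these multiples.
    S : ℕ
    S = (Λ + q + p) * (y * Q) + (Λ + q + p) * (2 * Q * F * (1 + 2 * w)) + Λ * R * (F * F * x) + Λ * (R * R) * (w * (a * F) * x) + 4 * (Λ * (R * w)) * (Q * F) + Λ * x * e * F
    expand₂ : ∀ Γ p y Q F w A B C D z →
      (Γ + p) * (y * Q * (F + 1) + 2 * Q * F) + ((Γ + p) * (2 * w) * (2 * Q * F) + (A + B + C) + 2 * D * (2 * Q * F) + z)
      ≡ Γ * y * (Q * F) + (A + p * (y * (Q * F)))
        + ((Γ + p) * (y * Q) + (Γ + p) * (2 * Q * F * (1 + 2 * w)) + B + C + 4 * D * (Q * F) + z)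
    expand₂ = solve-∀
    expand₃ : ∀ A B p y x T F → A + (B + p * (y * (x * T * F))) + p * (y * (x * T * F)) ≡ A + (B + p * (2 * T) * (y * (x * F)))
    expand₃ = solve-∀
    expand₄ : ∀ Λ R' y F x q → Λ * suc R' * (y * F * x) + q * (y * (x * F)) ≡ ((Λ + q) * y + Λ * (R' * y)) * (x * F)
    expand₄ = solve-∀
    expand₅ : ∀ Λ x Q F G e → Λ * x * (Q * F) + (Λ * (G + e)) * (x * F) ≡ Λ * x * ((Q + G) * F) + Λ * x * e * F
    expand₅ = solve-∀
    B : ℕ
    B = y * (Q * F)
    t₁ : g * ((Λ + q + p) * (y * Q)) ≤ 2 * c * B
    t₁ = begin
      g * ((Λ + q + p) * (y * Q))          ≤⟨ *-monoʳ-≤ g (*-monoˡ-≤ (y * Q) Γ≤) ⟩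
      g * (c * Λ * (y * Q))                ≡⟨ lem g c T y Q ⟩
      2 * c * (y * (Q * (g * g * T)))      ∎
      where
      lem : ∀ g c T y Q → g * (c * (2 * (g * T)) * (y * Q)) ≡ 2 * c * (y * (Q * (g * g * T)))
      lem = solve-∀
    t₂ : g * ((Λ + q + p) * (2 * Q * F * (1 + 2 * w))) ≤ 24 * c * B
    t₂ = begin
      g * ((Λ + q + p) * (2 * Q * F * (1 + 2 * w)))   ≤⟨ *-monoʳ-≤ g (*-mono-≤ Γ≤ (*-monoʳ-≤ (2 * Q * F) (+-monoˡ-≤ (2 * w) 1≤w))) ⟩
      g * (c * Λ * (2 * Q * F * (w + 2 * w)))         ≡⟨ lem g c T Q F w ⟩
      12 * c * (Q * F * (w * (g * g * T)))            ≤⟨ *-monoʳ-≤ (12 * c) (*-monoʳ-≤ (Q * F) wF₂) ⟩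
      12 * c * (Q * F * (2 * y))                      ≡⟨ lem₂ c (Q * F) y ⟩
      24 * c * B                                      ∎
      where
      lem : ∀ g c T Q F w → g * (c * (2 * (g * T)) * (2 * Q * F * (w + 2 * w))) ≡ 12 * c * (Q * F * (w * (g * g * T)))
      lem = solve-∀
      lem₂ : ∀ c k y → 12 * c * (k * (2 * y)) ≡ 24 * c * (y * k)
      lem₂ = solve-∀
    t₃ : g * (Λ * R * (F * F * x)) ≤ B
    t₃ = begin
      g * (Λ * R * (F * F * x))                       ≡⟨ lem g T R F x ⟩
      2 * (g * g) * (R * F) * (x * T * F)             ≤⟨ *-monoˡ-≤ (Q * F) big₁ ⟩
      B                                               ∎
      where
      lem : ∀ g T R F x → g * (2 * (g * T) * R * (F * F * x)) ≡ 2 * (g * g) * (R * F) * (x * T * F)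
      lem = solve-∀
    t₄ : g * (Λ * (R * R) * (w * (a * F) * x)) ≤ 4 * (R * R) * B
    t₄ = begin
      g * (Λ * (R * R) * (w * (a * F) * x))           ≡⟨ lem g T R w F x ⟩
      2 * (R * R) * (w * F * (x * T * (a * a)))       ≤⟨ *-monoʳ-≤ (2 * (R * R)) (*-mono-≤ wF₂ (*-monoʳ-≤ Q (*-monoʳ-≤ a a≤T))) ⟩
      2 * (R * R) * (2 * y * (Q * F))                 ≡⟨ lem₂ (R * R) y (Q * F) ⟩
      4 * (R * R) * B                                 ∎
      where
      a≤T : a ≤ T
      a≤T = ≤-trans (≤-reflexive (sym (*-identityʳ a))) (*-monoʳ-≤ a 1≤g)
      lem : ∀ g T R w F x → g * (2 * (g * T) * (R * R) * (w * (g * g * F) * x)) ≡ 2 * (R * R) * (w * F * (x * T * (g * g * (g * g))))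
      lem = solve-∀
      lem₂ : ∀ k y b → 2 * k * (2 * y * b) ≡ 4 * k * (y * b)
      lem₂ = solve-∀
    t₅ : g * (4 * (Λ * (R * w)) * (Q * F)) ≤ 16 * R * B
    t₅ = begin
      g * (4 * (Λ * (R * w)) * (Q * F))               ≡⟨ lem g T R w Q F ⟩
      8 * R * (w * (g * g * T) * (Q * F))             ≤⟨ *-monoʳ-≤ (8 * R) (*-monoˡ-≤ (Q * F) wF₂) ⟩
      8 * R * (2 * y * (Q * F))                       ≡⟨ lem₂ R y (Q * F) ⟩
      16 * R * B                                      ∎
      where
      lem : ∀ g T R w Q F → g * (4 * (2 * (g * T) * (R * w)) * (Q * F)) ≡ 8 * R * (w * (g * g * T) * (Q * F))
      lem = solve-∀
      lem₂ : ∀ R y b → 8 * R * (2 * y * b) ≡ 16 * R * (y * b)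
      lem₂ = solve-∀
    t₆ : g * (Λ * x * e * F) ≤ B
    t₆ = begin
      g * (Λ * x * e * F)                             ≡⟨ lem g T x e F ⟩
      2 * (g * g) * e * (x * T * F)                   ≤⟨ *-monoˡ-≤ (Q * F) big₂ ⟩
      B                                               ∎
      where
      lem : ∀ g T x e F → g * (2 * (g * T) * x * e * F) ≡ 2 * (g * g) * e * (x * T * F)
      lem = solve-∀
    S≤ : S ≤ p * B
    S≤ = ≤-trans (*-cancelˡ-≤ g {{>-nonZero 1≤g}} (begin
      g * S
        ≡⟨ lem g _ _ _ _ _ _ ⟩
      g * ((Λ + q + p) * (y * Q)) + g * ((Λ + q + p) * (2 * Q * F * (1 + 2 * w))) + g * (Λ * R * (F * F * x)) + g * (Λ * (R * R) * (w * (a * F) * x)) + g * (4 * (Λ * (R * w)) * (Q * F)) + g * (Λ * x * e * F)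
        ≤⟨ +-mono-≤ (+-mono-≤ (+-mono-≤ (+-mono-≤ (+-mono-≤ t₁ t₂) t₃) t₄) t₅) t₆ ⟩
      2 * c * B + 24 * c * B + B + 4 * (R * R) * B + 16 * R * B + B
        ≡⟨ lem₂ c B (R * R) R ⟩
      (26 * c + (2 + (4 * (R * R) + 16 * R))) * B
        ≤⟨ *-monoˡ-≤ B g≥ ⟩
      g * B ∎)) (≤-trans (≤-reflexive (sym (*-identityˡ B))) (*-monoˡ-≤ B 1≤p))
      where
      lem : ∀ g a b c d e f → g * (a + b + c + d + e + f) ≡ g * a + g * b + g * c + g * d + g * e + g * f
      lem = solve-∀
      lem₂ : ∀ c B k R → 2 * c * B + 24 * c * B + B + 4 * k * B + 16 * R * B + B ≡ (26 * c + (2 + (4 * k + 16 * R))) * B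
      lem₂ = solve-∀

-- With activation probability 1/T and relative error 1/F, an A-vertex loses about R * w * a edges, where w ≈ y / F;
-- y - v is the corresponding loss at a B-vertex.
module Choose (R' g κ x y : ℕ)
  (g-big : 1000 * (suc R' * suc R') ≤ g) (1≤κ : 1 ≤ κ)
  (y-big : κ * (g * g * (g * g * g) * (g * g * (g * g * g)) * (g * g * (g * g * g)) * (g * g * (g * g * g))) ≤ y)
  (y≤x : y ≤ x)
  (enough : 12 * (2 * (x * suc R') ^ 3 * (3 * (x * suc R') ^ 3)) ≤ 2 ^ g)
  where

  R a T F e G Q : ℕ
  R = suc R'
  a = g * g
  T = a * g
  F = a * T
  -- With `m = F * g` the moment order for survivors, `m * e` is exactly the overlap correction κ (m
  -- R) ^ 2 in `room`.
  e = κ * (F * g * (R * R))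
  G = (x + R' * y) ∸ e
  Q = x * T

  R≤R² : R ≤ R * R
  R≤R² = m≤m*n R R

  scaled : ∀ k → k ≤ 1000 → k * (R * R) ≤ g
  scaled k h = ≤-trans (*-monoˡ-≤ (R * R) h) g-big

  linear : ∀ k → k ≤ 1000 → k * R ≤ g
  linear k h = ≤-trans (*-monoʳ-≤ k R≤R²) (scaled k h)

  1≤g : 1 ≤ g
  1≤g = ≤-trans (s≤s z≤n) (scaled 1 (s≤s z≤n))

  instance
    g≢0 : NonZero g
    g≢0 = >-nonZero 1≤g

  g≤a : g ≤ a
  g≤a = m≤m*n g g

  a≤T : a ≤ T
  a≤T = m≤m*n a g

  T≤F : T ≤ F
  T≤F = m≤n*m T a {{m*n≢0 g g}}

  a≤F : a ≤ F
  a≤F = ≤-trans a≤T T≤F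

  g≤F : g ≤ F
  g≤F = ≤-trans g≤a a≤F

  1≤F : 1 ≤ F
  1≤F = ≤-trans 1≤g g≤F

  instance
    F≢0 : NonZero F
    F≢0 = >-nonZero 1≤F

  F³≤y : κ * (F * F * F) ≤ y
  F³≤y = ≤-trans (*-monoʳ-≤ κ (m≤m*n (F * F * F) F)) y-big

  F²≤y : κ * (F * F) ≤ y
  F²≤y = ≤-trans (*-monoʳ-≤ κ (m≤m*n (F * F) F)) F³≤y

  F³≤y' : F * F * F ≤ y
  F³≤y' = ≤-trans (m≤n*m (F * F * F) κ {{>-nonZero 1≤κ}}) F³≤y

  F≤y : F ≤ y
  F≤y = ≤-trans (≤-trans (m≤m*n F F) (m≤m*n (F * F) F)) F³≤y'

  1≤x : 1 ≤ x
  1≤x = ≤-trans 1≤F (≤-trans F≤y y≤x)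

  w : ℕ
  w = Division.ceil y F

  w-lower : y ≤ w * F
  w-lower = Division.ceil-lower y F

  w-upper : w * F ≤ y + F
  w-upper = Division.ceil-upper y F

  w-upper₂ : w * F ≤ 2 * y
  w-upper₂ = ≤-trans w-upper (≤-trans (+-monoʳ-≤ y F≤y) (≤-reflexive (twice y)))
    where
    twice : ∀ k → k + k ≡ 2 * k
    twice = solve-∀

  1≤w : 1 ≤ w
  1≤w = m≤n+m 1 (y / F)

  w-big : κ * (F * F * F) ≤ w
  w-big = *-cancelʳ-≤ _ _ F (≤-trans (≤-reflexive (*-assoc κ (F * F * F) F)) (≤-trans y-big w-lower))

  private
    lift² : ∀ k → k ≤ F * F → κ * k ≤ w
    lift² k h = ≤-trans (*-monoʳ-≤ κ (≤-trans h (m≤m*n (F * F) F))) w-big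

    gR²≤F : g * (R * R) ≤ F
    gR²≤F = ≤-trans (*-monoʳ-≤ g (≤-trans (≤-reflexive (sym (*-identityˡ (R * R)))) (scaled 1 (s≤s z≤n)))) a≤F

  R≤g : R ≤ g
  R≤g = ≤-trans (≤-reflexive (sym (*-identityˡ R))) (linear 1 (s≤s z≤n))

  R≤T : R ≤ T
  R≤T = ≤-trans R≤g (≤-trans g≤a a≤T)

  e≤x : e ≤ x
  e≤x = begin
    κ * (F * g * (R * R))      ≡⟨ cong (κ *_) (*-assoc F g (R * R)) ⟩
    κ * (F * (g * (R * R)))    ≤⟨ *-monoʳ-≤ κ (*-monoʳ-≤ F gR²≤F) ⟩
    κ * (F * F)                ≤⟨ F²≤y ⟩
    y                          ≤⟨ y≤x ⟩
    x                          ∎ where open ≤-Reasoning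

  G+e : G + e ≡ x + R' * y
  G+e = m∸n+n≡m (≤-trans e≤x (m≤m+n x _))

  private
    e-small : 2 * (g * g) * e ≤ y
    e-small = begin
      2 * (g * g) * (κ * (F * g * (R * R)))    ≡⟨ lem g κ F (R * R) ⟩
      κ * (g * g * F * (g * (2 * (R * R))))    ≤⟨ *-monoʳ-≤ κ (*-mono-≤ (*-monoˡ-≤ F a≤F) (≤-trans (*-monoʳ-≤ g (scaled 2 (m≤m+n 2 998))) a≤F)) ⟩
      κ * (F * F * F)                          ≤⟨ F³≤y ⟩
      y                                        ∎
      where
      open ≤-Reasoning
      lem : ∀ g κ F k → 2 * (g * g) * (κ * (F * g * k)) ≡ κ * (g * g * F * (g * (2 * k)))
      lem = solve-∀

    F-small : 2 * (g * g) * (R * F) ≤ y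
    F-small = begin
      2 * (g * g) * (R * F)     ≡⟨ lem g R F ⟩
      g * g * (2 * R) * F       ≤⟨ *-monoˡ-≤ F (*-mono-≤ a≤F (≤-trans (linear 2 (m≤m+n 2 998)) g≤F)) ⟩
      F * F * F                 ≤⟨ F³≤y' ⟩
      y                         ∎
      where
      open ≤-Reasoning
      lem : ∀ g R F → 2 * (g * g) * (R * F) ≡ g * g * (2 * R) * F
      lem = solve-∀

    lossSlack : T * (R * κ) ≤ w
    lossSlack = ≤-trans (≤-reflexive (lem T R κ)) (lift² (T * R) (*-mono-≤ T≤F (≤-trans R≤g g≤F)))
      where
      lem : ∀ T R κ → T * (R * κ) ≡ κ * (T * R)
      lem = solve-∀

    degreeSlack : F * g * (κ + R * κ) + g * (4 * (κ * (R * (2 * g)))) ≤ w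
    degreeSlack = begin
      F * g * (κ + R * κ) + g * (4 * (κ * (R * (2 * g))))    ≡⟨ lem F g κ R ⟩
      κ * (F * (g * (1 + R)) + 8 * R * (g * g))              ≤⟨ *-monoʳ-≤ κ (+-mono-≤ (*-monoʳ-≤ F (≤-trans (*-monoʳ-≤ g 1+R≤g) a≤F)) (*-mono-≤ (≤-trans (linear 8 (m≤m+n 8 992)) g≤F) a≤F)) ⟩
      κ * (F * F + F * F)                                    ≤⟨ *-monoʳ-≤ κ (≤-trans (≤-reflexive (lem₂ (F * F))) (*-monoʳ-≤ (F * F) 2≤F)) ⟩
      κ * (F * F * F)                                        ≤⟨ w-big ⟩
      w                                                      ∎
      where
      open ≤-Reasoning
      lem : ∀ F g κ R → F * g * (κ + R * κ) + g * (4 * (κ * (R * (2 * g)))) ≡ κ * (F * (g * (1 + R)) + 8 * R * (g * g))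
      lem = solve-∀
      lem₂ : ∀ k → k + k ≡ k * 2
      lem₂ = solve-∀
      1+R≤g : 1 + R ≤ g
      1+R≤g = ≤-trans (≤-trans (+-monoˡ-≤ R (s≤s z≤n)) (≤-reflexive (sym (cong (R +_) (+-identityʳ R))))) (linear 2 (m≤m+n 2 998))
      2≤F : 2 ≤ F
      2≤F = ≤-trans (*-monoʳ-≤ 2 (s≤s z≤n)) (≤-trans (linear 2 (m≤m+n 2 998)) g≤F)

  private
    instance
      T≢0 : NonZero T
      T≢0 = >-nonZero (≤-trans 1≤g (≤-trans g≤a a≤T))
      Q≢0 : NonZero Q
      Q≢0 = m*n≢0 x T {{>-nonZero 1≤x}}
      UF≢0 : NonZero ((Q + G) * F)
      UF≢0 = m*n≢0 (Q + G) F {{>-nonZero (≤-trans (>-nonZero⁻¹ Q) (m≤m+n Q G))}}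

  v : ℕ
  -- The bound y Q / (Q + G) for the expected number of survivors, enlarged by the factor 1 + 1/F
  -- and rounded up.
  v = Division.ceil (y * Q * (F + 1)) ((Q + G) * F)

  -- Each threshold is a main term plus the moment order times the clash bound, which `tail`
  -- subtracts again. The main term exceeds the expectation by a factor 1 + 1/j, with j = `a` for
  -- losses and j = `F` for survivors, so order `j * g` gives failure probability 2 ^ (-g) by
  -- `ratio`. For hits and conflicts the factor is at least 2 and order `g` suffices. `Q'` is kept
  -- apart from `Q` since the experiment has `x + W` in place of `x * T`.
  thresholds : ∀ Q' → Q' ≡ Q → Σ (Thresholds x y κ R Q') λ τ →
    Thresholds.θᵃ τ ≤ R * w * (a + 2) × Thresholds.θ¹ τ + Thresholds.θ² τ ≤ v + 2 * w
  thresholds Q' refl = record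
    { Z = 2 ^ g ; θᵃ = R * w * (a + 1) + T * (R * κ) ; θ¹ = v + F * g * (κ + R * κ) ; θ² = w + g * (4 * (κ * (R * (2 * g))))
    ; K = 2 * g ; G = G ; mᵃ = T ; mᴷ = g ; m¹ = F * g ; m² = g
    ; enough = enough
    ; posᵃ  = subst (0 <_) (sym baseᵃ) (*-mono-≤ (*-mono-≤ {1} {R} (s≤s z≤n) 1≤w) (m≤n+m 1 a))
    ; rareᵃ = subst (λ b → (x * R * y) ^ T * 2 ^ g ≤ b ^ T * Q ^ T) (sym baseᵃ)
                (≤-trans (ratio (x * R * y) (R * w * (a + 1) * Q) a g (≤-trans 1≤g g≤a) hᵃ) (≤-reflexive (^-distribʳ-* T (R * w * (a + 1)) Q)))
    ; posᴷ  = subst (0 <_) (sym baseᴷ) z<s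
    ; rareᴷ = subst (λ b → y ^ g * 2 ^ g ≤ b ^ g * Q ^ g) (sym baseᴷ)
                (≤-trans (≤-reflexive (sym (^-distribʳ-* g y 2))) (≤-trans (^-monoˡ-≤ g hᴷ) (≤-reflexive (^-distribʳ-* g (suc g) Q))))
    ; pos²  = subst (0 <_) (sym base²) 1≤w
    ; rare² = subst (λ b → (y * (x * R * y)) ^ g * 2 ^ g ≤ b ^ g * Q ^ (2 * g)) (sym base²)
                (≤-trans (≤-reflexive (sym (^-distribʳ-* g (y * (x * R * y)) 2))) (≤-trans (^-monoˡ-≤ g h²)
                  (≤-reflexive (trans (^-distribʳ-* g w (Q ^ 2)) (cong (w ^ g *_) (^-*-assoc Q 2 g))))))
    ; pos¹  = subst (0 <_) (sym base¹) (m≤n+m 1 _)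
    ; room  = ≤-reflexive (trans (lem-room (F * g) G κ R) (cong (F * g *_) G+e))
    ; rare¹ = subst (λ b → y ^ (F * g) * Q ^ (F * g) * 2 ^ g ≤ b ^ (F * g) * (Q + G) ^ (F * g)) (sym base¹)
                (≤-trans (≤-reflexive (cong (_* 2 ^ g) (sym (^-distribʳ-* (F * g) y Q))))
                  (≤-trans (ratio (y * Q) (v * (Q + G)) F g 1≤F h¹) (≤-reflexive (^-distribʳ-* (F * g) v (Q + G)))))
    } , lossBound , degreeBound
    where
    baseᵃ : R * w * (a + 1) + T * (R * κ) ∸ T * (R * κ) ≡ R * w * (a + 1)
    baseᵃ = m+n∸n≡m _ (T * (R * κ))
    baseᴷ : suc (2 * g) ∸ g * 1 ≡ suc g
    baseᴷ = trans (cong₂ _∸_ (lem g) (*-identityʳ g)) (m+n∸n≡m (suc g) g)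
      where
      lem : ∀ g → suc (2 * g) ≡ suc g + g
      lem = solve-∀
    base² : w + g * (4 * (κ * (R * (2 * g)))) ∸ g * (4 * (κ * (R * (2 * g)))) ≡ w
    base² = m+n∸n≡m w (g * (4 * (κ * (R * (2 * g)))))
    base¹ : v + F * g * (κ + R * κ) ∸ F * g * (κ + R * κ) ≡ v
    base¹ = m+n∸n≡m v (F * g * (κ + R * κ))
    open ≤-Reasoning
    hᵃ : x * R * y * suc a ≤ R * w * (a + 1) * Q * a
    hᵃ = begin
      x * R * y * suc a                  ≤⟨ *-monoˡ-≤ (suc a) (*-monoʳ-≤ (x * R) w-lower) ⟩
      x * R * (w * (a * T)) * suc a      ≡⟨ lem x R w a T ⟩
      R * w * (a + 1) * (x * T) * a      ∎
      where
      lem : ∀ x R w a T → x * R * (w * (a * T)) * suc a ≡ R * w * (a + 1) * (x * T) * a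
      lem = solve-∀
    hᴷ : y * 2 ≤ suc g * Q
    hᴷ = ≤-trans (≤-reflexive (*-comm y 2)) (*-mono-≤ (s≤s 1≤g) (≤-trans y≤x (m≤m*n x T)))
    h² : y * (x * R * y) * 2 ≤ w * Q ^ 2
    h² = begin
      y * (x * R * y) * 2                ≤⟨ *-monoˡ-≤ 2 (*-mono-≤ w-lower (*-monoʳ-≤ (x * R) y≤x)) ⟩
      w * F * (x * R * x) * 2            ≡⟨ lem₁ w F x R ⟩
      w * F * (x * x) * (2 * R)          ≤⟨ *-monoʳ-≤ (w * F * (x * x)) (linear 2 (m≤m+n 2 998)) ⟩
      w * (g * g * T) * (x * x) * g      ≡⟨ lem₂ w g T x ⟩
      w * (x * T * (x * (g * g * g) * 1)) ∎
      where
      lem₁ : ∀ w F x R → w * F * (x * R * x) * 2 ≡ w * F * (x * x) * (2 * R)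
      lem₁ = solve-∀
      lem₂ : ∀ w g T x → w * (g * g * T) * (x * x) * g ≡ w * (x * T * (x * (g * g * g) * 1))
      lem₂ = solve-∀
    h¹ : y * Q * suc F ≤ v * (Q + G) * F
    h¹ = ≤-trans (≤-reflexive (cong (y * Q *_) (sym (+-comm F 1)))) (≤-trans (Division.ceil-lower (y * Q * (F + 1)) ((Q + G) * F)) (≤-reflexive (sym (*-assoc v (Q + G) F))))
    lem-room : ∀ m G κ R → m * G + κ * (m * R * (m * R)) ≡ m * (G + κ * (m * (R * R)))
    lem-room = solve-∀
    lossBound : R * w * (a + 1) + T * (R * κ) ≤ R * w * (a + 2)
    lossBound = begin
      R * w * (a + 1) + T * (R * κ)      ≤⟨ +-monoʳ-≤ (R * w * (a + 1)) (≤-trans lossSlack (m≤n*m w R)) ⟩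
      R * w * (a + 1) + R * w            ≡⟨ lem (R * w) a ⟩
      R * w * (a + 2)                    ∎
      where
      lem : ∀ k a → k * (a + 1) + k ≡ k * (a + 2)
      lem = solve-∀
    degreeBound : v + F * g * (κ + R * κ) + (w + g * (4 * (κ * (R * (2 * g))))) ≤ v + 2 * w
    degreeBound = begin
      v + F * g * (κ + R * κ) + (w + g * (4 * (κ * (R * (2 * g)))))    ≡⟨ lem v (F * g * (κ + R * κ)) w (g * (4 * (κ * (R * (2 * g))))) ⟩
      v + w + (F * g * (κ + R * κ) + g * (4 * (κ * (R * (2 * g)))))    ≤⟨ +-monoʳ-≤ (v + w) degreeSlack ⟩
      v + w + w                                                        ≡⟨ lem₂ v w ⟩
      v + 2 * w                                                        ∎
      where
      lem : ∀ a b c d → a + b + (c + d) ≡ a + c + (b + d)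
      lem = solve-∀
      lem₂ : ∀ v w → v + w + w ≡ v + 2 * w
      lem₂ = solve-∀

  Λ : ℕ
  Λ = 2 * (g * T)

  gap : ∀ q p → Λ + q + p ≤ 35 * R * Λ → 1 ≤ p → p * (2 * T) ≤ q → (Λ + q) * y ≤ Λ * x →
        (Λ + q + p) * (v + 2 * w) + Λ * (R * w * (a + 2)) ≤ Λ * x
  gap q p Γ≤ 1≤p q≥ h = Gap.gap-step R' g κ x y w v G e q p (35 * R) 1≤g 1≤x 1≤w
    constant Γ≤ 1≤p q≥ h y≤x R≤T G+e w-upper w-upper₂ F-small e-small (Division.ceil-upper (y * Q * (F + 1)) ((Q + G) * F))
    where
    open ≤-Reasoning
    lem : ∀ k → 910 * k + (2 * k + (4 * k + 16 * k)) + 68 * k ≡ 1000 * k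
    lem = solve-∀
    lem₂ : ∀ R → 26 * (35 * R) ≡ 910 * R
    lem₂ = solve-∀
    constant : 26 * (35 * R) + (2 + (4 * (R * R) + 16 * R)) ≤ g
    constant = begin
      26 * (35 * R) + (2 + (4 * (R * R) + 16 * R))
        ≡⟨ cong (_+ (2 + (4 * (R * R) + 16 * R))) (lem₂ R) ⟩
      910 * R + (2 + (4 * (R * R) + 16 * R))
        ≤⟨ +-mono-≤ (*-monoʳ-≤ 910 R≤R²) (+-mono-≤ (*-monoʳ-≤ 2 (*-mono-≤ {1} {R} (s≤s z≤n) (s≤s z≤n))) (+-monoʳ-≤ (4 * (R * R)) (*-monoʳ-≤ 16 R≤R²))) ⟩
      910 * (R * R) + (2 * (R * R) + (4 * (R * R) + 16 * (R * R)))
        ≤⟨ m≤m+n _ (68 * (R * R)) ⟩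
      910 * (R * R) + (2 * (R * R) + (4 * (R * R) + 16 * (R * R))) + 68 * (R * R)
        ≡⟨ lem (R * R) ⟩
      1000 * (R * R)
        ≤⟨ g-big ⟩
      g ∎

  loss-bound : R * w * (a + 2) * T ≤ 4 * R * x
  loss-bound = begin
    R * w * (a + 2) * T             ≡⟨ lem₁ R w a T ⟩
    R * (w * (a * T) + w * (2 * T)) ≤⟨ *-monoʳ-≤ R (+-monoʳ-≤ (w * F) (*-monoʳ-≤ w (*-monoˡ-≤ T (≤-trans 2≤g g≤a)))) ⟩
    R * (w * F + w * F)             ≤⟨ *-monoʳ-≤ R (+-mono-≤ w-upper₂ w-upper₂) ⟩
    R * (2 * y + 2 * y)             ≤⟨ *-monoʳ-≤ R (+-mono-≤ (*-monoʳ-≤ 2 y≤x) (*-monoʳ-≤ 2 y≤x)) ⟩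
    R * (2 * x + 2 * x)             ≡⟨ lem₂ R x ⟩
    4 * R * x                       ∎
    where
    open ≤-Reasoning
    2≤g : 2 ≤ g
    2≤g = ≤-trans (*-monoʳ-≤ 2 (s≤s z≤n)) (linear 2 (m≤m+n 2 998))
    lem₁ : ∀ R w a T → R * w * (a + 2) * T ≡ R * (w * (a * T) + w * (2 * T))
    lem₁ = solve-∀
    lem₂ : ∀ R x → R * (2 * x + 2 * x) ≡ 4 * R * x
    lem₂ = solve-∀

weaken : ∀ {nB nA x y y' κ R} → y ≤ y' → System nB nA x y κ R → System nB nA x y' κ R
weaken h S = record { I = I ; uniform = uniform ; degree = λ b → ≤-trans (degree b) h ; codegree = codegree ; codegreeA = codegreeA }
  where open System S

module Iterate (R' g κ nB nA X₀ : ℕ)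
  (g-big : 1000 * (suc R' * suc R') ≤ g) (1≤κ : 1 ≤ κ)
  (enough : 12 * (2 * (X₀ * suc R') ^ 3 * (3 * (X₀ * suc R') ^ 3)) ≤ 2 ^ g)
  where

  R a T F Λ h Xₑ : ℕ
  R = suc R'
  a = g * g
  T = a * g
  F = a * T
  Λ = 2 * (g * T)
  h = 32 * R
  -- The last factor `g` pays for the ratio of `x` to `y`, which is at most about 35 R while
  -- nibbling, so that `y` remains as large as `Choose` demands.
  Xₑ = κ * (F * F * F * F) * g

  private
    linear : ∀ k → k ≤ 1000 → k * R ≤ g
    linear k k≤ = ≤-trans (*-monoˡ-≤ R k≤) (≤-trans (*-monoʳ-≤ 1000 (m≤m*n R R)) g-big)

    1≤g : 1 ≤ g
    1≤g = ≤-trans (s≤s z≤n) (linear 1 (s≤s z≤n))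

    instance
      g≢0 : NonZero g
      g≢0 = >-nonZero 1≤g
      T≢0 : NonZero T
      T≢0 = m*n≢0 a g {{m*n≢0 g g}}
      Λ≢0 : NonZero Λ
      Λ≢0 = m*n≢0 2 (g * T) {{_}} {{m*n≢0 g T}}

    g≤T : g ≤ T
    g≤T = m≤n*m g a {{m*n≢0 g g}}

    1≤Xₑ : 1 ≤ Xₑ
    1≤Xₑ = *-mono-≤ (*-mono-≤ 1≤κ (*-mono-≤ (*-mono-≤ (*-mono-≤ 1≤F 1≤F) 1≤F) 1≤F)) 1≤g
      where
      1≤F : 1 ≤ F
      1≤F = *-mono-≤ (*-mono-≤ 1≤g 1≤g) (≤-trans 1≤g g≤T)

  -- Here q / Λ is the guaranteed relative gap. The initial gap 1/g corresponds to q = 2 T, and the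
  -- factor `T` in `Λ` keeps the increments of q integral.
  Goal : ℕ → ℕ → Set
  Goal x q = ∀ y (S : System nB nA x y κ R) → (Λ + q) * y ≤ Λ * x → Matching S

  step : ∀ x q p → Xₑ ≤ x → x ≤ X₀ → Λ + q + p ≤ 35 * R * Λ → 1 ≤ p → p * (2 * T) ≤ q →
         (∀ x' → x' ≤ x → x * T ≤ x' * T + 4 * R * x → Goal x' (q + p)) → Goal x q
  step x q p x≥ x≤ Γ≤ 1≤p q≥ next y₀ S₀ gap₀ =
    proj₂ result (next x' (m∸n≤m x (θᵃ τ)) slow (θ¹ τ + θ² τ) (proj₁ result) gap')
    where
    open ≤-Reasoning
    open Thresholds using (θᵃ; θ¹; θ²)
    instance
      Γ≢0 : NonZero (Λ + q)
      Γ≢0 = >-nonZero (≤-trans (>-nonZero⁻¹ Λ) (m≤m+n Λ q))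
    y : ℕ
    -- The degree bound is raised to the largest one compatible with the gap: the thresholds require
    -- a large `y`, whereas `y₀` may be small.
    y = Λ * x / (Λ + q)
    gap : (Λ + q) * y ≤ Λ * x
    gap = ≤-trans (≤-reflexive (*-comm (Λ + q) y)) (m/n*n≤m (Λ * x) (Λ + q))
    y₀≤y : y₀ ≤ y
    y₀≤y = ≤-pred (*-cancelʳ-< (Λ + q) y₀ (suc y) (begin-strict
      y₀ * (Λ + q)                      ≡⟨ *-comm y₀ (Λ + q) ⟩
      (Λ + q) * y₀                      ≤⟨ gap₀ ⟩
      Λ * x                             ≡⟨ m≡m%n+[m/n]*n (Λ * x) (Λ + q) ⟩
      Λ * x % (Λ + q) + y * (Λ + q)     <⟨ +-monoˡ-< (y * (Λ + q)) (m%n<n (Λ * x) (Λ + q)) ⟩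
      suc y * (Λ + q)                   ∎))
    y≤x : y ≤ x
    y≤x = *-cancelˡ-≤ Λ (≤-trans (*-monoˡ-≤ y (m≤m+n Λ q)) gap)
    lem₁ : ∀ k R → 70 * R * k ≡ 35 * R * (k + k)
    lem₁ = solve-∀
    lem₂ : ∀ Λ R z → 35 * R * Λ * z ≡ Λ * (35 * R * z)
    lem₂ = solve-∀
    Y : ℕ
    Y = κ * (F * F * F * F)
    1≤Y : 1 ≤ Y
    1≤Y = proj₁ (*-pos Y g 1≤Xₑ)
    y-big : Y ≤ y
    y-big = +-cancelʳ-≤ 1 _ _ (≤-trans (+-monoʳ-≤ Y 1≤Y) (*-cancelˡ-≤ (35 * R) (*-cancelˡ-≤ Λ (begin
      Λ * (35 * R * (Y + Y))            ≡⟨ cong (Λ *_) (sym (lem₁ Y R)) ⟩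
      Λ * (70 * R * Y)                  ≤⟨ *-monoʳ-≤ Λ (*-monoˡ-≤ Y (linear 70 (m≤m+n 70 930))) ⟩
      Λ * (g * Y)                       ≡⟨ cong (Λ *_) (*-comm g Y) ⟩
      Λ * Xₑ                            ≤⟨ *-monoʳ-≤ Λ x≥ ⟩
      Λ * x                             ≤⟨ Division.ceil-lower (Λ * x) (Λ + q) ⟩
      (y + 1) * (Λ + q)                 ≤⟨ *-monoʳ-≤ (y + 1) (≤-trans (m≤m+n (Λ + q) p) Γ≤) ⟩
      (y + 1) * (35 * R * Λ)            ≡⟨ trans (*-comm (y + 1) (35 * R * Λ)) (lem₂ Λ R (y + 1)) ⟩
      Λ * (35 * R * (y + 1))            ∎))))
    enough' : 12 * (2 * (x * R) ^ 3 * (3 * (x * R) ^ 3)) ≤ 2 ^ g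
    enough' = ≤-trans (*-monoʳ-≤ 12 (*-mono-≤ (*-monoʳ-≤ 2 cube) (*-monoʳ-≤ 3 cube))) enough
      where
      cube : (x * R) ^ 3 ≤ (X₀ * R) ^ 3
      cube = ^-monoˡ-≤ 3 (*-monoˡ-≤ R x≤)
    module C = Choose R' g κ x y g-big 1≤κ y-big y≤x enough'
    W : ℕ
    -- This gives x + W = x T, that is, activation probability 1/T.
    W = x * (T ∸ 1)
    Q-eq : x + W ≡ x * T
    Q-eq = trans (cong (_+ W) (sym (*-identityʳ x))) (trans (sym (*-distribˡ-+ x 1 (T ∸ 1))) (cong (x *_) (m+[n∸m]≡n (>-nonZero⁻¹ T))))
    τ✓ = C.thresholds (x + W) Q-eq
    τ : Thresholds x y κ R (x + W)
    τ = proj₁ τ✓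
    total : (Λ + q + p) * (θ¹ τ + θ² τ) + Λ * θᵃ τ ≤ Λ * x
    total = ≤-trans (+-mono-≤ (*-monoʳ-≤ (Λ + q + p) (proj₂ (proj₂ τ✓))) (*-monoʳ-≤ Λ (proj₁ (proj₂ τ✓)))) (C.gap q p Γ≤ 1≤p q≥ gap)
    θᵃ≤x : θᵃ τ ≤ x
    θᵃ≤x = *-cancelˡ-≤ Λ (≤-trans (m≤n+m _ _) total)
    x' : ℕ
    x' = x ∸ θᵃ τ
    result = nibble (weaken y₀≤y S₀) W C.1≤x (s≤s z≤n) 1≤κ y≤x τ x' (θ¹ τ + θ² τ) (≤-reflexive (m∸n+n≡m θᵃ≤x)) ≤-refl
    gap' : (Λ + (q + p)) * (θ¹ τ + θ² τ) ≤ Λ * x'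
    gap' = +-cancelʳ-≤ (Λ * θᵃ τ) _ _ (begin
      (Λ + (q + p)) * (θ¹ τ + θ² τ) + Λ * θᵃ τ   ≡⟨ cong (λ z → z * (θ¹ τ + θ² τ) + Λ * θᵃ τ) (sym (+-assoc Λ q p)) ⟩
      (Λ + q + p) * (θ¹ τ + θ² τ) + Λ * θᵃ τ     ≤⟨ total ⟩
      Λ * x                                      ≡⟨ cong (Λ *_) (sym (m∸n+n≡m θᵃ≤x)) ⟩
      Λ * (x' + θᵃ τ)                            ≡⟨ *-distribˡ-+ Λ x' (θᵃ τ) ⟩
      Λ * x' + Λ * θᵃ τ                          ∎)
    slow : x * T ≤ x' * T + 4 * R * x
    slow = begin
      x * T                        ≡⟨ cong (_* T) (sym (m∸n+n≡m θᵃ≤x)) ⟩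
      (x' + θᵃ τ) * T              ≡⟨ *-distribʳ-+ T x' (θᵃ τ) ⟩
      x' * T + θᵃ τ * T            ≤⟨ +-monoʳ-≤ (x' * T) (≤-trans (*-monoˡ-≤ T (proj₁ (proj₂ τ✓))) C.loss-bound) ⟩
      x' * T + 4 * R * x           ∎

  private
    -- The potential n ^ h * x does not decrease from one nibble to the next: `x` keeps at least the
    -- fraction 1 - 4R/T, while (1 + 1/n) ^ h ≥ 1 + h/n. The exponent h = 32 R suffices because n ≤
    -- 4 T ≤ 8 (T - 4R).
    slow-decay : ∀ n x x' → .{{NonZero n}} → n ≤ 4 * T → x * T ≤ x' * T + 4 * R * x → n ^ h * x ≤ suc n ^ h * x'
    slow-decay n x x' n≤ slow = *-cancelʳ-≤ _ _ (n * T) {{m*n≢0 n T}} (begin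
      n ^ h * x * (n * T)                  ≡⟨ lem₁ (n ^ h) x n T ⟩
      n ^ h * (n * T * x)                  ≤⟨ *-monoʳ-≤ (n ^ h) (*-monoˡ-≤ x trade) ⟩
      n ^ h * ((n + h) * t * x)            ≡⟨ lem₂ (n ^ h) (n + h) t x ⟩
      n ^ h * (n + h) * (x * t)            ≤⟨ *-mono-≤ (bernoulli n h) xt ⟩
      suc n ^ h * n * (x' * T)             ≡⟨ lem₃ (suc n ^ h) n x' T ⟩
      suc n ^ h * x' * (n * T)             ∎)
      where
      open ≤-Reasoning
      t : ℕ
      t = T ∸ 4 * R
      8R≤T : 8 * R ≤ T
      8R≤T = ≤-trans (linear 8 (m≤m+n 8 992)) g≤T
      4R+t : 4 * R + t ≡ T
      4R+t = m+[n∸m]≡n (≤-trans (*-monoˡ-≤ R (m≤m+n 4 4)) 8R≤T)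
      lem₁ : ∀ a x n T → a * x * (n * T) ≡ a * (n * T * x)
      lem₁ = solve-∀
      lem₂ : ∀ a b t x → a * (b * t * x) ≡ a * b * (x * t)
      lem₂ = solve-∀
      lem₃ : ∀ a n x T → a * n * (x * T) ≡ a * x * (n * T)
      lem₃ = solve-∀
      xt : x * t ≤ x' * T
      xt = +-cancelʳ-≤ (4 * R * x) _ _ (≤-trans (≤-reflexive (trans (lem x t (4 * R)) (cong (x *_) 4R+t))) slow)
        where
        lem : ∀ x t r → x * t + r * x ≡ x * (r + t)
        lem = solve-∀
      n≤8t : n ≤ 8 * t
      n≤8t = ≤-trans n≤ (≤-trans (≤-reflexive (cong (4 *_) (sym 4R+t))) (begin
        4 * (4 * R + t)         ≡⟨ lem R t ⟩
        4 * (4 * R) + 4 * t     ≤⟨ +-monoˡ-≤ (4 * t) (*-monoʳ-≤ 4 4R≤t) ⟩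
        4 * t + 4 * t           ≡⟨ lem₄ t ⟩
        8 * t                   ∎))
        where
        lem : ∀ R t → 4 * (4 * R + t) ≡ 4 * (4 * R) + 4 * t
        lem = solve-∀
        lem₄ : ∀ t → 4 * t + 4 * t ≡ 8 * t
        lem₄ = solve-∀
        lem₅ : ∀ R → 8 * R ≡ 4 * R + 4 * R
        lem₅ = solve-∀
        4R≤t : 4 * R ≤ t
        4R≤t = +-cancelˡ-≤ (4 * R) _ _ (≤-trans (≤-reflexive (sym (lem₅ R))) (≤-trans 8R≤T (≤-reflexive (sym 4R+t))))
      trade : n * T ≤ (n + h) * t
      trade = begin
        n * T                    ≡⟨ cong (n *_) (sym 4R+t) ⟩
        n * (4 * R + t)          ≡⟨ lem n R t ⟩
        n * t + 4 * R * n        ≤⟨ +-monoʳ-≤ (n * t) (*-monoʳ-≤ (4 * R) n≤8t) ⟩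
        n * t + 4 * R * (8 * t)  ≡⟨ lem₄ n R t ⟩
        (n + 32 * R) * t         ∎
        where
        lem : ∀ n R t → n * (4 * R + t) ≡ n * t + 4 * R * n
        lem = solve-∀
        lem₄ : ∀ n R t → n * t + 4 * R * (8 * t) ≡ (n + 32 * R) * t
        lem₄ = solve-∀

    halved : ∀ X' x n → n ≤ 4 * T → (2 * T) ^ h * (2 ^ h * X') ≤ n ^ h * x → X' ≤ x
    halved X' x n n≤ le = *-cancelˡ-≤ ((4 * T) ^ h) {{m^n≢0 (4 * T) h {{m*n≢0 4 T}}}} (begin
      (4 * T) ^ h * X'               ≡⟨ cong (λ z → z ^ h * X') (lem T) ⟩
      (2 * T * 2) ^ h * X'           ≡⟨ cong (_* X') (^-distribʳ-* h (2 * T) 2) ⟩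
      (2 * T) ^ h * 2 ^ h * X'       ≡⟨ *-assoc ((2 * T) ^ h) _ X' ⟩
      (2 * T) ^ h * (2 ^ h * X')     ≤⟨ le ⟩
      n ^ h * x                      ≤⟨ *-monoˡ-≤ x (^-monoˡ-≤ h n≤) ⟩
      (4 * T) ^ h * x                ∎)
      where
      open ≤-Reasoning
      lem : ∀ T → 4 * T ≡ 2 * T * 2
      lem = solve-∀

  -- q runs from p * 2T to p * 4T, so the relative gap q / Λ doubles; x loses at most a factor 2 ^ h.
  doubling : ∀ p X' → 1 ≤ p → p ≤ 16 * R * g → Xₑ ≤ X' →
             (∀ x → X' ≤ x → x ≤ X₀ → Goal x (2 * p * (2 * T))) →
             ∀ f i → i + f ≡ 2 * T → ∀ x → (2 * T) ^ h * (2 ^ h * X') ≤ (2 * T + i) ^ h * x → x ≤ X₀ →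
             Goal x (p * (2 * T + i))
  doubling p X' 1≤p p≤ X'≥ rest zero i e x le x≤ y S gap =
    rest x (halved X' x (2 * T + i) n≤ le) x≤ y S (≤-trans (≤-reflexive (cong (λ z → (Λ + z) * y) (trans (lem₂ p T) (cong (λ z → p * (2 * T + z)) (sym i≡))))) gap)
    where
    i≡ : i ≡ 2 * T
    i≡ = trans (sym (+-identityʳ i)) e
    lem : ∀ T → 2 * T + 2 * T ≡ 4 * T
    lem = solve-∀
    lem₂ : ∀ p T → 2 * p * (2 * T) ≡ p * (2 * T + 2 * T)
    lem₂ = solve-∀
    n≤ : 2 * T + i ≤ 4 * T
    n≤ = ≤-reflexive (trans (cong (2 * T +_) i≡) (lem T))
  doubling p X' 1≤p p≤ X'≥ rest (suc f) i e x le x≤ =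
    step x (p * (2 * T + i)) p (≤-trans X'≥ (halved X' x (2 * T + i) n≤ le)) x≤ Γ≤ 1≤p (*-monoʳ-≤ p (m≤m+n (2 * T) i))
      λ x' x'≤ slow → subst (Goal x') (lem p (2 * T) i)
        (doubling p X' 1≤p p≤ X'≥ rest f (suc i) (trans (sym (+-suc i f)) e) x'
          (≤-trans le (≤-trans (slow-decay (2 * T + i) x x' {{>-nonZero (≤-trans (>-nonZero⁻¹ T) (≤-trans (m≤m+n T _) (m≤m+n (2 * T) i)))}} n≤ slow)
            (≤-reflexive (cong (λ z → z ^ h * x') (sym (+-suc (2 * T) i)))))) (≤-trans x'≤ x≤))
    where
    open ≤-Reasoning
    lem : ∀ p t i → p * (t + suc i) ≡ p * (t + i) + p
    lem = solve-∀
    lem₄ : ∀ T → 2 * T + 2 * T ≡ 4 * T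
    lem₄ = solve-∀
    n≤ : 2 * T + i ≤ 4 * T
    n≤ = ≤-trans (+-monoʳ-≤ (2 * T) (≤-trans (m≤m+n i (suc f)) (≤-reflexive e))) (≤-reflexive (lem₄ T))
    lem₅ : ∀ R g T → 16 * R * g * (4 * T) ≡ 32 * R * (2 * (g * T))
    lem₅ = solve-∀
    lem₆ : ∀ Λ R → R * Λ + 32 * R * Λ + 2 * R * Λ ≡ 35 * R * Λ
    lem₆ = solve-∀
    lem₇ : ∀ R g → 16 * R * g ≡ 2 * R * (8 * g)
    lem₇ = solve-∀
    lem₈ : ∀ g T → g * (2 * T) ≡ 2 * (g * T)
    lem₈ = solve-∀
    8g≤Λ : 8 * g ≤ Λ
    8g≤Λ = ≤-trans (≤-reflexive (*-comm 8 g)) (≤-trans (*-monoʳ-≤ g (≤-trans (≤-trans (*-monoʳ-≤ 8 (s≤s z≤n)) (linear 8 (m≤m+n 8 992))) (≤-trans g≤T (m≤m+n T _)))) (≤-reflexive (lem₈ g T)))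
    -- With p ≤ 16 R g and 2 T + i ≤ 4 T the gap term is at most 32 R Λ; 35 leaves room for Λ itself
    -- and for the increment.
    Γ≤ : Λ + p * (2 * T + i) + p ≤ 35 * R * Λ
    Γ≤ = begin
      Λ + p * (2 * T + i) + p
        ≤⟨ +-mono-≤ (+-mono-≤ (m≤n*m Λ R) (≤-trans (*-mono-≤ p≤ n≤) (≤-reflexive (lem₅ R g T)))) (≤-trans p≤ (≤-trans (≤-reflexive (lem₇ R g)) (*-monoʳ-≤ (2 * R) 8g≤Λ))) ⟩
      R * Λ + 32 * R * Λ + 2 * R * Λ
        ≡⟨ lem₆ Λ R ⟩
      35 * R * Λ ∎

  private
    -- For q = p * (2 * T) the relative gap q / Λ is p / g, so p ≥ 16 R g means a gap of at least 16
    -- R, enough for `finish`.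
    spread : ∀ p x → Xₑ ≤ x → 16 * R * g ≤ p → Goal x (p * (2 * T))
    spread p x x≥ p≥ y S gap = finish-at y S wide
      where
      open ≤-Reasoning
      lem : ∀ R g T y → 2 * (g * T) * (16 * (R * y)) ≡ 16 * R * g * (2 * T) * y
      lem = solve-∀
      wide : 16 * (R * y) ≤ x
      wide = *-cancelˡ-≤ Λ (begin
        Λ * (16 * (R * y))             ≡⟨ lem R g T y ⟩
        16 * R * g * (2 * T) * y       ≤⟨ *-monoˡ-≤ y (≤-trans (*-monoˡ-≤ (2 * T) p≥) (m≤n+m _ Λ)) ⟩
        (Λ + p * (2 * T)) * y          ≤⟨ gap ⟩
        Λ * x                          ∎)
      1≤x : 1 ≤ x
      1≤x = ≤-trans 1≤Xₑ x≥
      finish-at : ∀ y (S : System nB nA x y κ R) → 16 * (R * y) ≤ x → Matching S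
      finish-at (suc y) S w = finish S 1≤x (s≤s z≤n) 1≤κ (s≤s z≤n) w
      -- `finish` works with a positive degree bound, so 0 is raised to 1; here `Xₑ ≤ x` takes the
      -- place of the gap.
      finish-at zero    S w = finish (weaken z≤n S) 1≤x (s≤s z≤n) 1≤κ (s≤s z≤n) (begin
        16 * (R * 1)          ≡⟨ cong (16 *_) (*-identityʳ R) ⟩
        16 * R                ≤⟨ linear 16 (m≤m+n 16 984) ⟩
        g                     ≤⟨ m≤n*m g (κ * (F * F * F * F)) {{>-nonZero (proj₁ (*-pos _ g 1≤Xₑ))}} ⟩
        Xₑ                    ≤⟨ x≥ ⟩
        x                     ∎)

  -- One phase doubles `p` and costs `x` at most a factor 2 ^ h. With 2 ^ n of order g the phases
  -- together cost only a fixed power of g.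
  phases : ∀ n p → 1 ≤ p → 16 * R * g ≤ p * 2 ^ n → ∀ x → Xₑ * (2 ^ h) ^ n ≤ x → x ≤ X₀ → Goal x (p * (2 * T))
  phases zero    p 1≤p p≥ x x≥ x≤ = spread p x (≤-trans (≤-reflexive (sym (*-identityʳ Xₑ))) x≥) (≤-trans p≥ (≤-reflexive (*-identityʳ p)))
  -- Stopping once the gap is wide ensures p < 16 R g whenever a further doubling is started.
  phases (suc n) p 1≤p p≥ x x≥ x≤ with 16 * R * g ≤? p
  ... | yes big = spread p x (≤-trans (m≤m*n Xₑ _ {{m^n≢0 (2 ^ h) (suc n) {{m^n≢0 2 h}}}}) x≥) big
  ... | no small = subst (λ z → Goal x (p * z)) (+-identityʳ (2 * T))
        (doubling p (Xₑ * (2 ^ h) ^ n) 1≤p (<⇒≤ (≰⇒> small)) (m≤m*n Xₑ _ {{m^n≢0 (2 ^ h) n {{m^n≢0 2 h}}}})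
          (λ x' x'≥ x'≤ → phases n (2 * p) (≤-trans 1≤p (m≤m+n p _)) (≤-trans p≥ (≤-reflexive (lem p (2 ^ n)))) x' x'≥ x'≤)
          (2 * T) 0 refl x (≤-trans (≤-reflexive (cong ((2 * T) ^ h *_) (lem₂ (2 ^ h) Xₑ ((2 ^ h) ^ n))))
            (*-mono-≤ (≤-reflexive (cong (_^ h) (sym (+-identityʳ (2 * T))))) x≥)) x≤)
    where
    lem : ∀ p k → p * (2 * k) ≡ 2 * p * k
    lem = solve-∀
    lem₂ : ∀ k X m → k * (X * m) ≡ X * (k * m)
    lem₂ = solve-∀

  matching : ∀ n → 16 * R * g ≤ 2 ^ n → ∀ x → Xₑ * (2 ^ h) ^ n ≤ x → x ≤ X₀ →
             ∀ y (S : System nB nA x y κ R) → (g + 1) * y ≤ g * x → Matching S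
  matching n n≥ x x≥ x≤ y S gap = phases n 1 ≤-refl (≤-trans n≥ (≤-reflexive (sym (*-identityˡ (2 ^ n))))) x x≥ x≤ y S (begin
    (Λ + 1 * (2 * T)) * y        ≡⟨ lem g T y ⟩
    2 * T * ((g + 1) * y)        ≤⟨ *-monoʳ-≤ (2 * T) gap ⟩
    2 * T * (g * x)              ≡⟨ lem₂ g T x ⟩
    Λ * x                        ∎)
    where
    open ≤-Reasoning
    lem : ∀ g T y → (2 * (g * T) + 1 * (2 * T)) * y ≡ 2 * T * ((g + 1) * y)
    lem = solve-∀
    lem₂ : ∀ g T x → 2 * T * (g * x) ≡ 2 * (g * T) * x
    lem₂ = solve-∀

-- Integer roots and exponential growth

root : ∀ c → 1 ≤ c → ∀ D → Σ ℕ λ g → g ^ c ≤ D × D < suc g ^ c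
root c@(suc _) 1≤c zero    = 0 , z≤n , ≤-trans (s≤s z≤n) (≤-reflexive (sym (^-zeroˡ c)))
root c         1≤c (suc D) with root c 1≤c D
... | g , lo , hi with suc g ^ c ≤? suc D
...   | yes h = suc g , h , ≤-<-trans hi (^-monoˡ-< c {{>-nonZero 1≤c}} (n<1+n (suc g)))
...   | no  h = g , ≤-trans lo (n≤1+n D) , ≰⇒> h

1+n≤2^n : ∀ n → suc n ≤ 2 ^ n
1+n≤2^n zero    = ≤-refl
1+n≤2^n (suc n) = ≤-trans (+-mono-≤ (m^n>0 2 n) (1+n≤2^n n)) (≤-reflexive (cong (2 ^ n +_) (sym (+-identityʳ (2 ^ n)))))

-- With t the quotient of g by 2 k, g is at most (t + 1) * (2 * k), hence at most 2 ^ (t + 2 k). In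
-- the k-th power the parts t k and 2 k ^ 2 of the exponent are at most g/2 each.
poly≤exp : ∀ k g → 1 ≤ k → 4 * (k * k) ≤ g → g ^ k ≤ 2 ^ g
poly≤exp k g 1≤k h = begin
  g ^ k                              ≤⟨ ^-monoˡ-≤ k (begin
      g                                  ≤⟨ Division.ceil-lower g (2 * k) ⟩
      (t + 1) * (2 * k)                  ≤⟨ *-mono-≤ (≤-trans (≤-reflexive (+-comm t 1)) (1+n≤2^n t)) (≤-trans (n≤1+n (2 * k)) (1+n≤2^n (2 * k))) ⟩
      2 ^ t * 2 ^ (2 * k)                ≡⟨ sym (^-distribˡ-+-* 2 t (2 * k)) ⟩
      2 ^ (t + 2 * k)                    ∎) ⟩
  (2 ^ (t + 2 * k)) ^ k              ≡⟨ ^-*-assoc 2 (t + 2 * k) k ⟩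
  2 ^ ((t + 2 * k) * k)              ≤⟨ ^-monoʳ-≤ 2 {(t + 2 * k) * k} {g} (*-cancelˡ-≤ 2 (begin
      2 * ((t + 2 * k) * k)              ≡⟨ lem t k ⟩
      t * (2 * k) + 4 * (k * k)          ≤⟨ +-mono-≤ (m/n*n≤m g (2 * k)) h ⟩
      g + g                              ≡⟨ cong (g +_) (sym (+-identityʳ g)) ⟩
      2 * g                              ∎)) ⟩
  2 ^ g                              ∎
  where
  open ≤-Reasoning
  instance
    2k≢0 : NonZero (2 * k)
    2k≢0 = m*n≢0 2 k {{_}} {{>-nonZero 1≤k}}
  t : ℕ
  t = g / (2 * k)
  lem : ∀ t k → 2 * ((t + 2 * k) * k) ≡ t * (2 * k) + 4 * (k * k)
  lem = solve-∀

power-of-two : ∀ m → 1 ≤ m → Σ ℕ λ n → m ≤ 2 ^ n × 2 ^ n ≤ 2 * m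
power-of-two (suc zero)    _ = 0 , ≤-refl , s≤s z≤n
power-of-two (suc (suc m)) _ with power-of-two (suc m) (s≤s z≤n)
... | n , lo , hi with suc (suc m) ≤? 2 ^ n
...   | yes h = n , h , ≤-trans hi (*-monoʳ-≤ 2 (n≤1+n (suc m)))
...   | no  h = suc n , ≤-trans (+-mono-≤ {1} (m^n>0 2 n) lo) (≤-reflexive (cong (2 ^ n +_) (sym (+-identityʳ (2 ^ n))))) , *-monoʳ-≤ 2 (<⇒≤ (≰⇒> h))

-- Cyclic intervals of cliques

<ᵇ-true : ∀ {m n} → m < n → (m <ᵇ n) ≡ true
<ᵇ-true h = true-≤ᵇ h

<ᵇ-false : ∀ {m n} → n ≤ m → (m <ᵇ n) ≡ false
<ᵇ-false {m} {n} h with m <ᵇ n in e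
... | false = refl
... | true  = ⊥-elim (<-irrefl refl (<-≤-trans (≤ᵇ-true {suc m} e) h))

-- The cyclic interval of length r ending at p in ℤ/k, for r ≤ k.
window : ∀ k → ℕ → Fin k → Fin k → Bool
window k r p q = ((toℕ q <ᵇ suc (toℕ p)) ∧ (toℕ p <ᵇ toℕ q + r)) ∨ (toℕ p + k <ᵇ toℕ q + r)

private
  -- Initial segments are what `∑-<-⊓` can count. This identity and the next two express the parts
  -- of a window through initial segments, with the subtracted segment moved to the other side.
  interval : ∀ p q r → 𝟙 ((q <ᵇ suc p) ∧ (p <ᵇ q + r)) + 𝟙 (q <ᵇ suc p ∸ r) ≡ 𝟙 (q <ᵇ suc p)
  interval p q r with q ≤? p | p <? q + r
  ... | yes h | yes h' rewrite <ᵇ-true (s≤s h) | <ᵇ-true h' | <ᵇ-false {q} {suc p ∸ r} (≤-trans (∸-monoˡ-≤ r h') (≤-reflexive (m+n∸n≡m q r))) = refl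
  ... | yes h | no h'  rewrite <ᵇ-true (s≤s h) | <ᵇ-false (≮⇒≥ h') | <ᵇ-true {q} {suc p ∸ r} (m+n≤o⇒m≤o∸n (suc q) (s≤s (≮⇒≥ h'))) = refl
  ... | no h  | _ rewrite <ᵇ-false {q} {suc p} (≰⇒> h) | <ᵇ-false {q} {suc p ∸ r} (≤-trans (m∸n≤m (suc p) r) (≰⇒> h)) = refl

  interval' : ∀ p q r → 𝟙 ((q <ᵇ suc p) ∧ (p <ᵇ q + r)) + 𝟙 (p <ᵇ q) ≡ 𝟙 (p <ᵇ q + r)
  interval' p q r with q ≤? p
  ... | yes h rewrite <ᵇ-true (s≤s h) | <ᵇ-false h = +-identityʳ _
  ... | no h rewrite <ᵇ-false {q} {suc p} (≰⇒> h) | <ᵇ-true (≰⇒> h) | <ᵇ-true {p} {q + r} (≤-trans (≰⇒> h) (m≤m+n q r)) = refl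

  complement : ∀ s q r → 𝟙 (s <ᵇ q + r) + 𝟙 (q <ᵇ suc s ∸ r) ≡ 1
  complement s q r with s <? q + r
  ... | yes h rewrite <ᵇ-true h | <ᵇ-false {q} {suc s ∸ r} (≤-trans (∸-monoˡ-≤ r h) (≤-reflexive (m+n∸n≡m q r))) = refl
  ... | no h  rewrite <ᵇ-false (≮⇒≥ h) | <ᵇ-true {q} {suc s ∸ r} (m+n≤o⇒m≤o∸n (suc q) (s≤s (≮⇒≥ h))) = refl

  split-window : ∀ k r p q → r ≤ k → 𝟙 (window k r p q) ≡ 𝟙 ((toℕ q <ᵇ suc (toℕ p)) ∧ (toℕ p <ᵇ toℕ q + r)) + 𝟙 (toℕ p + k <ᵇ toℕ q + r)
  split-window k r p q h with toℕ q ≤? toℕ p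
  ... | no h' rewrite <ᵇ-false {toℕ q} {suc (toℕ p)} (≰⇒> h') = refl
  ... | yes h' rewrite <ᵇ-true (s≤s h') | <ᵇ-false {toℕ p + k} {toℕ q + r} (+-mono-≤ h' h) with toℕ p <ᵇ toℕ q + r
  ...   | true  = refl
  ...   | false = refl

window-row : ∀ k r → r ≤ k → ∀ p → ∑ (fins k) (λ q → 𝟙 (window k r p q)) ≡ r
window-row k r r≤k p = +-cancelʳ-≡ (C + D) _ _ (begin
  ∑ (fins k) (λ q → 𝟙 (window k r p q)) + (C + D)
    ≡⟨ cong (_+ (C + D)) (trans (∑-cong (fins k) (λ q → split-window k r p q r≤k)) (∑-+ (fins k) _ _)) ⟩
  A + B + (C + D)
    ≡⟨ shuffle A B C D ⟩
  (A + C) + (B + D)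
    ≡⟨ cong₂ _+_ (trans (sym (∑-+ (fins k) _ _)) (trans (∑-cong (fins k) (λ q → interval (toℕ p) (toℕ q) r)) (∑-<-⊓ k (suc (toℕ p)))))
                 (trans (sym (∑-+ (fins k) _ _)) (trans (∑-cong (fins k) (λ q → complement (toℕ p + k) (toℕ q) r)) (trans (∑-const-fins k 1) (*-identityʳ k)))) ⟩
  k ⊓ suc (toℕ p) + k
    ≡⟨ cong (_+ k) (m≥n⇒m⊓n≡n (F.toℕ<n p)) ⟩
  suc (toℕ p) + k
    ≡⟨ total ⟩
  r + (C + D) ∎)
  where
  open ≡-Reasoning
  A B C D : ℕ
  A = ∑ (fins k) (λ q → 𝟙 ((toℕ q <ᵇ suc (toℕ p)) ∧ (toℕ p <ᵇ toℕ q + r)))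
  B = ∑ (fins k) (λ q → 𝟙 (toℕ p + k <ᵇ toℕ q + r))
  C = ∑ (fins k) (λ q → 𝟙 (toℕ q <ᵇ suc (toℕ p) ∸ r))
  D = ∑ (fins k) (λ q → 𝟙 (toℕ q <ᵇ suc (toℕ p + k) ∸ r))
  shuffle : ∀ a b c d → a + b + (c + d) ≡ (a + c) + (b + d)
  shuffle = solve-∀
  C≡ : C ≡ suc (toℕ p) ∸ r
  C≡ = trans (∑-<-⊓ k _) (m≥n⇒m⊓n≡n (≤-trans (m∸n≤m (suc (toℕ p)) r) (F.toℕ<n p)))
  D≡ : D ≡ k ⊓ (suc (toℕ p + k) ∸ r)
  D≡ = ∑-<-⊓ k _
  shuffle₂ : ∀ a b c → a + b + c ≡ b + (a + c)
  shuffle₂ = solve-∀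
  total : suc (toℕ p) + k ≡ r + (C + D)
  -- The window ending at `p` wraps around exactly when r exceeds p + 1.
  total with r ≤? suc (toℕ p)
  ... | yes h = begin
    suc (toℕ p) + k                              ≡⟨ cong (_+ k) (sym (m∸n+n≡m h)) ⟩
    suc (toℕ p) ∸ r + r + k                      ≡⟨ shuffle₂ (suc (toℕ p) ∸ r) r k ⟩
    r + (suc (toℕ p) ∸ r + k)                    ≡⟨ cong (r +_) (cong₂ _+_ (sym C≡) (sym (trans D≡ (m≤n⇒m⊓n≡m (m+n≤o⇒m≤o∸n k (≤-trans (+-monoʳ-≤ k h) (≤-reflexive (+-comm k (suc (toℕ p)))))))))) ⟩
    r + (C + D)                                  ∎
  ... | no h = begin
    suc (toℕ p + k)                              ≡⟨ sym (m+[n∸m]≡n (≤-trans r≤k (≤-trans (m≤n+m k (suc (toℕ p))) ≤-refl))) ⟩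
    r + (suc (toℕ p + k) ∸ r)                    ≡⟨ cong (r +_) (cong₂ _+_ (sym (trans C≡ (m≤n⇒m∸n≡0 (<⇒≤ (≰⇒> h))))) (sym (trans D≡ (m≥n⇒m⊓n≡n small)))) ⟩
    r + (C + D)                                  ∎
    where
    small : suc (toℕ p + k) ∸ r ≤ k
    small = m≤n+o⇒m∸n≤o (suc (toℕ p + k)) r (+-monoˡ-≤ k (<⇒≤ (≰⇒> h)))

window-column : ∀ k r → r ≤ k → ∀ q → ∑ (fins k) (λ p → 𝟙 (window k r p q)) ≤ r
window-column k r r≤k q = +-cancelʳ-≤ C _ _ (begin
  ∑ (fins k) (λ p → 𝟙 (window k r p q)) + C
    ≡⟨ cong (_+ C) (trans (∑-cong (fins k) (λ p → split-window k r p q r≤k)) (∑-+ (fins k) _ _)) ⟩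
  A + B + C
    ≡⟨ shuffle A B C ⟩
  (A + C) + B
    ≡⟨ cong₂ _+_ (trans (sym (∑-+ (fins k) _ _)) (trans (∑-cong (fins k) (λ p → interval' (toℕ p) (toℕ q) r)) (∑-<-⊓ k (toℕ q + r)))) B≡ ⟩
  k ⊓ (toℕ q + r) + k ⊓ (toℕ q + r ∸ k)
    ≤⟨ total ⟩
  r + toℕ q
    ≡⟨ cong (r +_) (sym (trans (∑-<-⊓ k (toℕ q)) (m≥n⇒m⊓n≡n (<⇒≤ (F.toℕ<n q))))) ⟩
  r + C ∎)
  where
  open ≤-Reasoning
  A B C : ℕ
  A = ∑ (fins k) (λ p → 𝟙 ((toℕ q <ᵇ suc (toℕ p)) ∧ (toℕ p <ᵇ toℕ q + r)))
  B = ∑ (fins k) (λ p → 𝟙 (toℕ p + k <ᵇ toℕ q + r))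
  C = ∑ (fins k) (λ p → 𝟙 (toℕ p <ᵇ toℕ q))
  shuffle : ∀ a b c → a + b + c ≡ (a + c) + b
  shuffle = solve-∀
  shift : ∀ p s → (p + k <ᵇ s) ≡ (p <ᵇ s ∸ k)
  shift p s with p + k <? s
  ... | yes h rewrite <ᵇ-true h | <ᵇ-true {p} {s ∸ k} (m+n≤o⇒m≤o∸n (suc p) h) = refl
  ... | no h rewrite <ᵇ-false (≮⇒≥ h) | <ᵇ-false {p} {s ∸ k} (≤-trans (∸-monoˡ-≤ k (≮⇒≥ h)) (≤-reflexive (m+n∸n≡m p k))) = refl
  B≡ : B ≡ k ⊓ (toℕ q + r ∸ k)
  B≡ = trans (∑-cong (fins k) (λ p → cong 𝟙 (shift (toℕ p) (toℕ q + r)))) (∑-<-⊓ k _)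
  total : k ⊓ (toℕ q + r) + k ⊓ (toℕ q + r ∸ k) ≤ r + toℕ q
  total with ≤-total k (toℕ q + r)
  ... | inj₁ h = ≤-trans (+-mono-≤ (m⊓n≤m k _) (m⊓n≤n k _)) (≤-reflexive (trans (m+[n∸m]≡n h) (+-comm (toℕ q) r)))
  ... | inj₂ h = ≤-trans (+-mono-≤ (m⊓n≤n k _) (≤-trans (m⊓n≤n k _) (≤-reflexive (m≤n⇒m∸n≡0 h)))) (≤-reflexive (trans (+-identityʳ _) (+-comm (toℕ q) r)))

-- Families of edges in a colour class

size-∑ : ∀ {n} (A : Subset n) → ∣ A ∣ ≡ ∑ (fins n) (λ v → 𝟙 (lookup A v))
size-∑ []          = refl
size-∑ {suc n} (true  ∷ A) = trans (cong suc (size-∑ A)) (sym (∑-suc n (λ v → 𝟙 (lookup (true ∷ A) v))))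
size-∑ {suc n} (false ∷ A) = trans (size-∑ A) (sym (∑-suc n (λ v → 𝟙 (lookup (false ∷ A) v))))

countF-∑ : ∀ {n} (f : Fin n → Bool) → countF f ≡ ∑ (fins n) (λ i → 𝟙 (f i))
countF-∑ {n} f = trans (size-∑ (tabulate f)) (∑-cong (fins n) (λ i → cong 𝟙 (V.lookup∘tabulate f i)))

anyF-true : ∀ {m} (f : Fin m → Bool) → anyF f ≡ true → ∃ λ i → f i ≡ true
anyF-true {suc m} f h with f zero in e
... | true  = zero , e
... | false with anyF-true (f ∘ suc) h
...   | i , p = suc i , p

true-anyF : ∀ {m} (f : Fin m → Bool) i → f i ≡ true → anyF f ≡ true
true-anyF f zero    h rewrite h = refl
true-anyF f (suc i) h = trans (cong (f zero ∨_) (true-anyF (f ∘ suc) i h)) (𝔹.∨-zeroʳ (f zero))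

-- The subset of K whose i-th element (in increasing order) is kept iff w i.
sub : ∀ {n} (K : Subset n) → (Fin ∣ K ∣ → Bool) → Subset n
sub []          w = []
sub (true  ∷ K) w = w zero ∷ sub K (w ∘ suc)
sub (false ∷ K) w = false ∷ sub K w

sub-size : ∀ {n} (K : Subset n) w → ∣ sub K w ∣ ≡ ∑ (fins ∣ K ∣) (λ i → 𝟙 (w i))
sub-size []          w = refl
sub-size (false ∷ K) w = sub-size K w
sub-size (true  ∷ K) w = trans (size-∷ (w zero) (sub K (w ∘ suc)))
  (trans (cong (𝟙 (w zero) +_) (sub-size K (w ∘ suc))) (sym (∑-suc ∣ K ∣ (λ i → 𝟙 (w i)))))
  where
  size-∷ : ∀ {n} b (A : Subset n) → ∣ b ∷ A ∣ ≡ 𝟙 b + ∣ A ∣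
  size-∷ true  A = refl
  size-∷ false A = refl

-- The rank `i` of `v` in `K` is the same for all `w`. With `v` fixed, the windows containing it can
-- therefore be counted by `window-column` at the position `i`.
sub-lookup : ∀ {n} (K : Subset n) v →
             (∀ w → lookup (sub K w) v ≡ false) ⊎ (lookup K v ≡ true × ∃ λ i → ∀ w → lookup (sub K w) v ≡ w i)
sub-lookup (true  ∷ K) zero    = inj₂ (refl , zero , λ w → refl)
sub-lookup (false ∷ K) zero    = inj₁ (λ w → refl)
sub-lookup (false ∷ K) (suc v) = sub-lookup K v
sub-lookup (true  ∷ K) (suc v) with sub-lookup K v
... | inj₁ h           = inj₁ (λ w → h (w ∘ suc))
... | inj₂ (k , i , h) = inj₂ (k , suc i , λ w → h (w ∘ suc))

lookup⇒∈ : ∀ {n} {A : Subset n} {v} → lookup A v ≡ true → v ∈ A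
lookup⇒∈ {A = A} {v} h = V.lookup⇒[]= v A h

∈⇒lookup : ∀ {n} {A : Subset n} {v} → v ∈ A → lookup A v ≡ true
∈⇒lookup h = V.[]=⇒lookup h

sub-⊆ : ∀ {n} (K : Subset n) w → sub K w ⊆ K
sub-⊆ K w {v} h with sub-lookup K v
... | inj₁ f       = case trans (sym (f w)) (∈⇒lookup h) of λ ()
... | inj₂ (k , _) = lookup⇒∈ k

-- As in `select`, the inequality between sums is the usable form of injectivity. It trims every
-- colour to the same number `x` of edges.
prefix : ∀ {A : Set} (L : List A) x → x ≤ length L → Σ (Fin x → A) λ E → ∀ f → ∑ (fins x) (f ∘ E) ≤ ∑ L f
prefix L       zero    h       = (λ ()) , λ f → z≤n
prefix (e ∷ L) (suc x) (s≤s h) with prefix L x h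
... | E , E-sum = E⁺ , λ f → ≤-trans (≤-reflexive (∑-suc x (f ∘ E⁺))) (+-monoʳ-≤ (f e) (E-sum f))
  where
  E⁺ : Fin (suc x) → _
  E⁺ zero    = e
  E⁺ (suc i) = E i

at-most-one : ∀ {t} (b : Fin t → Bool) → (∀ i j → i ≢ j → b i ≡ true → b j ≡ true → ⊥) → ∑ (fins t) (λ i → 𝟙 (b i)) ≤ 1
at-most-one {t} b h with ∑ (fins t) (λ i → 𝟙 (b i)) in e
... | zero  = z≤n
... | suc s with ∑-pos (fins t) (λ i → 𝟙 (b i)) (subst (0 <_) (sym e) z<s)
...   | i , _ , p = ≤-trans (≤-reflexive (sym e)) (≤-trans (∑-mono (fins t) (λ j → 𝟙-mono (b j) (j == i) (only j))) (≤-reflexive (∑-δ1 i)))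
  where
  only : ∀ j → b j ≡ true → (j == i) ≡ true
  only j q with j F.≟ i
  ... | yes _ = refl
  ... | no ne = ⊥-elim (h j i ne q (𝟙-pos _ p))

module Palette {n m k : ℕ} (G : ColHyp n m k) (r : ℕ) (uni : Uniform G r) where

  open ColHyp G

  -- Each clique contributes its cyclic intervals of length r (for a clique on exactly r vertices, the single
  -- edge r times), so that each spanned vertex lies in at most r members of the family.
  family : ∀ c → DisjointUnionOfCliques G r c → ∀ x → x ≤ spanC G c →
           Σ (Fin x → Fin m) λ E → (∀ s → color (E s) ≡ c) × (∀ v → ∑ (fins x) (λ s → 𝟙 (lookup (edge (E s)) v)) ≤ r)
  family c (t , K , big , disj , mult) x x≤ =
    proj₁ ∘ E , (λ s → proj₂ (E s)) , λ v → ≤-trans (E-sum (λ e → 𝟙 (lookup (edge (proj₁ e)) v))) (load v)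
    where
    open ≤-Reasoning
    cut : ∀ i → Fin ∣ K i ∣ → Subset n
    cut i p = sub (K i) (window ∣ K i ∣ r p)
    -- An interval is an `r`-subset of its clique, so it has multiplicity 1 in the colour class; a
    -- positive count produces the edge.
    realize : ∀ i p → Σ (Σ (Fin m) λ e → color e ≡ c) λ e → edge (proj₁ e) ≡ cut i p
    realize i p with ∑-pos (fins m) (λ e → 𝟙 ((color e == c) ∧ does (V.≡-dec 𝔹._≟_ (edge e) (cut i p))))
      (≤-reflexive (sym (trans (sym (countF-∑ (λ e → (color e == c) ∧ does (V.≡-dec 𝔹._≟_ (edge e) (cut i p)))))
        (proj₁ (mult (cut i p) (trans (sub-size (K i) _) (window-row _ r (big i) p))) (i , sub-⊆ (K i) _)))))
    ... | e , _ , pos with V.≡-dec 𝔹._≟_ (edge e) (cut i p)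
    ...   | yes eq = (e , ==-true (proj₁ (∧-true (𝟙-pos _ pos)))) , eq
    ...   | no _   = case proj₂ (∧-true {color e == c} (𝟙-pos _ pos)) of λ ()
    L : List (Σ (Fin m) λ e → color e ≡ c)
    L = concatMap (λ i → map (λ p → proj₁ (realize i p)) (fins ∣ K i ∣)) (fins t)
    ∑-L : ∀ f → ∑ L f ≡ ∑ (fins t) (λ i → ∑ (fins ∣ K i ∣) (λ p → f (proj₁ (realize i p))))
    ∑-L f = trans (∑-concatMap _ (fins t) f) (∑-cong (fins t) (λ i → ∑-map _ (fins ∣ K i ∣) f))
    covered : ∀ v → 𝟙 (anyF (λ e → (color e == c) ∧ lookup (edge e) v)) ≤ ∑ (fins t) (λ i → 𝟙 (lookup (K i) v))
    covered v with anyF (λ e → (color e == c) ∧ lookup (edge e) v) in an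
    ... | false = z≤n
    ... | true with anyF-true _ an
    ...   | e , h with F.any? (λ i → edge e S.⊆? K i)
    ...     | yes (i , e⊆) = ≤-trans (≤-reflexive (cong 𝟙 (sym (∈⇒lookup (e⊆ (lookup⇒∈ (proj₂ (∧-true {color e == c} h)))))))) (∑-fin (λ i → 𝟙 (lookup (K i) v)) i)
    -- An edge of colour `c` inside no clique would have multiplicity 0, yet it is counted there
    -- itself.
    ...     | no none = ⊥-elim (<-irrefl refl (begin-strict
      0                                   <⟨ ≤-reflexive (cong 𝟙 (sym (cong₂ _∧_ (proj₁ (∧-true h)) (dec-true (V.≡-dec 𝔹._≟_ (edge e) (edge e)) refl)))) ⟩
      𝟙 ((color e == c) ∧ does (V.≡-dec 𝔹._≟_ (edge e) (edge e)))
                                          ≤⟨ ∑-fin (λ f → 𝟙 ((color f == c) ∧ does (V.≡-dec 𝔹._≟_ (edge f) (edge e)))) e ⟩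
      ∑ (fins m) (λ f → 𝟙 ((color f == c) ∧ does (V.≡-dec 𝔹._≟_ (edge f) (edge e))))
                                          ≡⟨ sym (countF-∑ (λ f → (color f == c) ∧ does (V.≡-dec 𝔹._≟_ (edge f) (edge e)))) ⟩
      multC G c (edge e)                  ≡⟨ proj₂ (mult (edge e) (uni e)) none ⟩
      0                                   ∎))
    long : x ≤ length L
    long = begin
      x
        ≤⟨ x≤ ⟩
      spanC G c
        ≡⟨ countF-∑ (λ v → anyF (λ e → (color e == c) ∧ lookup (edge e) v)) ⟩
      ∑ (fins n) (λ v → 𝟙 (anyF (λ e → (color e == c) ∧ lookup (edge e) v)))
        ≤⟨ ∑-mono (fins n) covered ⟩
      ∑ (fins n) (λ v → ∑ (fins t) (λ i → 𝟙 (lookup (K i) v)))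
        ≡⟨ ∑-swap (fins n) (fins t) _ ⟩
      ∑ (fins t) (λ i → ∑ (fins n) (λ v → 𝟙 (lookup (K i) v)))
        ≡⟨ ∑-cong (fins t) (λ i → trans (sym (size-∑ (K i))) (sym (trans (∑-const-fins ∣ K i ∣ 1) (*-identityʳ ∣ K i ∣)))) ⟩
      ∑ (fins t) (λ i → ∑ (fins ∣ K i ∣) (λ p → 1))
        ≡⟨ sym (∑-L (λ _ → 1)) ⟩
      ∑ L (λ _ → 1)
        ≡⟨ trans (∑-const L 1) (*-identityʳ (length L)) ⟩
      length L ∎
    E : Fin x → Σ (Fin m) λ e → color e ≡ c
    E = proj₁ (prefix L x long)
    E-sum : ∀ f → ∑ (fins x) (f ∘ E) ≤ ∑ L f
    E-sum = proj₂ (prefix L x long)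
    in-clique : ∀ v i → ∑ (fins ∣ K i ∣) (λ p → 𝟙 (lookup (edge (proj₁ (proj₁ (realize i p)))) v)) ≤ 𝟙 (lookup (K i) v) * r
    in-clique v i = ≤-trans (≤-reflexive (∑-cong (fins ∣ K i ∣) (λ p → cong (λ A → 𝟙 (lookup A v)) (proj₂ (realize i p))))) bound
      where
      bound : ∑ (fins ∣ K i ∣) (λ p → 𝟙 (lookup (cut i p) v)) ≤ 𝟙 (lookup (K i) v) * r
      bound with sub-lookup (K i) v
      ... | inj₁ h = ≤-trans (≤-reflexive (∑-zero∀ (fins ∣ K i ∣) (λ p → cong 𝟙 (h _)))) z≤n
      ... | inj₂ (kv , q , h) = begin
        ∑ (fins ∣ K i ∣) (λ p → 𝟙 (lookup (cut i p) v))           ≡⟨ ∑-cong (fins ∣ K i ∣) (λ p → cong 𝟙 (h _)) ⟩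
        ∑ (fins ∣ K i ∣) (λ p → 𝟙 (window ∣ K i ∣ r p q))         ≤⟨ window-column ∣ K i ∣ r (big i) q ⟩
        r                                                        ≡⟨ sym (trans (cong (λ b → 𝟙 b * r) kv) (*-identityˡ r)) ⟩
        𝟙 (lookup (K i) v) * r                                   ∎
    load : ∀ v → ∑ L (λ e → 𝟙 (lookup (edge (proj₁ e)) v)) ≤ r
    load v = begin
      ∑ L (λ e → 𝟙 (lookup (edge (proj₁ e)) v))                  ≡⟨ ∑-L _ ⟩
      ∑ (fins t) (λ i → ∑ (fins ∣ K i ∣) (λ p → 𝟙 (lookup (edge (proj₁ (proj₁ (realize i p)))) v)))
                                                                 ≤⟨ ∑-mono (fins t) (in-clique v) ⟩
      ∑ (fins t) (λ i → 𝟙 (lookup (K i) v) * r)                  ≡⟨ ∑-*ʳ (fins t) r _ ⟩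
      ∑ (fins t) (λ i → 𝟙 (lookup (K i) v)) * r                  ≤⟨ *-monoˡ-≤ r (at-most-one (λ i → lookup (K i) v) (λ i j ne p q → disj i j ne v (lookup⇒∈ p) (lookup⇒∈ q))) ⟩
      1 * r                                                      ≡⟨ *-identityˡ r ⟩
      r                                                          ∎

  contains : Fin n → Maybe (Fin m) → Bool
  contains v (just e) = lookup (edge e) v
  contains v nothing  = false

  record Picks (x : ℕ) : Set where
    field
      pick       : Fin k → Fin x → Maybe (Fin m)
      pick-color : ∀ {c s e} → pick c s ≡ just e → color e ≡ c
      pick-load  : ∀ c v → ∑ (fins x) (λ s → 𝟙 (contains v (pick c s))) ≤ r
      pick-used  : ∀ c → Used G c → ∀ s → ∃ λ e → pick c s ≡ just e

  picks : (∀ c → Used G c → DisjointUnionOfCliques G r c) → ∀ x → (∀ c → Used G c → x ≤ spanC G c) → Picks x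
  picks cliques x x≤ = record
    { pick       = λ c → pick₀ c (used? c)
    ; pick-color = λ {c} {s} {e} → color₀ c (used? c) s e
    ; pick-load  = λ c → load₀ c (used? c)
    ; pick-used  = λ c u → used₀ c (used? c) u
    }
    where
    used? : ∀ c → Dec (Used G c)
    used? c = F.any? (λ e → color e F.≟ c)
    fam : ∀ c → Used G c → _
    fam c u = family c (cliques c u) x (x≤ c u)
    pick₀ : ∀ c → Dec (Used G c) → Fin x → Maybe (Fin m)
    pick₀ c (yes u) s = just (proj₁ (fam c u) s)
    pick₀ c (no _)  s = nothing
    color₀ : ∀ c d s e → pick₀ c d s ≡ just e → color e ≡ c
    color₀ c (yes u) s e refl = proj₁ (proj₂ (fam c u)) s
    load₀ : ∀ c d v → ∑ (fins x) (λ s → 𝟙 (contains v (pick₀ c d s))) ≤ r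
    load₀ c (yes u) v = proj₂ (proj₂ (fam c u)) v
    load₀ c (no _)  v = ≤-trans (≤-reflexive (∑-zero (fins x))) z≤n
    used₀ : ∀ c d → Used G c → ∀ s → ∃ λ e → pick₀ c d s ≡ just e
    used₀ c (yes u) _ s = _ , refl
    used₀ c (no ¬u) u s = ⊥-elim (¬u u)

-- Reduction to a bipartite hypergraph

∑-remQuot : ∀ k D (f : Fin k × Fin D → ℕ) → ∑ (fins (k * D)) (λ a → f (remQuot D a)) ≡ ∑ (fins k) (λ c → ∑ (fins D) (λ i → f (c , i)))
∑-remQuot k D f = trans (∑-split* k D (λ a → f (remQuot D a)))
  (∑-cong (fins k) (λ c → ∑-cong (fins D) (λ i → cong f (F.remQuot-combine c i))))

remQuot-injective : ∀ k D {a b : Fin (k * D)} → remQuot {k} D a ≡ remQuot D b → a ≡ b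
remQuot-injective k D {a} {b} e = trans (sym (F.combine-remQuot {k} D a)) (trans (cong (uncurry combine) e) (F.combine-remQuot {k} D b))

-- D copies of the colours against D copies of the vertices together with the edges of G: a matching saturating
-- the colours is a sequence of D full rainbow matchings of G, no edge being used twice.
module Copies {n m k : ℕ} (G : ColHyp n m k) (r : ℕ) (1≤r : 1 ≤ r) (uni : Uniform G r) {x : ℕ}
  (picks : Palette.Picks G r uni x) (D κ₀ : ℕ) (1≤κ₀ : 1 ≤ κ₀)
  (codeg≤ : ∀ u v → u ≢ v → codeg G u v ≤ κ₀) (colDeg≤ : ∀ v → colDeg G v ≤ D) where

  open ColHyp G
  open Palette G r uni using (contains)
  open Palette.Picks picks

  Vertex : Set
  Vertex = (Fin n × Fin D) ⊎ Fin m

  is : Fin m → Maybe (Fin m) → Bool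
  is e (just e') = e' == e
  is e nothing   = false

  inc : Vertex → Fin k × Fin D → Fin x → Bool
  inc (inj₁ (v , i')) (c , i) s = (i' == i) ∧ contains v (pick c s)
  inc (inj₂ e)        (c , i) s = is e (pick c s)

  decode : Fin (n * D + m) → Vertex
  decode u = [ inj₁ ∘ remQuot D , inj₂ ]′ (splitAt (n * D) u)

  ∑-decode : ∀ (f : Vertex → ℕ) → ∑ (fins (n * D + m)) (λ u → f (decode u))
             ≡ ∑ (fins n) (λ v → ∑ (fins D) (λ i → f (inj₁ (v , i)))) + ∑ (fins m) (λ e → f (inj₂ e))
  ∑-decode f = trans (∑-split+ (n * D) m (λ u → f (decode u))) (cong₂ _+_
    (trans (∑-cong (fins (n * D)) (λ a → cong (f ∘ [ inj₁ ∘ remQuot D , inj₂ ]′) (F.splitAt-↑ˡ (n * D) a m))) (∑-remQuot n D (f ∘ inj₁)))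
    (∑-cong (fins m) (λ e → cong (f ∘ [ inj₁ ∘ remQuot D , inj₂ ]′) (F.splitAt-↑ʳ (n * D) m e))))

  decode-injective : ∀ {u w} → decode u ≡ decode w → u ≡ w
  decode-injective {u} {w} e with splitAt (n * D) u in eu | splitAt (n * D) w in ew
  ... | inj₁ a | inj₁ b = trans (sym (F.splitAt⁻¹-↑ˡ eu)) (trans (cong (_↑ˡ m) (remQuot-injective n D (inj₁-injective e))) (F.splitAt⁻¹-↑ˡ ew))
    where
    inj₁-injective : ∀ {A B : Set} {p q : A} → inj₁ {B = B} p ≡ inj₁ q → p ≡ q
    inj₁-injective refl = refl
  ... | inj₂ a | inj₂ b = trans (sym (F.splitAt⁻¹-↑ʳ eu)) (trans (cong ((n * D) ↑ʳ_) (inj₂-injective e)) (F.splitAt⁻¹-↑ʳ ew))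
    where
    inj₂-injective : ∀ {A B : Set} {p q : B} → inj₂ {A = A} p ≡ inj₂ q → p ≡ q
    inj₂-injective refl = refl
  decode-injective () | inj₁ _ | inj₂ _
  decode-injective () | inj₂ _ | inj₁ _

  is-just : ∀ {e o} → is e o ≡ true → o ≡ just e
  is-just {e} {just e'} h = cong just (==-true h)

  -- An edge is nonempty, and each of its repetitions loads one fixed vertex of it, so `pick-load`
  -- at that vertex bounds their number.
  repeats : ∀ e c → ∑ (fins x) (λ s → 𝟙 (is e (pick c s))) ≤ 𝟙 (c == color e) * r
  repeats e c with ∑-pos (fins n) (λ v → 𝟙 (lookup (edge e) v)) (≤-trans 1≤r (≤-reflexive (trans (sym (uni e)) (size-∑ (edge e)))))
  ... | v , _ , h with c F.≟ color e
  ...   | yes refl = ≤-trans (∑-mono (fins x) inside) (≤-trans (pick-load c v) (≤-reflexive (sym (*-identityˡ r))))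
    where
    inside : ∀ s → 𝟙 (is e (pick c s)) ≤ 𝟙 (contains v (pick c s))
    inside s with is e (pick c s) in i
    ... | false = z≤n
    ... | true rewrite is-just {e} {pick c s} i = h
  ...   | no ne = ≤-trans (≤-reflexive (∑-zero∀ (fins x) never)) z≤n
    where
    never : ∀ s → 𝟙 (is e (pick c s)) ≡ 0
    never s with is e (pick c s) in i
    ... | false = refl
    ... | true  = ⊥-elim (ne (sym (pick-color (is-just i))))

  multiplicity : ∀ e → ∑ (fins k) (λ c → ∑ (fins x) (λ s → 𝟙 (is e (pick c s)))) ≤ r
  multiplicity e = ≤-trans (∑-mono (fins k) (repeats e)) (≤-reflexive (∑-δ (color e) (λ _ → r)))

  select-copy : ∀ i' (f : Fin k → Fin x → Bool) →
    ∑ (fins k) (λ c → ∑ (fins D) (λ i → ∑ (fins x) (λ s → 𝟙 ((i' == i) ∧ f c s)))) ≡ ∑ (fins k) (λ c → ∑ (fins x) (λ s → 𝟙 (f c s)))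
  select-copy i' f = ∑-cong (fins k) (λ c → trans
    (∑-cong (fins D) (λ i → trans (∑-cong (fins x) (λ s → trans (𝟙-∧ (i' == i) (f c s)) (cong (λ b → 𝟙 b * 𝟙 (f c s)) (==-sym i' i)))) (∑-*ˡ (fins x) (𝟙 (i == i')) _)))
    (∑-δ i' (λ _ → ∑ (fins x) (λ s → 𝟙 (f c s)))))

  seen : Fin n → Fin k → Bool
  seen v c = anyF (λ e → (color e == c) ∧ lookup (edge e) v)

  contains-seen : ∀ v c s → 𝟙 (contains v (pick c s)) ≤ 𝟙 (seen v c) * 𝟙 (contains v (pick c s))
  contains-seen v c s with pick c s in p
  ... | nothing = z≤n
  ... | just e with lookup (edge e) v in l
  ...   | false = z≤n
  ...   | true rewrite true-anyF (λ e → (color e == c) ∧ lookup (edge e) v) e (cong₂ _∧_ (trans (cong (_== c) (pick-color p)) (==-refl c)) l) = ≤-refl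

  vertex-load : ∀ v → ∑ (fins k) (λ c → ∑ (fins x) (λ s → 𝟙 (contains v (pick c s)))) ≤ r * D
  vertex-load v = begin
    ∑ (fins k) (λ c → ∑ (fins x) (λ s → 𝟙 (contains v (pick c s))))
      ≤⟨ ∑-mono (fins k) (λ c → ≤-trans (∑-mono (fins x) (contains-seen v c))
           (≤-trans (≤-reflexive (∑-*ˡ (fins x) (𝟙 (seen v c)) _)) (*-monoʳ-≤ (𝟙 (seen v c)) (pick-load c v)))) ⟩
    ∑ (fins k) (λ c → 𝟙 (seen v c) * r)
      ≡⟨ ∑-*ʳ (fins k) r _ ⟩
    ∑ (fins k) (λ c → 𝟙 (seen v c)) * r
      ≤⟨ *-monoˡ-≤ r (≤-trans (≤-reflexive (sym (countF-∑ (seen v)))) (colDeg≤ v)) ⟩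
    D * r
      ≡⟨ *-comm D r ⟩
    r * D ∎ where open ≤-Reasoning

  -- The two kinds of vertex reach the same bound: a copy of `v` sees at most D colours, each at
  -- most r times; an edge of `G` sees its own colour at most r times in each of the D copies.
  degree : ∀ v → ∑ (fins k) (λ c → ∑ (fins D) (λ i → ∑ (fins x) (λ s → 𝟙 (inc v (c , i) s)))) ≤ r * D
  degree (inj₁ (v , i')) = ≤-trans (≤-reflexive (select-copy i' (λ c s → contains v (pick c s)))) (vertex-load v)
  degree (inj₂ e) = begin
    ∑ (fins k) (λ c → ∑ (fins D) (λ i → ∑ (fins x) (λ s → 𝟙 (is e (pick c s)))))   ≡⟨ ∑-swap (fins k) (fins D) _ ⟩
    ∑ (fins D) (λ i → ∑ (fins k) (λ c → ∑ (fins x) (λ s → 𝟙 (is e (pick c s)))))   ≤⟨ ∑-≤ D (λ i → multiplicity e) ⟩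
    D * r                                                                          ≡⟨ *-comm D r ⟩
    r * D                                                                          ∎ where open ≤-Reasoning

  r≤ : r ≤ r * κ₀
  r≤ = ≤-trans (≤-reflexive (sym (*-identityʳ r))) (*-monoʳ-≤ r 1≤κ₀)

  -- Every common pick is an edge through both vertices, of which there are at most `κ₀`, and each
  -- edge is picked at most r times.
  both : ∀ u v → u ≢ v → ∑ (fins k) (λ c → ∑ (fins x) (λ s → 𝟙 (contains u (pick c s) ∧ contains v (pick c s)))) ≤ r * κ₀
  both u v ne = begin
    ∑ (fins k) (λ c → ∑ (fins x) (λ s → 𝟙 (contains u (pick c s) ∧ contains v (pick c s))))
      ≤⟨ ∑-mono (fins k) (λ c → ∑-mono (fins x) (λ s → each (pick c s))) ⟩
    ∑ (fins k) (λ c → ∑ (fins x) (λ s → ∑ (fins m) (λ e → joint e * 𝟙 (is e (pick c s)))))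
      ≡⟨ trans (∑-cong (fins k) (λ c → ∑-swap (fins x) (fins m) _)) (∑-swap (fins k) (fins m) _) ⟩
    ∑ (fins m) (λ e → ∑ (fins k) (λ c → ∑ (fins x) (λ s → joint e * 𝟙 (is e (pick c s)))))
      ≡⟨ ∑-cong (fins m) (λ e → trans (∑-cong (fins k) (λ c → ∑-*ˡ (fins x) (joint e) _)) (∑-*ˡ (fins k) (joint e) _)) ⟩
    ∑ (fins m) (λ e → joint e * ∑ (fins k) (λ c → ∑ (fins x) (λ s → 𝟙 (is e (pick c s)))))
      ≤⟨ ∑-mono (fins m) (λ e → *-monoʳ-≤ (joint e) (multiplicity e)) ⟩
    ∑ (fins m) (λ e → joint e * r)
      ≡⟨ ∑-*ʳ (fins m) r joint ⟩
    ∑ (fins m) joint * r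
      ≤⟨ *-monoˡ-≤ r (≤-trans (≤-reflexive (sym (countF-∑ (λ e → lookup (edge e) u ∧ lookup (edge e) v)))) (codeg≤ u v ne)) ⟩
    κ₀ * r
      ≡⟨ *-comm κ₀ r ⟩
    r * κ₀ ∎
    where
    open ≤-Reasoning
    joint : Fin m → ℕ
    joint e = 𝟙 (lookup (edge e) u ∧ lookup (edge e) v)
    each : ∀ o → 𝟙 (contains u o ∧ contains v o) ≤ ∑ (fins m) (λ e → joint e * 𝟙 (is e o))
    each nothing  = z≤n
    each (just e) = ≤-trans (≤-reflexive (sym (trans (cong (λ b → joint e * 𝟙 b) (==-refl e)) (*-identityʳ (joint e))))) (∑-fin (λ e' → joint e' * 𝟙 (e == e')) e)

  private
    drop : ∀ {f g : Fin k → Fin D → Fin x → ℕ} → (∀ c i s → f c i s ≤ g c i s) →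
           ∑ (fins k) (λ c → ∑ (fins D) (λ i → ∑ (fins x) (f c i))) ≤ ∑ (fins k) (λ c → ∑ (fins D) (λ i → ∑ (fins x) (g c i)))
    drop h = ∑-mono (fins k) (λ c → ∑-mono (fins D) (λ i → ∑-mono (fins x) (h c i)))

    mixed : ∀ v i' e → ∑ (fins k) (λ c → ∑ (fins D) (λ i → ∑ (fins x) (λ s → 𝟙 (inc (inj₁ (v , i')) (c , i) s) * 𝟙 (is e (pick c s))))) ≤ r * κ₀
    mixed v i' e = ≤-trans (drop pointwise) (≤-trans (≤-reflexive (select-copy i' (λ c s → is e (pick c s)))) (≤-trans (multiplicity e) r≤))
      where
      pointwise : ∀ c i s → 𝟙 ((i' == i) ∧ contains v (pick c s)) * 𝟙 (is e (pick c s)) ≤ 𝟙 ((i' == i) ∧ is e (pick c s))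
      pointwise c i s with i' == i
      ... | false = z≤n
      ... | true  = ≤-trans (*-monoˡ-≤ _ (𝟙≤1 (contains v (pick c s)))) (≤-reflexive (*-identityˡ _))

  codegree : ∀ v w → v ≢ w → ∑ (fins k) (λ c → ∑ (fins D) (λ i → ∑ (fins x) (λ s → 𝟙 (inc v (c , i) s) * 𝟙 (inc w (c , i) s)))) ≤ r * κ₀
  codegree (inj₁ (v , i₁)) (inj₂ e) ne = mixed v i₁ e
  codegree (inj₂ e) (inj₁ (v , i₁)) ne = ≤-trans (drop (λ c i s → ≤-reflexive (*-comm (𝟙 (is e (pick c s))) _))) (mixed v i₁ e)
  codegree (inj₂ e) (inj₂ e') ne = ≤-trans (≤-reflexive (∑-zero∀ (fins k) (λ c → ∑-zero∀ (fins D) (λ i → ∑-zero∀ (fins x) (λ s → apart (pick c s)))))) z≤n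
    where
    apart : ∀ o → 𝟙 (is e o) * 𝟙 (is e' o) ≡ 0
    apart nothing = refl
    apart (just f) with f F.≟ e
    ... | no _     = refl
    ... | yes refl rewrite ==-≢ {i = e} {e'} (ne ∘ cong inj₂) = refl
  codegree (inj₁ (v , i₁)) (inj₁ (w , i₂)) ne with i₁ F.≟ i₂
  ... | yes refl = ≤-trans (drop pointwise) (≤-trans (≤-reflexive (select-copy i₁ (λ c s → contains v (pick c s) ∧ contains w (pick c s))))
                     (both v w (λ { refl → ne refl })))
    where
    pointwise : ∀ c i s → 𝟙 ((i₁ == i) ∧ contains v (pick c s)) * 𝟙 ((i₁ == i) ∧ contains w (pick c s)) ≤ 𝟙 ((i₁ == i) ∧ (contains v (pick c s) ∧ contains w (pick c s)))
    pointwise c i s with i₁ == i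
    ... | false = z≤n
    ... | true  = ≤-reflexive (sym (𝟙-∧ (contains v (pick c s)) _))
  ... | no i₁≢i₂ = ≤-trans (≤-reflexive (∑-zero∀ (fins k) (λ c → ∑-zero∀ (fins D) (λ i → ∑-zero∀ (fins x) (apart c i))))) z≤n
    where
    apart : ∀ c i s → 𝟙 ((i₁ == i) ∧ contains v (pick c s)) * 𝟙 ((i₂ == i) ∧ contains w (pick c s)) ≡ 0
    apart c i s with i₁ F.≟ i
    ... | no _     = refl
    ... | yes refl rewrite ==-≢ {i = i₂} {i₁} (i₁≢i₂ ∘ sym) = *-zeroʳ (𝟙 (contains v (pick c s)))

  codegreeA : ∀ v c i → ∑ (fins x) (λ s → 𝟙 (inc v (c , i) s)) ≤ r * κ₀
  codegreeA (inj₁ (v , i')) c i = ≤-trans (∑-mono (fins x) (λ s → 𝟙-mono _ _ (λ h → proj₂ (∧-true {i' == i} h)))) (≤-trans (pick-load c v) r≤)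
  codegreeA (inj₂ e)        c i = ≤-trans (repeats e c) (≤-trans (*-monoˡ-≤ r (𝟙≤1 (c == color e))) (≤-trans (≤-reflexive (*-identityˡ r)) r≤))

  uniform : ∀ c i s v → inc v (c , i) s ≡ true →
            ∑ (fins n) (λ v → ∑ (fins D) (λ i' → 𝟙 (inc (inj₁ (v , i')) (c , i) s))) + ∑ (fins m) (λ e → 𝟙 (inc (inj₂ e) (c , i) s)) ≡ suc r
  uniform c i s v h with pick c s in p
  ... | nothing = case trans (sym h) (empty v) of λ ()
    where
    empty : ∀ v → inc v (c , i) s ≡ false
    empty (inj₁ (v , i')) = trans (cong (λ o → (i' == i) ∧ contains v o) p) (𝔹.∧-zeroʳ (i' == i))
    empty (inj₂ e)        = cong (is e) p
  ... | just e = trans (cong₂ _+_ vertices (trans (∑-cong (fins m) (λ e' → cong 𝟙 (==-sym e e'))) (∑-δ1 e))) (+-comm r 1)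
    where
    vertices : ∑ (fins n) (λ v → ∑ (fins D) (λ i' → 𝟙 ((i' == i) ∧ lookup (edge e) v))) ≡ r
    vertices = trans (∑-cong (fins n) (λ v → trans (∑-cong (fins D) (λ i' → 𝟙-∧ (i' == i) _)) (∑-δ i (λ _ → 𝟙 (lookup (edge e) v)))))
      (trans (sym (size-∑ (edge e))) (uni e))

  system : System (n * D + m) (k * D) x (r * D) (r * κ₀) (suc r)
  system = record
    { I         = λ u a s → inc (decode u) (remQuot D a) s
    ; uniform   = λ a s b h → trans (∑-decode (λ v → 𝟙 (inc v (remQuot D a) s))) (uniform _ _ s (decode b) h)
    ; degree    = λ b → ≤-trans (≤-reflexive (∑-remQuot k D (λ a → ∑ (fins x) (λ s → 𝟙 (inc (decode b) a s))))) (degree (decode b))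
    ; codegree  = λ u w ne → ≤-trans (≤-reflexive (∑-remQuot k D (λ a → ∑ (fins x) (λ s → 𝟙 (inc (decode u) a s) * 𝟙 (inc (decode w) a s)))))
                    (codegree (decode u) (decode w) (ne ∘ decode-injective))
    ; codegreeA = λ u a → codegreeA (decode u) _ _
    }

  encode : Vertex → Fin (n * D + m)
  encode (inj₁ (v , i)) = combine v i ↑ˡ m
  encode (inj₂ e)       = (n * D) ↑ʳ e

  decode-encode : ∀ v → decode (encode v) ≡ v
  decode-encode (inj₁ (v , i)) = trans (cong [ inj₁ ∘ remQuot D , inj₂ ]′ (F.splitAt-↑ˡ (n * D) (combine v i) m)) (cong inj₁ (F.remQuot-combine v i))
  decode-encode (inj₂ e)       = cong [ inj₁ ∘ remQuot D , inj₂ ]′ (F.splitAt-↑ʳ (n * D) m e)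

  module Extract (matching : Matching system) where

    chosen : Fin k → Fin D → Maybe (Fin m)
    chosen c i = pick c (proj₁ matching (combine c i))

    -- An edge is compared with the pick of its own colour only, so each used colour contributes
    -- exactly one edge to each copy.
    M : Fin D → Subset m
    M i = tabulate (λ e → is e (chosen (color e) i))

    ∈M : ∀ {i e} → e ∈ M i → chosen (color e) i ≡ just e
    ∈M {i} {e} h = is-just (trans (sym (V.lookup∘tabulate _ e)) (∈⇒lookup h))

    M∋ : ∀ {i e c} → chosen c i ≡ just e → e ∈ M i
    M∋ {i} {e} {c} h = lookup⇒∈ (trans (V.lookup∘tabulate _ e) (trans (cong (λ c → is e (chosen c i)) (pick-color h)) (trans (cong (is e) h) (==-refl e))))

    private
      disjoint : ∀ {c c' i i' o o'} v → (c ≢ c' ⊎ i ≢ i') → chosen c i ≡ o → chosen c' i' ≡ o' →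
                 inc v (c , i) (proj₁ matching (combine c i)) ≡ true → inc v (c' , i') (proj₁ matching (combine c' i')) ≡ true → ⊥
      disjoint {c} {c'} {i} {i'} v ne _ _ h h' = proj₂ matching (combine c i) (combine c' i') (encode v) distinct
        (trans (cong₂ (λ u a → inc u a (proj₁ matching (combine c i))) (decode-encode v) (F.remQuot-combine c i)) h)
        (trans (cong₂ (λ u a → inc u a (proj₁ matching (combine c' i'))) (decode-encode v) (F.remQuot-combine c' i')) h')
        where
        distinct : combine c i ≢ combine c' i'
        distinct e with F.combine-injective c i c' i' e
        ... | refl , refl = [ (λ ne → ne refl) , (λ ne → ne refl) ]′ ne

      contained : ∀ {c i e v} → chosen c i ≡ just e → v ∈ edge e → inc (inj₁ (v , i)) (c , i) (proj₁ matching (combine c i)) ≡ true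
      contained {c} {i} {e} {v} h v∈ = cong₂ _∧_ (==-refl i) (trans (cong (contains v) h) (∈⇒lookup v∈))

      same : ∀ {c i e} → chosen c i ≡ just e → is e (chosen c i) ≡ true
      same {e = e} h = trans (cong (is e) h) (==-refl e)

    same-colour : ∀ {i e f} → e ∈ M i → f ∈ M i → color e ≡ color f → e ≡ f
    same-colour {i} {e} {f} e∈ f∈ c≡ with trans (sym (∈M e∈)) (trans (cong (λ c → chosen c i) c≡) (∈M f∈))
    ... | refl = refl

    full : ∀ i → FullRainbowMatching G (M i)
    full i = (λ e f e∈ f∈ ne v v∈e v∈f → disjoint (inj₁ (v , i)) (inj₁ (ne ∘ same-colour e∈ f∈)) (∈M e∈) (∈M f∈) (contained (∈M e∈) v∈e) (contained (∈M f∈) v∈f))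
           , (λ e f e∈ f∈ ne → ne ∘ same-colour e∈ f∈)
           , (λ c used → let (e , h) = pick-used c used (proj₁ matching (combine c i)) in e , M∋ h , pick-color h)

    edge-disjoint : ∀ i j → ¬ (i ≡ j) → ∀ e → e ∈ M i → e ∈ M j → ⊥
    edge-disjoint i j ne e e∈ e∈' = disjoint (inj₂ e) (inj₂ ne) (∈M e∈) (∈M e∈') (same (∈M e∈)) (same (∈M e∈'))

-- The theorem

module Constants (r p q : ℕ) (2≤r : 2 ≤ r) (1≤p : 1 ≤ p) (1≤q : 1 ≤ q) where

  R h E c k g₀ : ℕ
  R = suc r
  h = 32 * R
  -- The exponent of g that `x` must afford: 20 for the fourth power of F = g ^ 5, one for the extra
  -- factor in `Xₑ`, and 2 h for the phases, as 2 ^ n ≤ g ^ 2.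
  E = 21 + 2 * h
  -- From g ^ c ≤ D ≤ D ^ p follows g ^ E ≤ D ^ (p/q), so codegrees are at most D / g ^ E.
  c = E * q
  -- The dependency bound is 72 (x R) ^ 6; with 72 ≤ g and x R ≤ g ^ (2 c + 1) it is at most g ^ k,
  -- to be compared with 2 ^ g.
  k = 12 * c + 7
  g₀ = 1000 * (R * R) + 4 * (k * k)

  1≤r : 1 ≤ r
  1≤r = ≤-trans (s≤s z≤n) 2≤r

  1≤c : 1 ≤ c
  1≤c = *-mono-≤ {1} {E} (s≤s z≤n) 1≤q

  module Scale (D : ℕ) (D≥ : g₀ ^ c ≤ D) where

    private
      rt = root c 1≤c D

    g : ℕ
    g = proj₁ rt

    g^c≤D : g ^ c ≤ D
    g^c≤D = proj₁ (proj₂ rt)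

    D<[1+g]^c : D < suc g ^ c
    D<[1+g]^c = proj₂ (proj₂ rt)

    g₀≤g : g₀ ≤ g
    g₀≤g with g₀ ≤? g
    ... | yes h = h
    ... | no h  = ⊥-elim (<-irrefl refl (<-≤-trans D<[1+g]^c (≤-trans (^-monoˡ-≤ c (≰⇒> h)) D≥)))

    g-big : 1000 * (R * R) ≤ g
    g-big = ≤-trans (m≤m+n _ _) g₀≤g

    linear : ∀ j → j ≤ 1000 → j * R ≤ g
    linear j h = ≤-trans (*-monoˡ-≤ R h) (≤-trans (*-monoʳ-≤ 1000 (m≤m*n R R)) g-big)

    10≤g : 10 ≤ g
    10≤g = ≤-trans (*-monoʳ-≤ 10 (s≤s z≤n)) (linear 10 (m≤m+n 10 990))

    instance
      g≢0 : NonZero g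
      g≢0 = >-nonZero (≤-trans (s≤s z≤n) 10≤g)
      g^E≢0 : NonZero (g ^ E)
      g^E≢0 = m^n≢0 g E
      q≢0 : NonZero q
      q≢0 = >-nonZero 1≤q

    g≤D : g ≤ D
    g≤D = ≤-trans (≤-reflexive (sym (^-identityʳ g))) (≤-trans (^-monoʳ-≤ g 1≤c) g^c≤D)

    instance
      D≢0 : NonZero D
      D≢0 = >-nonZero (≤-trans (≤-trans (s≤s z≤n) 10≤g) g≤D)

    g^E≤D : g ^ E ≤ D
    g^E≤D = ≤-trans (^-monoʳ-≤ g (m≤m*n E q)) g^c≤D

    κ₀ : ℕ
    κ₀ = D / g ^ E

    ≤κ₀ : ∀ j → j * g ^ E ≤ D → j ≤ κ₀
    ≤κ₀ j h = ≤-trans (≤-reflexive (sym (m*n/n≡m j (g ^ E)))) (/-monoˡ-≤ (g ^ E) h)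

    1≤κ₀ : 1 ≤ κ₀
    1≤κ₀ = ≤κ₀ 1 (≤-trans (≤-reflexive (*-identityˡ (g ^ E))) g^E≤D)

    codegree-bound : ∀ j → LeqPow1minus j D p q → j ≤ κ₀
    codegree-bound j hyp = ≤κ₀ j (≮⇒≥ λ lt → <-irrefl refl (begin-strict
      D ^ q                    <⟨ ^-monoˡ-< q lt ⟩
      (j * g ^ E) ^ q          ≡⟨ trans (^-distribʳ-* q j (g ^ E)) (cong (j ^ q *_) (^-*-assoc g E q)) ⟩
      j ^ q * g ^ c            ≤⟨ *-monoʳ-≤ (j ^ q) (≤-trans g^c≤D (≤-trans (≤-reflexive (sym (^-identityʳ D))) (^-monoʳ-≤ D 1≤p))) ⟩
      j ^ q * D ^ p            ≤⟨ hyp ⟩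
      D ^ q                    ∎))
      where open ≤-Reasoning

    -- `x` is about (1 + 1/g) r D: the smallest excess over the degree bound r D that the iteration
    -- can start from, up to rounding.
    z x : ℕ
    z = Division.ceil (r * D) g
    x = r * D + z

    g≤rD : g ≤ r * D
    g≤rD = ≤-trans g≤D (m≤n*m D r {{>-nonZero 1≤r}})

    zg≤2rD : z * g ≤ 2 * (r * D)
    zg≤2rD = ≤-trans (Division.ceil-upper (r * D) g) (+-monoʳ-≤ (r * D) (≤-trans g≤rD (m≤m+n (r * D) 0)))

    -- Equivalently D ^ (-1 / (2 c)) ≥ 2 / g, which follows from D < (g + 1) ^ c and is what the
    -- span hypothesis needs: the factor 2 absorbs the rounding of `z`.
    D≤g^2c : 4 ^ c * D ≤ g ^ (2 * c)
    D≤g^2c = begin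
      4 ^ c * D                ≤⟨ *-monoʳ-≤ (4 ^ c) (<⇒≤ D<[1+g]^c) ⟩
      4 ^ c * suc g ^ c        ≡⟨ sym (^-distribʳ-* c 4 (suc g)) ⟩
      (4 * suc g) ^ c          ≤⟨ ^-monoˡ-≤ c quad ⟩
      (g ^ 2) ^ c              ≡⟨ ^-*-assoc g 2 c ⟩
      g ^ (2 * c)              ∎
      where
      open ≤-Reasoning
      lem : ∀ g → 4 * (1 + g) + (6 + 6 * g) ≡ 10 * (1 + g)
      lem = solve-∀
      quad : 4 * suc g ≤ g ^ 2
      quad = begin
        4 * suc g              ≡⟨ *-suc 4 g ⟩
        4 + 4 * g              ≤⟨ +-monoˡ-≤ (4 * g) (≤-trans (m≤m+n 4 6) 10≤g) ⟩
        g + 4 * g              ≤⟨ *-monoˡ-≤ g {5} {10} (m≤m+n 5 5) ⟩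
        10 * g                 ≤⟨ *-monoˡ-≤ g 10≤g ⟩
        g * g                  ≡⟨ cong (g *_) (sym (*-identityʳ g)) ⟩
        g ^ 2                  ∎

    span-bound : ∀ N → GeqSpanBound N r D 1 (2 * c) → x ≤ N
    span-bound N (rD≤N , hyp) = ≤-trans (+-monoʳ-≤ (r * D) z≤) (≤-reflexive (m+[n∸m]≡n rD≤N))
      where
      open ≤-Reasoning
      e : ℕ
      e = N ∸ r * D
      instance
        2c≢0 : NonZero (2 * c)
        2c≢0 = m*n≢0 2 c {{_}} {{>-nonZero 1≤c}}
      shuffle : ∀ a b c → a * b * c ≡ c * (a * b)
      shuffle = solve-∀
      enough : 2 * (r * D) ≤ e * g
      enough = ≮⇒≥ λ lt → <-irrefl refl (begin-strict
        e ^ (2 * c) * (4 ^ c * D)            ≤⟨ *-monoʳ-≤ (e ^ (2 * c)) D≤g^2c ⟩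
        e ^ (2 * c) * g ^ (2 * c)            ≡⟨ sym (^-distribʳ-* (2 * c) e g) ⟩
        (e * g) ^ (2 * c)                    <⟨ ^-monoˡ-< (2 * c) lt ⟩
        (2 * (r * D)) ^ (2 * c)              ≡⟨ trans (^-distribʳ-* (2 * c) 2 (r * D)) (cong₂ _*_ (sym (^-*-assoc 2 2 c)) (^-distribʳ-* (2 * c) r D)) ⟩
        4 ^ c * (r ^ (2 * c) * D ^ (2 * c))  ≤⟨ *-monoʳ-≤ (4 ^ c) hyp ⟩
        4 ^ c * (e ^ (2 * c) * (D * 1))      ≡⟨ lem (4 ^ c) (e ^ (2 * c)) D ⟩
        e ^ (2 * c) * (4 ^ c * D)            ∎)
        where
        lem : ∀ a b D → a * (b * (D * 1)) ≡ b * (a * D)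
        lem = solve-∀
      z≤ : z ≤ e
      z≤ = *-cancelʳ-≤ z e g (≤-trans zg≤2rD enough)

    gap : (g + 1) * (r * D) ≤ g * x
    gap = begin
      (g + 1) * (r * D)        ≡⟨ lem g (r * D) ⟩
      g * (r * D) + r * D      ≤⟨ +-monoʳ-≤ (g * (r * D)) (Division.ceil-lower (r * D) g) ⟩
      g * (r * D) + z * g      ≡⟨ lem₂ g (r * D) z ⟩
      g * (r * D + z)          ∎
      where
      open ≤-Reasoning
      lem : ∀ g y → (g + 1) * y ≡ g * y + y
      lem = solve-∀
      lem₂ : ∀ g y z → g * y + z * g ≡ g * (y + z)
      lem₂ = solve-∀

    rounds : Σ ℕ λ n → 16 * R * g ≤ 2 ^ n × 2 ^ n ≤ 2 * (16 * R * g)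
    rounds = power-of-two (16 * R * g) (*-mono-≤ {1} {16 * R} (s≤s z≤n) (≤-trans (s≤s z≤n) 10≤g))

    n : ℕ
    n = proj₁ rounds

    2^n≤g² : 2 ^ n ≤ g * g
    2^n≤g² = ≤-trans (proj₂ (proj₂ rounds)) (≤-trans (≤-reflexive (lem R g)) (*-monoˡ-≤ g (linear 32 (m≤m+n 32 968))))
      where
      lem : ∀ R g → 2 * (16 * R * g) ≡ 32 * R * g
      lem = solve-∀

    F : ℕ
    F = g * g * (g * g * g)

    start : r * κ₀ * (F * F * F * F) * g * (2 ^ h) ^ n ≤ x
    start = begin
      r * κ₀ * (F * F * F * F) * g * (2 ^ h) ^ n
        ≡⟨ cong (r * κ₀ * (F * F * F * F) * g *_) (trans (^-*-assoc 2 h n) (trans (cong (2 ^_) (*-comm h n)) (sym (^-*-assoc 2 n h)))) ⟩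
      r * κ₀ * (F * F * F * F) * g * (2 ^ n) ^ h
        ≤⟨ *-monoʳ-≤ (r * κ₀ * (F * F * F * F) * g) (^-monoˡ-≤ h 2^n≤g²) ⟩
      r * κ₀ * (F * F * F * F) * g * (g * g) ^ h
        ≡⟨ lem r κ₀ (F * F * F * F) g ((g * g) ^ h) ⟩
      r * (κ₀ * (F * F * F * F * g * (g * g) ^ h))
        ≡⟨ cong (λ z → r * (κ₀ * z)) powers ⟩
      r * (κ₀ * g ^ E)
        ≤⟨ *-monoʳ-≤ r (m/n*n≤m D (g ^ E)) ⟩
      r * D
        ≤⟨ m≤m+n (r * D) z ⟩
      x ∎
      where
      open ≤-Reasoning
      lem : ∀ r κ F g H → r * κ * F * g * H ≡ r * (κ * (F * g * H))
      lem = solve-∀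
      power-5 : g * g * (g * g * g) ≡ g ^ 5
      power-5 = lem₅ g
        where
        lem₅ : ∀ g → g * g * (g * g * g) ≡ g * (g * (g * (g * (g * 1))))
        lem₅ = solve-∀
      powers : F * F * F * F * g * (g * g) ^ h ≡ g ^ E
      powers = trans (cong₂ _*_ (cong₂ _*_ four (sym (^-identityʳ g))) (trans (cong (_^ h) (cong (g *_) (sym (*-identityʳ g)))) (^-*-assoc g 2 h)))
        (trans (cong (_* g ^ (2 * h)) (sym (^-distribˡ-+-* g 20 1))) (sym (^-distribˡ-+-* g 21 (2 * h))))
        where
        lem₄ : ∀ a → a * a * a * a ≡ a * (a * (a * (a * 1)))
        lem₄ = solve-∀
        four : F * F * F * F ≡ g ^ 20
        four = trans (lem₄ F) (trans (cong (_^ 4) power-5) (^-*-assoc g 5 4))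

    enough : 12 * (2 * (x * R) ^ 3 * (3 * (x * R) ^ 3)) ≤ 2 ^ g
    enough = begin
      12 * (2 * (x * R) ^ 3 * (3 * (x * R) ^ 3))   ≡⟨ lem (x * R) ⟩
      72 * (x * R) ^ 6                             ≤⟨ *-mono-≤ 72≤g (^-monoˡ-≤ 6 xR≤) ⟩
      g * (g ^ (2 * c + 1)) ^ 6                    ≡⟨ cong (g *_) (^-*-assoc g (2 * c + 1) 6) ⟩
      g ^ suc ((2 * c + 1) * 6)                    ≡⟨ cong (g ^_) (lem₂ c) ⟩
      g ^ k                                        ≤⟨ poly≤exp k g (≤-trans (s≤s z≤n) (m≤n+m 7 (12 * c))) (≤-trans (m≤n+m (4 * (k * k)) (1000 * (R * R))) g₀≤g) ⟩
      2 ^ g                                        ∎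
      where
      open ≤-Reasoning
      lem : ∀ a → 12 * (2 * (a * (a * (a * 1))) * (3 * (a * (a * (a * 1))))) ≡ 72 * (a * (a * (a * (a * (a * (a * 1))))))
      lem = solve-∀
      lem₂ : ∀ c → suc ((2 * c + 1) * 6) ≡ 12 * c + 7
      lem₂ = solve-∀
      72≤g : 72 ≤ g
      72≤g = ≤-trans (*-monoʳ-≤ 72 (s≤s z≤n)) (linear 72 (m≤m+n 72 928))
      z≤rD : z ≤ r * D
      z≤rD = *-cancelʳ-≤ z (r * D) g (≤-trans zg≤2rD (≤-trans (≤-reflexive (*-comm 2 (r * D))) (*-monoʳ-≤ (r * D) (≤-trans (m≤m+n 2 8) 10≤g))))
      xR≤ : x * R ≤ g ^ (2 * c + 1)
      xR≤ = begin
        (r * D + z) * R                    ≤⟨ *-monoˡ-≤ R (+-monoʳ-≤ (r * D) z≤rD) ⟩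
        (r * D + r * D) * R                ≡⟨ lem₃ r D R ⟩
        D * (2 * (r * R))                  ≤⟨ *-mono-≤ (≤-trans (m≤n*m D (4 ^ c) {{m^n≢0 4 c}}) D≤g^2c)
                                                (≤-trans (*-mono-≤ (m≤m+n 2 998) (*-monoˡ-≤ R (n≤1+n r))) g-big) ⟩
        g ^ (2 * c) * g                    ≡⟨ trans (cong (g ^ (2 * c) *_) (sym (^-identityʳ g))) (sym (^-distribˡ-+-* g (2 * c) 1)) ⟩
        g ^ (2 * c + 1)                    ∎
        where
        lem₃ : ∀ r D R → (r * D + r * D) * R ≡ D * (2 * (r * R))
        lem₃ = solve-∀

theorem2p14 : ∀ (r : ℕ) → 2 ≤ r →
    ∀ (p q : ℕ) → 1 ≤ p → 1 ≤ q →
    Σ ℕ λ Dβ → Σ ℕ λ a → Σ ℕ λ b → 1 ≤ a × 1 ≤ b ×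
    (∀ (D : ℕ) → Dβ ≤ D →
    ∀ {n m k : ℕ} (G : ColHyp n m k) →
    Uniform G r →
    (∀ u v → ¬ (u ≡ v) → LeqPow1minus (codeg G u v) D p q) →
    (∀ c → Used G c → DisjointUnionOfCliques G r c) →
    (∀ c → Used G c → GeqSpanBound (spanC G c) r D a b) →
    (∀ v → colDeg G v ≤ D) →
    (Σ (Subset m) λ M₀ → FullRainbowMatching G M₀) ×
    Σ (Fin D → Subset m) λ M →
    (∀ i → FullRainbowMatching G (M i)) ×
    (∀ i j → ¬ (i ≡ j) → ∀ e → e ∈ M i → e ∈ M j → ⊥))
-- The exponent is α = 1 / (2 c), for which the hypothesis on spans yields the initial gap 1/g.
theorem2p14 r 2≤r p q 1≤p 1≤q = g₀ ^ c , 1 , 2 * c , s≤s z≤n , ≤-trans 1≤c (m≤m+n c (c + 0)) , main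
  where
  open Constants r p q 2≤r 1≤p 1≤q using (g₀; c; 1≤r; 1≤c; module Scale)

  main : ∀ (D : ℕ) → g₀ ^ c ≤ D →
    ∀ {n m k : ℕ} (G : ColHyp n m k) →
    Uniform G r →
    (∀ u v → ¬ (u ≡ v) → LeqPow1minus (codeg G u v) D p q) →
    (∀ c → Used G c → DisjointUnionOfCliques G r c) →
    (∀ c → Used G c → GeqSpanBound (spanC G c) r D 1 (2 * Constants.c r p q 2≤r 1≤p 1≤q)) →
    (∀ v → colDeg G v ≤ D) →
    (Σ (Subset m) λ M₀ → FullRainbowMatching G M₀) ×
    Σ (Fin D → Subset m) λ M →
    (∀ i → FullRainbowMatching G (M i)) ×
    (∀ i j → ¬ (i ≡ j) → ∀ e → e ∈ M i → e ∈ M j → ⊥)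
  main D D≥ {n} {m} {k} G uni codeg≤ cliques spans colDeg≤ =
    (M (fromℕ< (>-nonZero⁻¹ D)) , full (fromℕ< (>-nonZero⁻¹ D))) , M , full , edge-disjoint
    where
    open Scale D D≥ using (g; κ₀; 1≤κ₀; x; g-big; enough; start; gap; rounds; D≢0; codegree-bound; span-bound)
    copies = Palette.picks G r uni cliques x (λ c u → span-bound (spanC G c) (spans c u))
    open Copies G r 1≤r uni copies D κ₀ 1≤κ₀ (λ u v ne → codegree-bound (codeg G u v) (codeg≤ u v ne)) colDeg≤
    open Extract (Iterate.matching r g (r * κ₀) (n * D + m) (k * D) x g-big (*-mono-≤ 1≤r 1≤κ₀) enough
      (proj₁ rounds) (proj₁ (proj₂ rounds)) x start ≤-refl (r * D) system gap)
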